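{- Let $\operatorname{T}(X)$ denote the number of domino tilings of a region $X$, and let $R(n)$, $K_a(n)$, $K_{na}(n)$ be the quartered Aztec diamonds of order $n$ defined in the context. Then: (i) for every integer $n\ge 0$, $\operatorname{T}(R(4n+1))=\operatorname{T}(R(4n+2))=0$; and for every integer $n\ge 1$: (ii) $\displaystyle \operatorname{T}(R(4n))=2^n\operatorname{T}(R(4n-1))=2^{n(3n-1)/2}\prod_{1\le i<j\le n}\frac{2i+2j-1}{i+j-1}$; (iii) $\displaystyle \operatorname{T}(K_a(4n-2))=\operatorname{T}(K_a(4n))=2^{n(3n-1)/2}\prod_{1\le i<j\le n}\frac{2i+2j-3}{i+j-1}$; (iv) $\displaystyle \operatorname{T}(K_a(4n-1))=\operatorname{T}(K_a(4n+1))=2^{n(3n-3)/2}\prod_{1\le i\le j\le n}\frac{2i+2j-1}{i+j-1}$; (v) $\displaystyle \operatorname{T}(K_{na}(4n))=\operatorname{T}(K_{na}(4n+2))=2^{n(3n-1)/2}\prod_{1\le i\le j\le n}\frac{2i+2j-1}{i+j-1}$; (vi) $\displaystyle \operatorname{T}(K_{na}(4n-3))=\operatorname{T}(K_{na}(4n-1))=2^{n(3n-3)/2}\prod_{1\le i<j\le n}\frac{2i+2j-3}{i+j-1}$. (Empty products equal $1$.)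
   Context: A domino is the union of two unit squares of the square lattice sharing an edge; a (domino) tiling of a region (a finite union of lattice unit squares) is a covering of it by dominoes without gaps or overlaps; $\operatorname{T}(X)$ is the number of tilings of $X$ (the empty region has exactly one tiling). For integers $a,b$ let $S_{a,b}=[a,a+1]\times[b,b+1]$. The Aztec diamond of order $n$ is the union of the squares $S_{a,b}$ with $|a+\tfrac12|+|b+\tfrac12|\le n$ (equivalently, all four corners $(x,y)$ satisfy $|x|+|y|\le n+1$). Quartered Aztec diamonds are the four pieces obtained by cutting the Aztec diamond of order $n$ along two zigzag lattice paths with steps of length 2 passing through its center; explicitly: $R(n)$ is the union of the squares $S_{a,b}$ of the Aztec diamond of order $n$ with $b\ge 2\lceil a/2\rceil$ and $a\ge -2\lceil b/2\rceil$ (the pieces for the fourfold rotationally symmetric pair of cuts); the abutting quartered Aztec diamond $K_a(n)$ is the union of the squares $S_{a,b}$ of the Aztec diamond of order $n$ with $b\ge 2\,|\lceil a/2\rceil|$; the non-abutting quartered Aztec diamond $K_{na}(n)$ is the union of the squares $S_{a,b}$ of the Aztec diamond of order $n$ with $-2\lceil a/2\rceil\le b\le 2\lceil a/2\rceil-1$ (the last two being pieces for the reflection-symmetric pair of cuts). -}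

module Defs where

open import Data.Nat as ℕ using (ℕ; zero; suc; ⌊_/2⌋; ⌈_/2⌉)
open import Data.Integer as ℤ using (ℤ; +_; -[1+_]; ∣_∣)
open import Data.Product using (Σ; _×_; _,_)
open import Data.Sum using (_⊎_)
open import Data.List using (List; length; lookup)
open import Data.List.Membership.Propositional using (_∈_)
open import Data.Vec as Vec using (Vec)
open import Data.Fin using (Fin)
open import Relation.Binary.PropositionalEquality using (_≡_)

-- The unit square S_{a,b} = [a,a+1] × [b,b+1] is identified with (a , b).
Square : Set
Square = ℤ × ℤ

Region : Set₁
Region = ℤ → ℤ → Set

-- A domino: hor a b = S_{a,b} ∪ S_{a+1,b};  ver a b = S_{a,b} ∪ S_{a,b+1}.
data Domino : Set where
  hor : ℤ → ℤ → Domino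
  ver : ℤ → ℤ → Domino

Covers : Domino → ℤ → ℤ → Set
Covers (hor a b) x y = (x ≡ a × y ≡ b) ⊎ (x ≡ a ℤ.+ ℤ.1ℤ × y ≡ b)
Covers (ver a b) x y = (x ≡ a × y ≡ b) ⊎ (x ≡ a × y ≡ b ℤ.+ ℤ.1ℤ)

IsTiling : Region → List Domino → Set
IsTiling X ds =
  (∀ (i : Fin (length ds)) x y → Covers (lookup ds i) x y → X x y) ×
  (∀ x y → X x y →
     Σ (Fin (length ds)) λ i → Covers (lookup ds i) x y ×
       (∀ (j : Fin (length ds)) → Covers (lookup ds j) x y → j ≡ i))

-- Two lists describe the same tiling iff they have the same dominoes.
_∼_ : List Domino → List Domino → Set
ds ∼ es = ∀ d → (d ∈ ds → d ∈ es) × (d ∈ es → d ∈ ds)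

NumTilings : Region → ℕ → Set
NumTilings X k =
  Σ (Vec (List Domino) k) λ v →
    (∀ i → IsTiling X (Vec.lookup v i)) ×
    (∀ i j → Vec.lookup v i ∼ Vec.lookup v j → i ≡ j) ×
    (∀ ds → IsTiling X ds → Σ (Fin k) λ i → ds ∼ Vec.lookup v i)

ceilHalf : ℤ → ℤ
ceilHalf (+ n) = + ⌈ n /2⌉
ceilHalf -[1+ n ] = ℤ.- (+ ⌊ suc n /2⌋)

-- S_{a,b} ∈ AD(n)  iff  |a + 1/2| + |b + 1/2| ≤ n  iff  |2a+1| + |2b+1| ≤ 2n
Aztec : ℕ → Region
Aztec n a b = ∣ ℤ.+ 2 ℤ.* a ℤ.+ ℤ.1ℤ ∣ ℕ.+ ∣ ℤ.+ 2 ℤ.* b ℤ.+ ℤ.1ℤ ∣ ℕ.≤ 2 ℕ.* n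

R : ℕ → Region
R n a b = Aztec n a b × (ℤ.+ 2 ℤ.* ceilHalf a ℤ.≤ b) × (ℤ.- (ℤ.+ 2 ℤ.* ceilHalf b) ℤ.≤ a)

Ka : ℕ → Region
Ka n a b = Aztec n a b × (ℤ.+ 2 ℤ.* (+ ∣ ceilHalf a ∣) ℤ.≤ b)

Kna : ℕ → Region
Kna n a b = Aztec n a b × (ℤ.- (ℤ.+ 2 ℤ.* ceilHalf a) ℤ.≤ b)
                        × (b ℤ.≤ ℤ.+ 2 ℤ.* ceilHalf a ℤ.- ℤ.1ℤ)

prod : ℕ → (ℕ → ℕ) → ℕ
prod zero f = 1
prod (suc m) f = prod m f ℕ.* f (suc m)

prodLt : ℕ → (ℕ → ℕ → ℕ) → ℕ
prodLt n f = prod n (λ j → prod (j ℕ.∸ 1) (λ i → f i j))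

prodLe : ℕ → (ℕ → ℕ → ℕ) → ℕ
prodLe n f = prod n (λ j → prod j (λ i → f i j))

{-# OPTIONS --safe #-}
module Submission where

-- In the rotated coordinates r = a + b + 1 and p = b - a (p = a - b for K_na) every domino joins
-- (r , p) to (r + 1 , p ± 1), and all three quartered diamonds become the same stack of rows:
-- 0 < p ≤ n, with p = 0 allowed in every fourth row, and with every other cell missing in row 0.
-- Matching the rows one after another, the number of completions of a partial row is a
-- determinant det (f_i(p_j)): if the p_j are the cells of the row, each of them moves to p_j ± 1
-- (collisions cancel by antisymmetry), so f is replaced by f(p - 1) + f(p + 1); if the p_j are its
-- empty sites, the next positions interlace them and f is replaced by an antiderivative for the
-- step-2 difference.  The wall makes the f_i alternately even and odd polynomials, so up to constants
-- they remain 1, p², p⁴, … or p, p³, …, and the determinant for row 0, whose p_j form an arithmetic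
-- progression of difference 4, is a Vandermonde product.

-- The cells that a matching removes from the next row are the empty sites of what remains there, so
-- formulas in the cells and formulas in the empty sites alternate from row to row. The number k of
-- functions changes only under integration. Where nothing fixes the constant of integration, the
-- constant function is adjoined to the determinant; this happens once in every four rows. In the
-- other integration steps a virtual empty site to the left of the row fixes the constant. Comparing
-- k with the number of points in row 0 gives the vanishing for the orders 4n + 1 and 4n + 2.
--
-- Integration also brings denominators. To stay in the integers, every formula has the form count ·
-- C = ± D · det: leading coefficients due to integration are collected in C, those due to sums over
-- two neighbours in D. In the end they account for the product formula: the coefficients of odd
-- functions cancel the differences j - i of the Vandermonde product, those of even functions make
-- up the factors i + j - 1, and powers of two remain.

-- Exterior algebra of functions on the sites; hopping and interlacing operators.

module Determinants where

  open import Data.Nat as ℕ using (ℕ; zero; suc)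
  import Data.Nat.Properties as ℕₚ
  open import Data.Integer using (ℤ; +_; -_; _+_; _-_; _*_; 0ℤ; 1ℤ)
  open import Data.Integer.Properties using (*-zeroʳ; +-inverseʳ; +-identityʳ)
  open import Data.Integer.Tactic.RingSolver using (solve-∀)
  open import Data.List using (List; []; _∷_; map; length; _++_)
  open import Data.Sum using (inj₁; inj₂)
  open import Function using (_∘_)
  open import Relation.Nullary using (contradiction)
  open import Relation.Binary.PropositionalEquality using (_≡_; _≢_; _≗_; refl; sym; trans; cong; cong₂; module ≡-Reasoning)
  open ≡-Reasoning

  Fn Form : Set
  Fn = ℕ → ℤ
  Form = List ℕ → ℤ

  infixr 7 _·_
  _·_ : {A : Set} → ℤ → (A → ℤ) → A → ℤ
  (c · f) x = c * f x

  infixr 6 _⊕_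
  _⊕_ : {A : Set} → (A → ℤ) → (A → ℤ) → A → ℤ
  (f ⊕ g) x = f x + g x

  infixl 8 _⟨_⟩
  _⟨_⟩ : Form → ℕ → Form
  (φ ⟨ x ⟩) xs = φ (x ∷ xs)

  ε : Form
  ε []      = 1ℤ
  ε (_ ∷ _) = 0ℤ

  -- The exterior product f ∧ φ, expanded along the first argument.
  D : Fn → Form → Form
  D f φ []       = 0ℤ
  D f φ (x ∷ xs) = f x * φ xs - D f (φ ⟨ x ⟩) xs

  det : List Fn → Form
  det []       = ε
  det (f ∷ fs) = D f (det fs)

  D-cong : ∀ {f g φ ψ} → f ≗ g → φ ≗ ψ → D f φ ≗ D g ψ
  D-cong f≗g φ≗ψ []       = refl
  D-cong f≗g φ≗ψ (x ∷ xs) =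
    cong₂ _-_ (cong₂ _*_ (f≗g x) (φ≗ψ xs)) (D-cong f≗g (λ ys → φ≗ψ (x ∷ ys)) xs)

  D-+ˡ : ∀ f g φ → D (f ⊕ g) φ ≗ D f φ ⊕ D g φ
  D-+ˡ f g φ []       = refl
  D-+ˡ f g φ (x ∷ xs) rewrite D-+ˡ f g (φ ⟨ x ⟩) xs = lemma (f x) (g x) (φ xs) _ _
    where
    lemma : ∀ a b p u v → (a + b) * p - (u + v) ≡ (a * p - u) + (b * p - v)
    lemma = solve-∀

  D-·ˡ : ∀ c f φ → D (c · f) φ ≗ c · D f φ
  D-·ˡ c f φ []       = sym (*-zeroʳ c)
  D-·ˡ c f φ (x ∷ xs) rewrite D-·ˡ c f (φ ⟨ x ⟩) xs = lemma c (f x) (φ xs) _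
    where
    lemma : ∀ c a p u → (c * a) * p - c * u ≡ c * (a * p - u)
    lemma = solve-∀

  D-+ʳ : ∀ f φ ψ → D f (φ ⊕ ψ) ≗ D f φ ⊕ D f ψ
  D-+ʳ f φ ψ []       = refl
  D-+ʳ f φ ψ (x ∷ xs) rewrite D-+ʳ f (φ ⟨ x ⟩) (ψ ⟨ x ⟩) xs = lemma (f x) (φ xs) (ψ xs) _ _
    where
    lemma : ∀ a p q u v → a * (p + q) - (u + v) ≡ (a * p - u) + (a * q - v)
    lemma = solve-∀

  D-·ʳ : ∀ c f φ → D f (c · φ) ≗ c · D f φ
  D-·ʳ c f φ []       = sym (*-zeroʳ c)
  D-·ʳ c f φ (x ∷ xs) rewrite D-·ʳ c f (φ ⟨ x ⟩) xs = lemma c (f x) (φ xs) _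
    where
    lemma : ∀ c a p u → a * (c * p) - c * u ≡ c * (a * p - u)
    lemma = solve-∀

  D-0ʳ : ∀ f {φ} → (∀ xs → φ xs ≡ 0ℤ) → ∀ xs → D f φ xs ≡ 0ℤ
  D-0ʳ f φ≡0 []       = refl
  D-0ʳ f φ≡0 (x ∷ xs) rewrite φ≡0 xs | D-0ʳ f (λ ys → φ≡0 (x ∷ ys)) xs = lemma (f x)
    where
    lemma : ∀ a → a * 0ℤ - 0ℤ ≡ 0ℤ
    lemma = solve-∀

  D-sub : ∀ f c φ ψ → D f (λ xs → c * φ xs - ψ xs) ≗ (λ xs → c * D f φ xs - D f ψ xs)
  D-sub f c φ ψ xs = begin
    D f (λ ys → c * φ ys - ψ ys) xs          ≡⟨ D-cong (λ _ → refl) (λ ys → lemma c (φ ys) (ψ ys)) xs ⟩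
    D f (c · φ ⊕ - 1ℤ · ψ) xs                ≡⟨ D-+ʳ f (c · φ) (- 1ℤ · ψ) xs ⟩
    D f (c · φ) xs + D f (- 1ℤ · ψ) xs       ≡⟨ cong₂ _+_ (D-·ʳ c f φ xs) (D-·ʳ (- 1ℤ) f ψ xs) ⟩
    c * D f φ xs + - 1ℤ * D f ψ xs           ≡⟨ sym (lemma c (D f φ xs) (D f ψ xs)) ⟩
    c * D f φ xs - D f ψ xs                  ∎
    where
    lemma : ∀ c p q → c * p - q ≡ c * p + - 1ℤ * q
    lemma = solve-∀

  D-unfold : ∀ f g φ x xs →
    D f (D g φ) (x ∷ xs) ≡ f x * D g φ xs - (g x * D f φ xs - D f (D g (φ ⟨ x ⟩)) xs)
  D-unfold f g φ x xs = cong (λ z → f x * D g φ xs - z) (D-sub f (g x) φ (D g (φ ⟨ x ⟩)) xs)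

  D-anticomm : ∀ f g φ xs → D f (D g φ) xs ≡ - D g (D f φ) xs
  D-anticomm f g φ []       = refl
  D-anticomm f g φ (x ∷ xs)
    rewrite D-unfold f g φ x xs | D-unfold g f φ x xs | D-anticomm f g (φ ⟨ x ⟩) xs
    = lemma (f x * D g φ xs) (g x * D f φ xs) _
    where
    lemma : ∀ a b u → a - (b - - u) ≡ - (b - (a - u))
    lemma = solve-∀

  D-square : ∀ f φ xs → D f (D f φ) xs ≡ 0ℤ
  D-square f φ []       = refl
  D-square f φ (x ∷ xs) rewrite D-unfold f f φ x xs | D-square f (φ ⟨ x ⟩) xs = lemma (f x * D f φ xs)
    where
    lemma : ∀ a → a - (a - 0ℤ) ≡ 0ℤ
    lemma = solve-∀

  below : {A : Set} → (ℕ → A) → ℕ → List A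
  below b zero    = []
  below b (suc k) = b k ∷ below b k

  -- Anticommutation carries the repeated factor inwards until it meets its copy, where `D-square`
  -- applies.
  det-repeat : ∀ b {i k} → i ℕ.< k → ∀ xs → D (b i) (det (below b k)) xs ≡ 0ℤ
  det-repeat b {i} {suc k} (ℕ.s≤s i≤k) xs with ℕₚ.m≤n⇒m<n∨m≡n i≤k
  ... | inj₂ refl = D-square (b k) (det (below b k)) xs
  ... | inj₁ i<k  = begin
    D (b i) (D (b k) φ) xs   ≡⟨ D-anticomm (b i) (b k) φ xs ⟩
    - D (b k) (D (b i) φ) xs ≡⟨ cong -_ (D-0ʳ (b k) (det-repeat b i<k) xs) ⟩
    - 0ℤ                     ∎
    where φ = det (below b k)

  -- f is c · b i modulo the span of b 0 , … , b (i-1).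
  data Lead {A : Set} (b : ℕ → A → ℤ) : ℕ → ℤ → (A → ℤ) → Set where
    base : ∀ {c f} → f ≗ c · b 0 → Lead b 0 c f
    step : ∀ {i c f c′ g} → Lead b i c′ g → f ≗ (c · b (suc i)) ⊕ g → Lead b (suc i) c f

  det-lead-0 : ∀ b {i k c} f → Lead b i c f → i ℕ.< k → ∀ xs → D f (det (below b k)) xs ≡ 0ℤ
  det-lead-0 b {zero} {k} {c} f (base f≗) i<k xs = begin
    D f (det (below b k)) xs         ≡⟨ D-cong f≗ (λ _ → refl) xs ⟩
    D (c · b 0) (det (below b k)) xs ≡⟨ D-·ˡ c (b 0) _ xs ⟩
    c * D (b 0) (det (below b k)) xs ≡⟨ cong (c *_) (det-repeat b i<k xs) ⟩
    c * 0ℤ                           ≡⟨ *-zeroʳ c ⟩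
    0ℤ                               ∎
  det-lead-0 b {suc i} {k} {c} f (step {g = g} lg f≗) i<k xs = begin
    D f φ xs                            ≡⟨ D-cong f≗ (λ _ → refl) xs ⟩
    D ((c · b (suc i)) ⊕ g) φ xs        ≡⟨ D-+ˡ (c · b (suc i)) g φ xs ⟩
    D (c · b (suc i)) φ xs + D g φ xs   ≡⟨ cong₂ _+_ (D-·ˡ c (b (suc i)) φ xs)
                                             (det-lead-0 b g lg (ℕₚ.<-trans (ℕₚ.n<1+n i) i<k) xs) ⟩
    c * D (b (suc i)) φ xs + 0ℤ         ≡⟨ cong (λ z → c * z + 0ℤ) (det-repeat b i<k xs) ⟩
    c * 0ℤ + 0ℤ                         ≡⟨ cong (_+ 0ℤ) (*-zeroʳ c) ⟩
    0ℤ                                  ∎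
    where φ = det (below b k)

  -- The lower part of `f` lies in the span of the functions already wedged together, so only the
  -- leading coefficient survives.
  D-lead : ∀ b {k c} f → Lead b k c f → ∀ xs →
    D f (det (below b k)) xs ≡ c * det (below b (suc k)) xs
  D-lead b {zero} {c} f (base f≗) xs = trans (D-cong f≗ (λ _ → refl) xs) (D-·ˡ c (b 0) ε xs)
  D-lead b {suc k} {c} f (step {g = g} lg f≗) xs = begin
    D f φ xs                            ≡⟨ D-cong f≗ (λ _ → refl) xs ⟩
    D ((c · b (suc k)) ⊕ g) φ xs        ≡⟨ D-+ˡ (c · b (suc k)) g φ xs ⟩
    D (c · b (suc k)) φ xs + D g φ xs   ≡⟨ cong₂ _+_ (D-·ˡ c (b (suc k)) φ xs)
                                             (det-lead-0 b g lg (ℕₚ.n<1+n k) xs) ⟩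
    c * D (b (suc k)) φ xs + 0ℤ         ≡⟨ +-identityʳ _ ⟩
    c * D (b (suc k)) φ xs              ∎
    where φ = det (below b (suc k))

  ∏ : (ℕ → ℤ) → ℕ → ℤ
  ∏ c zero    = 1ℤ
  ∏ c (suc k) = c k * ∏ c k

  -- A triangular change of basis. After each row it brings the new functions back to monomials at
  -- the price of a constant.
  det-lead : ∀ b f c → (∀ i → Lead b i (c i) (f i)) → ∀ k →
    det (below f k) ≗ ∏ c k · det (below b k)
  det-lead b f c lead zero    xs = lemma (ε xs)
    where
    lemma : ∀ a → a ≡ 1ℤ * a
    lemma = solve-∀
  det-lead b f c lead (suc k) xs = begin
    D (f k) (det (below f k)) xs             ≡⟨ D-cong (λ _ → refl) (det-lead b f c lead k) xs ⟩
    D (f k) (∏ c k · det (below b k)) xs     ≡⟨ D-·ʳ (∏ c k) (f k) _ xs ⟩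
    ∏ c k * D (f k) (det (below b k)) xs     ≡⟨ cong (∏ c k *_) (D-lead b (f k) (lead k) xs) ⟩
    ∏ c k * (c k * det (below b (suc k)) xs) ≡⟨ lemma (∏ c k) (c k) _ ⟩
    (c k * ∏ c k) * det (below b (suc k)) xs ∎
    where
    lemma : ∀ p q d → p * (q * d) ≡ (q * p) * d
    lemma = solve-∀

  -- Forms are defined on lists of every length and vanish off their degree. This is what makes
  -- counts vanish when row 0 has the wrong number of points.
  det-length : ∀ fs xs → length xs ≢ length fs → det fs xs ≡ 0ℤ
  det-length []       []       ne = contradiction refl ne
  det-length []       (x ∷ xs) ne = refl
  det-length (f ∷ fs) xs       ne = D-length f (det-length fs) xs ne
    where
    D-length : ∀ f {φ n} → (∀ ys → length ys ≢ n → φ ys ≡ 0ℤ) → ∀ ys → length ys ≢ suc n → D f φ ys ≡ 0ℤ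
    D-length f       φ≡0 []       ne = refl
    D-length f {φ} {zero} φ≡0 (y ∷ ys) ne
      rewrite φ≡0 ys (ne ∘ cong suc) | D-0ʳ f (λ zs → φ≡0 (y ∷ zs) (λ ())) ys = trans (+-identityʳ _) (*-zeroʳ (f y))
    D-length f {φ} {suc n} φ≡0 (y ∷ ys) ne
      rewrite φ≡0 ys (ne ∘ cong suc)
            | D-length f {φ ⟨ y ⟩} {n} (λ zs ne′ → φ≡0 (y ∷ zs) (ne′ ∘ ℕₚ.suc-injective)) ys (ne ∘ cong suc)
      = trans (+-identityʳ _) (*-zeroʳ (f y))

  det-map : ∀ (h : ℕ → ℕ) (f : ℕ → Fn) k xs → det (below f k) (map h xs) ≡ det (below (λ i → f i ∘ h) k) xs
  det-map h f zero    []       = refl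
  det-map h f zero    (x ∷ xs) = refl
  det-map h f (suc k) xs = trans (D-map (f k) (det (below f k)) xs) (D-cong (λ _ → refl) (det-map h f k) xs)
    where
    D-map : ∀ f φ xs → D f φ (map h xs) ≡ D (f ∘ h) (φ ∘ map h) xs
    D-map f φ []       = refl
    D-map f φ (x ∷ xs) = cong (λ z → f (h x) * φ (map h xs) - z) (D-map f (φ ⟨ h x ⟩) xs)

  -- Adjacent arguments suffice, since rows are read from left to right and only neighbouring
  -- particles can collide.
  Alternating : Form → Set
  Alternating φ = ∀ xs y zs → φ (xs ++ y ∷ y ∷ zs) ≡ 0ℤ

  D-alternating : ∀ f {φ} → Alternating φ → Alternating (D f φ)
  D-alternating f {φ} alt [] y zs
    rewrite D-0ʳ f {φ ⟨ y ⟩ ⟨ y ⟩} (alt [] y) zs = lemma (f y * φ (y ∷ zs))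
    where
    lemma : ∀ a → a - (a - 0ℤ) ≡ 0ℤ
    lemma = solve-∀
  D-alternating f {φ} alt (x ∷ xs) y zs
    rewrite alt xs y zs | D-alternating f {φ ⟨ x ⟩} (λ ws → alt (x ∷ ws)) xs y zs
    = trans (+-identityʳ _) (*-zeroʳ (f x))

  det-alternating : ∀ fs → Alternating (det fs)
  det-alternating []       []       y zs = refl
  det-alternating []       (x ∷ xs) y zs = refl
  det-alternating (f ∷ fs) = D-alternating f (det-alternating fs)

  -- Site x of a row lies between the sites x - 1 and x of the next row.
  hop : Form → Form
  hop φ []           = φ []
  hop φ (0 ∷ xs)     = hop (φ ⟨ 0 ⟩) xs
  hop φ (suc x ∷ xs) = hop (φ ⟨ x ⟩) xs + hop (φ ⟨ suc x ⟩) xs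

  hopFn : Fn → Fn
  hopFn f 0       = f 0
  hopFn f (suc x) = f x + f (suc x)

  hop-sub : ∀ c φ ψ xs → hop (λ ys → c * φ ys - ψ ys) xs ≡ c * hop φ xs - hop ψ xs
  hop-sub c φ ψ []       = refl
  hop-sub c φ ψ (0 ∷ xs) = hop-sub c (φ ⟨ 0 ⟩) (ψ ⟨ 0 ⟩) xs
  hop-sub c φ ψ (suc x ∷ xs)
    rewrite hop-sub c (φ ⟨ x ⟩) (ψ ⟨ x ⟩) xs | hop-sub c (φ ⟨ suc x ⟩) (ψ ⟨ suc x ⟩) xs
    = lemma c (hop (φ ⟨ x ⟩) xs) (hop (φ ⟨ suc x ⟩) xs) _ _
    where
    lemma : ∀ c p q u v → (c * p - u) + (c * q - v) ≡ c * (p + q) - (u + v)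
    lemma = solve-∀

  hop-0 : ∀ {φ} → (∀ xs → φ xs ≡ 0ℤ) → ∀ xs → hop φ xs ≡ 0ℤ
  hop-0 e []       = e []
  hop-0 e (0 ∷ xs) = hop-0 (λ ys → e (0 ∷ ys)) xs
  hop-0 e (suc x ∷ xs) rewrite hop-0 (λ ys → e (x ∷ ys)) xs | hop-0 (λ ys → e (suc x ∷ ys)) xs = refl

  -- `hop` moves every argument independently, so it is the map induced on forms by the linear map
  -- `hopFn` and respects exterior products.
  hop-D : ∀ f φ xs → hop (D f φ) xs ≡ D (hopFn f) (hop φ) xs
  hop-D f φ []       = refl
  hop-D f φ (0 ∷ xs) = trans (hop-sub (f 0) φ (D f (φ ⟨ 0 ⟩)) xs)
                             (cong (λ z → f 0 * hop φ xs - z) (hop-D f (φ ⟨ 0 ⟩) xs))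
  hop-D f φ (suc x ∷ xs)
    rewrite hop-sub (f x) φ (D f (φ ⟨ x ⟩)) xs | hop-sub (f (suc x)) φ (D f (φ ⟨ suc x ⟩)) xs
          | hop-D f (φ ⟨ x ⟩) xs | hop-D f (φ ⟨ suc x ⟩) xs
          | D-+ʳ (hopFn f) (hop (φ ⟨ x ⟩)) (hop (φ ⟨ suc x ⟩)) xs
    = lemma (f x) (f (suc x)) (hop φ xs) _ _
    where
    lemma : ∀ a b p u v → (a * p - u) + (b * p - v) ≡ (a + b) * p - (u + v)
    lemma = solve-∀

  hop-det : ∀ (f : ℕ → Fn) k xs → hop (det (below f k)) xs ≡ det (below (hopFn ∘ f) k) xs
  hop-det f zero    []           = refl
  hop-det f zero    (0 ∷ xs)     = hop-0 (λ _ → refl) xs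
  hop-det f zero    (suc x ∷ xs) = cong₂ _+_ (hop-0 (λ _ → refl) xs) (hop-0 (λ _ → refl) xs)
  hop-det f (suc k) xs = trans (hop-D (f k) (det (below f k)) xs) (D-cong (λ _ → refl) (hop-det f k) xs)

  Σ< : Fn → Fn
  Σ< f zero    = 0ℤ
  Σ< f (suc n) = Σ< f n + f n

  Σ<-cong : ∀ {f g} → f ≗ g → Σ< f ≗ Σ< g
  Σ<-cong e zero    = refl
  Σ<-cong e (suc n) = cong₂ _+_ (Σ<-cong e n) (e n)

  Σ<-0 : ∀ {f} → (∀ x → f x ≡ 0ℤ) → ∀ n → Σ< f n ≡ 0ℤ
  Σ<-0 e zero    = refl
  Σ<-0 e (suc n) rewrite Σ<-0 e n | e n = refl

  Σ<-lin : ∀ f p g n → Σ< (λ x → f x * p - g x) n ≡ Σ< f n * p - Σ< g n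
  Σ<-lin f p g zero    = sym (lemma p)
    where
    lemma : ∀ p → 0ℤ * p - 0ℤ ≡ 0ℤ
    lemma = solve-∀
  Σ<-lin f p g (suc n) rewrite Σ<-lin f p g n = lemma (Σ< f n) (f n) p (Σ< g n) (g n)
    where
    lemma : ∀ s a p t b → (s * p - t) + (a * p - b) ≡ (s + a) * p - (t + b)
    lemma = solve-∀

  Σ<-telescope : ∀ (F : Fn) n → Σ< (λ x → F (suc x) - F x) n ≡ F n - F 0
  Σ<-telescope F zero    = sym (+-inverseʳ (F 0))
  Σ<-telescope F (suc n) rewrite Σ<-telescope F n = lemma (F n) (F 0) (F (suc n))
    where
    lemma : ∀ a b c → (a - b) + (c - a) ≡ c - b
    lemma = solve-∀

  -- Sum of φ over the sequences interlacing a , h₁ , h₂ , …: one site in each of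
  -- [a , h₁) , [h₁ , h₂) , …; an interval with h < a counts negatively.
  interlace : ℕ → Form → Form
  interlace a φ []       = φ []
  interlace a φ (h ∷ hs) = Σ< Φ h - Σ< Φ a
    where Φ = λ b → interlace h (φ ⟨ b ⟩) hs

  -- The first argument becomes the initial endpoint, so the degree of the form goes up by one.
  J : Form → Form
  J φ []       = 0ℤ
  J φ (h ∷ hs) = interlace h φ hs

  interlace-sub : ∀ a c φ ψ hs → interlace a (λ ys → c * φ ys - ψ ys) hs ≡ c * interlace a φ hs - interlace a ψ hs
  interlace-sub a c φ ψ []       = refl
  interlace-sub a c φ ψ (h ∷ hs) = begin
    Σ< Θ h - Σ< Θ a
      ≡⟨ cong₂ _-_ (trans (Σ<-cong e h) (Σ<-lin Φ c Ψ h)) (trans (Σ<-cong e a) (Σ<-lin Φ c Ψ a)) ⟩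
    (Σ< Φ h * c - Σ< Ψ h) - (Σ< Φ a * c - Σ< Ψ a)
      ≡⟨ lemma c (Σ< Φ h) (Σ< Φ a) (Σ< Ψ h) (Σ< Ψ a) ⟩
    c * (Σ< Φ h - Σ< Φ a) - (Σ< Ψ h - Σ< Ψ a) ∎
    where
    Θ Φ Ψ : Fn
    Θ b = interlace h (λ ys → c * φ (b ∷ ys) - ψ (b ∷ ys)) hs
    Φ b = interlace h (φ ⟨ b ⟩) hs
    Ψ b = interlace h (ψ ⟨ b ⟩) hs
    comm : ∀ x y z → x * y - z ≡ y * x - z
    comm = solve-∀
    e : ∀ b → Θ b ≡ Φ b * c - Ψ b
    e b = trans (interlace-sub h c (φ ⟨ b ⟩) (ψ ⟨ b ⟩) hs) (comm c (Φ b) (Ψ b))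
    lemma : ∀ c p q u v → (p * c - u) - (q * c - v) ≡ c * (p - q) - (u - v)
    lemma = solve-∀

  -- With signed intervals, [a , h′) = [a , h) + [h , h′) for every position of h; the part over [a
  -- , h) fixes the first site and leaves `J` of the rest.
  interlace-split : ∀ a h φ hs →
    interlace a φ hs ≡ interlace h φ hs + (Σ< (λ b → J (φ ⟨ b ⟩) hs) h - Σ< (λ b → J (φ ⟨ b ⟩) hs) a)
  interlace-split a h φ [] rewrite Σ<-0 (λ _ → refl) h | Σ<-0 {λ _ → 0ℤ} (λ _ → refl) a = sym (+-identityʳ (φ []))
  interlace-split a h φ (h′ ∷ hs) = lemma (Σ< Φ h′) (Σ< Φ h) (Σ< Φ a)
    where
    Φ = λ b → interlace h′ (φ ⟨ b ⟩) hs
    lemma : ∀ x y z → x - z ≡ (x - y) + (y - z)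
    lemma = solve-∀

  Δ : Fn → Fn
  Δ F x = F (suc x) - F x

  D-Σ< : ∀ F (Φ : ℕ → Form) n xs → D F (λ ys → Σ< (λ b → Φ b ys) n) xs ≡ Σ< (λ b → D F (Φ b) xs) n
  D-Σ< F Φ zero    xs = D-0ʳ F (λ _ → refl) xs
  D-Σ< F Φ (suc n) xs = trans (D-+ʳ F _ (Φ n) xs) (cong (_+ D F (Φ n) xs) (D-Σ< F Φ n xs))


  Σ<-lin₂ : ∀ f p X q Y n → Σ< (λ b → f b * p + (X b * q - Y b)) n ≡ Σ< f n * p + (Σ< X n * q - Σ< Y n)
  Σ<-lin₂ f p X q Y zero    = refl
  Σ<-lin₂ f p X q Y (suc n) rewrite Σ<-lin₂ f p X q Y n = lemma (Σ< f n) (f n) p (Σ< X n) (X n) q (Σ< Y n) (Y n)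
    where
    lemma : ∀ s a p t b q u v →
      (s * p + (t * q - u)) + (a * p + (b * q - v)) ≡ (s + a) * p + ((t + b) * q - (u + v))
    lemma = solve-∀

  -- Summation by parts: summing over interlacing sequences integrates each factor.
  interlace-D : ∀ F φ a hs → interlace a (D (Δ F) φ) hs ≡ - D F (J φ) (a ∷ hs)
  interlace-D F φ a [] = sym (cong -_ (trans (+-identityʳ _) (*-zeroʳ (F a))))
  interlace-D F φ a (h ∷ hs) = begin
    Σ< Φ h - Σ< Φ a
      -- Both sums telescope in `F` with the same lower boundary value `F 0`, which cancels in their
      -- difference.
      ≡⟨ cong₂ _-_ (ΣΦ h) (ΣΦ a) ⟩
    ((F h - F 0) * p + (Σ< X h * F h - Σ< Y h)) - ((F a - F 0) * p + (Σ< X a * F h - Σ< Y a))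
      ≡⟨ lemma (F h) (F 0) (F a) p (Σ< X h) (Σ< X a) (Σ< Y h) (Σ< Y a) ⟩
    - (F a * p - (F h * (p + (Σ< X h - Σ< X a)) - (Σ< Y h - Σ< Y a)))
      ≡⟨ cong (λ z → - (F a * p - z)) (cong₂ _-_ (cong (F h *_) (sym (interlace-split a h φ hs))) (sym DY)) ⟩
    - (F a * p - (F h * interlace a φ hs - D F (J φ ⟨ a ⟩ ⟨ h ⟩) hs)) ∎
    where
    f = Δ F
    p = interlace h φ hs
    Φ X Y : ℕ → ℤ
    Φ b = interlace h (D f φ ⟨ b ⟩) hs
    X b = J (φ ⟨ b ⟩) hs
    Y b = D F (J (φ ⟨ b ⟩) ⟨ h ⟩) hs
    arith : ∀ f p x q y → f * p - - (q * x - y) ≡ f * p + (x * q - y)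
    arith = solve-∀
    Φ≡ : ∀ b → Φ b ≡ f b * p + (X b * F h - Y b)
    Φ≡ b = begin
      Φ b                                           ≡⟨ interlace-sub h (f b) φ (D f (φ ⟨ b ⟩)) hs ⟩
      f b * p - interlace h (D f (φ ⟨ b ⟩)) hs      ≡⟨ cong (λ z → f b * p - z) (interlace-D F (φ ⟨ b ⟩) h hs) ⟩
      f b * p - - (F h * X b - Y b)                 ≡⟨ arith (f b) p (X b) (F h) (Y b) ⟩
      f b * p + (X b * F h - Y b)                   ∎
    ΣΦ : ∀ n → Σ< Φ n ≡ (F n - F 0) * p + (Σ< X n * F h - Σ< Y n)
    ΣΦ n = begin
      Σ< Φ n                                        ≡⟨ Σ<-cong Φ≡ n ⟩
      Σ< (λ b → f b * p + (X b * F h - Y b)) n      ≡⟨ Σ<-lin₂ f p X (F h) Y n ⟩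
      Σ< f n * p + (Σ< X n * F h - Σ< Y n)          ≡⟨ cong (λ z → z * p + (Σ< X n * F h - Σ< Y n)) (Σ<-telescope F n) ⟩
      (F n - F 0) * p + (Σ< X n * F h - Σ< Y n)     ∎
    one : ∀ x y → x - y ≡ 1ℤ * x - y
    one = solve-∀
    DY : D F (J φ ⟨ a ⟩ ⟨ h ⟩) hs ≡ Σ< Y h - Σ< Y a
    DY = begin
      D F (J φ ⟨ a ⟩ ⟨ h ⟩) hs                      ≡⟨ D-cong (λ _ → refl) (λ ys → one (S h ys) (S a ys)) hs ⟩
      D F (λ ys → 1ℤ * S h ys - S a ys) hs          ≡⟨ D-sub F 1ℤ (S h) (S a) hs ⟩
      1ℤ * D F (S h) hs - D F (S a) hs              ≡⟨ sym (one (D F (S h) hs) (D F (S a) hs)) ⟩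
      D F (S h) hs - D F (S a) hs                   ≡⟨ cong₂ _-_ (D-Σ< F _ h hs) (D-Σ< F _ a hs) ⟩
      Σ< Y h - Σ< Y a                               ∎
      where
      S : ℕ → Form
      S n ys = Σ< (λ b → J (φ ⟨ b ⟩) (h ∷ ys)) n
    lemma : ∀ fh f0 fa p xh xa yh ya →
      ((fh - f0) * p + (xh * fh - yh)) - ((fa - f0) * p + (xa * fh - ya))
        ≡ - (fa * p - (fh * (p + (xh - xa)) - (yh - ya)))
    lemma = solve-∀

  -- The sign comes from carrying `F` past the extra factor, the constant function, that `J`
  -- introduces.
  J-D : ∀ F φ hs → J (D (Δ F) φ) hs ≡ - D F (J φ) hs
  J-D F φ []       = refl
  J-D F φ (a ∷ hs) = interlace-D F φ a hs

  sgn : ℕ → ℤ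
  sgn zero    = 1ℤ
  sgn (suc k) = - sgn k

  sgn² : ∀ k x → sgn k * (sgn k * x) ≡ x
  sgn² zero    x = lemma x
    where
    lemma : ∀ x → 1ℤ * (1ℤ * x) ≡ x
    lemma = solve-∀
  sgn² (suc k) x = trans (lemma (sgn k) x) (sgn² k x)
    where
    lemma : ∀ s x → - s * (- s * x) ≡ s * (s * x)
    lemma = solve-∀

  one : Fn
  one _ = 1ℤ

  interlace-0 : ∀ a {φ} → (∀ xs → φ xs ≡ 0ℤ) → ∀ hs → interlace a φ hs ≡ 0ℤ
  interlace-0 a e []       = e []
  interlace-0 a e (h ∷ hs) = cong₂ _-_ (Σ<-0 Φ h) (Σ<-0 Φ a)
    where Φ = λ b → interlace-0 h (λ ys → e (b ∷ ys)) hs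

  J-ε : J ε ≗ D one ε
  J-ε []           = refl
  J-ε (a ∷ [])     = refl
  J-ε (a ∷ h ∷ hs) = trans (interlace-ε (h ∷ hs)) (sym (cong (λ z → 0ℤ - z) (D-0ʳ one {ε ⟨ a ⟩} (λ _ → refl) (h ∷ hs))))
    where
    interlace-ε : ∀ hs → interlace a ε hs ≡ ε hs
    interlace-ε []       = refl
    interlace-ε (h ∷ hs) = cong₂ _-_ (Σ<-0 (λ b → interlace-0 h (λ _ → refl) hs) h)
                                     (Σ<-0 (λ b → interlace-0 h (λ _ → refl) hs) a)

  -- A determinant with an arbitrary innermost factor: pulling `J` inwards leaves `J ε`, the
  -- constant function, in place of `ε`.
  D* : (ℕ → Fn) → ℕ → Form → Form
  D* f zero    φ = φ
  D* f (suc k) φ = D (f k) (D* f k φ)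

  D*-cong : ∀ f k {φ ψ} → φ ≗ ψ → D* f k φ ≗ D* f k ψ
  D*-cong f zero    e = e
  D*-cong f (suc k) e = D-cong (λ _ → refl) (D*-cong f k e)

  D*-ε : ∀ f k → D* f k ε ≡ det (below f k)
  D*-ε f zero    = refl
  D*-ε f (suc k) = cong (D (f k)) (D*-ε f k)

  J-D* : ∀ F k hs → J (det (below (Δ ∘ F) k)) hs ≡ sgn k * D* F k (D one ε) hs
  J-D* F zero    hs = trans (J-ε hs) (lemma _)
    where
    lemma : ∀ x → x ≡ 1ℤ * x
    lemma = solve-∀
  J-D* F (suc k) hs = begin
    J (D (Δ (F k)) φ) hs                        ≡⟨ J-D (F k) φ hs ⟩
    - D (F k) (J φ) hs                          ≡⟨ cong -_ (D-cong (λ _ → refl) (J-D* F k) hs) ⟩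
    - D (F k) (sgn k · D* F k (D one ε)) hs     ≡⟨ cong -_ (D-·ʳ (sgn k) (F k) _ hs) ⟩
    - (sgn k * D* F (suc k) (D one ε) hs)       ≡⟨ lemma (sgn k) _ ⟩
    - sgn k * D* F (suc k) (D one ε) hs         ∎
    where
    φ = det (below (Δ ∘ F) k)
    lemma : ∀ s x → - (s * x) ≡ - s * x
    lemma = solve-∀

  -- Antiderivatives are determined only up to constants; the factor `b 0`, the constant function,
  -- makes the determinant insensitive to them and raises its size by one.
  J-det : ∀ (b : ℕ → Fn) → b 0 ≗ one → ∀ k hs →
    J (det (below (λ i → Δ (b (suc i))) k)) hs ≡ sgn k * det (below b (suc k)) hs
  J-det b b0 k hs = trans (J-D* (b ∘ suc) k hs) (cong (sgn k *_) (go k hs))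
    where
    go : ∀ k → D* (b ∘ suc) k (D one ε) ≗ det (below b (suc k))
    go zero    = D-cong (λ x → sym (b0 x)) (λ _ → refl)
    go (suc k) = D-cong (λ _ → refl) (go k)

  -- At the endpoint 0 all antiderivatives vanish and only the constant function does not. Expanding
  -- at this point removes the constant function again, and the sign of the expansion cancels that
  -- of `J-D*`.
  J-det-0 : ∀ (F : ℕ → Fn) → (∀ i → F i 0 ≡ 0ℤ) → ∀ k hs →
    J (det (below (Δ ∘ F) k)) (0 ∷ hs) ≡ det (below F k) hs
  J-det-0 F F0 k hs = begin
    J (det (below (Δ ∘ F) k)) (0 ∷ hs)               ≡⟨ J-D* F k (0 ∷ hs) ⟩
    sgn k * D* F k (D one ε) (0 ∷ hs)                ≡⟨ cong (sgn k *_) (go k (D one ε) hs) ⟩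
    sgn k * (sgn k * D* F k (D one ε ⟨ 0 ⟩) hs)      ≡⟨ sgn² k _ ⟩
    D* F k (D one ε ⟨ 0 ⟩) hs                        ≡⟨ D*-cong F k unit hs ⟩
    D* F k ε hs                                      ≡⟨ cong (λ φ → φ hs) (D*-ε F k) ⟩
    det (below F k) hs                               ∎
    where
    unit : D one ε ⟨ 0 ⟩ ≗ ε
    unit ys rewrite D-0ʳ one {ε ⟨ 0 ⟩} (λ _ → refl) ys = lemma (ε ys)
      where
      lemma : ∀ x → 1ℤ * x - 0ℤ ≡ x
      lemma = solve-∀
    go : ∀ k φ → D* F k φ ⟨ 0 ⟩ ≗ sgn k · D* F k (φ ⟨ 0 ⟩)
    go zero    φ hs = lemma (φ (0 ∷ hs))
      where
      lemma : ∀ x → x ≡ 1ℤ * x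
      lemma = solve-∀
    go (suc k) φ hs = begin
      F k 0 * D* F k φ hs - D (F k) (D* F k φ ⟨ 0 ⟩) hs
        ≡⟨ cong₂ (λ x y → x * D* F k φ hs - y) (F0 k) (D-cong (λ _ → refl) (go k φ) hs) ⟩
      0ℤ * D* F k φ hs - D (F k) (sgn k · D* F k (φ ⟨ 0 ⟩)) hs
        ≡⟨ cong (λ y → 0ℤ * D* F k φ hs - y) (D-·ʳ (sgn k) (F k) _ hs) ⟩
      0ℤ * D* F k φ hs - sgn k * D* F (suc k) (φ ⟨ 0 ⟩) hs
        ≡⟨ lemma (D* F k φ hs) (sgn k) _ ⟩
      - sgn k * D* F (suc k) (φ ⟨ 0 ⟩) hs ∎
      where
      lemma : ∀ x s y → 0ℤ * x - s * y ≡ - s * y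
      lemma = solve-∀

-- Matching one row with the next, expressed by the operators on forms.

module RowMatching where

  open Determinants
  open import Data.Bool using (Bool; true; false; if_then_else_)
  open import Data.Nat as ℕ using (ℕ; zero; suc; s≤s)
  import Data.Nat.Properties as ℕₚ
  open import Data.Integer using (ℤ; +_; ∣_∣; -_; _+_; _-_; _*_; 0ℤ)
  open import Data.Integer.Properties using (*-zeroˡ; *-zeroʳ; pos-+; abs-*; ∣-i∣≡∣i∣)
  open import Data.Integer.Tactic.RingSolver using (solve-∀)
  open import Data.List using (List; []; _∷_; map; length; replicate; drop)
  open import Data.List.Properties using (length-replicate)
  open import Function using (_∘_)
  open import Relation.Binary.PropositionalEquality using (_≡_; _≗_; refl; sym; trans; cong; cong₂; module ≡-Reasoning)
  open ≡-Reasoning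

  first : List Bool → Bool
  first []      = false
  first (y ∷ _) = y

  -- Sites of consecutive rows are listed from left to right; the first site of xs lies
  -- between the first two sites of ys.  Every cell of xs (bit true) is matched to one of its
  -- two neighbours in ys, and k counts the completions for the remaining cells of ys.
  scan : List Bool → List Bool → (List Bool → ℕ) → ℕ
  scan ys       []           k = k ys
  scan []       (false ∷ xs) k = scan [] xs k
  scan []       (true ∷ xs)  k = 0
  scan (y ∷ ys) (false ∷ xs) k = scan ys xs (k ∘ (y ∷_))
  scan (y ∷ ys) (true ∷ xs)  k =
    (if y then scan ys xs (k ∘ (false ∷_)) else 0) ℕ.+
    (if first ys then scan (false ∷ drop 1 ys) xs (k ∘ (y ∷_)) else 0)

  -- The same when the first site of xs lies to the left of all of ys.
  scanˡ : List Bool → List Bool → (List Bool → ℕ) → ℕ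
  scanˡ ys []           k = k ys
  scanˡ ys (false ∷ xs) k = scan ys xs k
  scanˡ ys (true ∷ xs)  k = if first ys then scan (false ∷ drop 1 ys) xs k else 0

  full : ℕ → List Bool
  full m = replicate m true

  ones zeros : ℕ → List Bool → List ℕ
  ones n []           = []
  ones n (true ∷ xs)  = n ∷ ones (suc n) xs
  ones n (false ∷ xs) = ones (suc n) xs
  zeros n []           = []
  zeros n (true ∷ xs)  = zeros (suc n) xs
  zeros n (false ∷ xs) = n ∷ zeros (suc n) xs

  ones-suc : ∀ n xs → ones (suc n) xs ≡ map suc (ones n xs)
  ones-suc n []           = refl
  ones-suc n (true ∷ xs)  = cong (suc n ∷_) (ones-suc (suc n) xs)
  ones-suc n (false ∷ xs) = ones-suc (suc n) xs

  zeros-suc : ∀ n xs → zeros (suc n) xs ≡ map suc (zeros n xs)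
  zeros-suc n []           = refl
  zeros-suc n (true ∷ xs)  = zeros-suc (suc n) xs
  zeros-suc n (false ∷ xs) = cong (suc n ∷_) (zeros-suc (suc n) xs)

  zeros-full : ∀ n m → zeros n (full m) ≡ []
  zeros-full n zero    = refl
  zeros-full n (suc m) = zeros-full (suc n) m

  add : ∀ a b c d x y → + a * c ≡ d * x → + b * c ≡ d * y → + (a ℕ.+ b) * c ≡ d * (x + y)
  add a b c d x y p q = begin
    + (a ℕ.+ b) * c         ≡⟨ cong (_* c) (pos-+ a b) ⟩
    (+ a + + b) * c         ≡⟨ distribʳ (+ a) (+ b) c ⟩
    + a * c + + b * c       ≡⟨ cong₂ _+_ p q ⟩
    d * x + d * y           ≡⟨ sym (distribˡ d x y) ⟩
    d * (x + y)             ∎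
    where
    distribʳ : ∀ a b c → (a + b) * c ≡ a * c + b * c
    distribʳ = solve-∀
    distribˡ : ∀ d x y → d * (x + y) ≡ d * x + d * y
    distribˡ = solve-∀

  none : ∀ c d {x} → x ≡ 0ℤ → + 0 * c ≡ d * x
  none c d refl = trans (*-zeroˡ c) (sym (*-zeroʳ d))

  module _ (c d : ℤ) where

    mutual
      -- The two possible partners of a cell are the two terms of `hop`; the bound on `length xs`
      -- ensures that the right partner exists.
      scan-hop : ∀ n {m} xs k {φ} → length xs ℕ.≤ m → Alternating φ →
        (∀ zs → length zs ≡ suc m → + k zs * c ≡ d * φ (zeros n zs)) →
        + scan (full (suc m)) xs k * c ≡ d * hop φ (ones (suc n) xs)
      scan-hop n {m} [] k {φ} _ alt val =
        trans (val (full (suc m)) (length-replicate (suc m))) (cong (λ z → d * φ z) (zeros-full (suc n) m))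
      scan-hop n (false ∷ xs) k (s≤s le) alt val =
        scan-hop (suc n) xs (k ∘ (true ∷_)) le alt (λ zs e → val (true ∷ zs) (cong suc e))
      scan-hop n {suc m} (true ∷ xs) k {φ} (s≤s le) alt val =
        add (scan (full (suc m)) xs (k ∘ (false ∷_))) _ c d _ _
          (scan-hop (suc n) xs (k ∘ (false ∷_)) le (λ ws → alt (n ∷ ws)) (λ zs e → val (false ∷ zs) (cong suc e)))
          (scan-hop-used (suc n) xs (k ∘ (true ∷_)) {φ} le alt (λ zs e → val (true ∷ zs) (cong suc e)))

      -- A second particle arriving at the used site n would make two arguments of φ equal.
      scan-hop-used : ∀ n {m} xs k {φ} → length xs ℕ.≤ m → Alternating φ →
        (∀ zs → length zs ≡ suc m → + k zs * c ≡ d * φ (zeros n zs)) →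
        + scan (false ∷ full m) xs k * c ≡ d * hop (φ ⟨ n ⟩) (ones (suc n) xs)
      scan-hop-used n {m} [] k {φ} _ alt val =
        trans (val (false ∷ full m) (cong suc (length-replicate m)))
              (cong (λ z → d * φ (n ∷ z)) (zeros-full (suc n) m))
      scan-hop-used n (false ∷ xs) k (s≤s le) alt val =
        scan-hop (suc n) xs (k ∘ (false ∷_)) le (λ ws → alt (n ∷ ws)) (λ zs e → val (false ∷ zs) (cong suc e))
      scan-hop-used n {suc m} (true ∷ xs) k {φ} (s≤s le) alt val =
        add 0 (scan (false ∷ full m) xs (k ∘ (false ∷_))) c d _ _
          (none c d (hop-0 (alt [] n) (ones (suc (suc n)) xs)))
          (scan-hop-used (suc n) xs (k ∘ (false ∷_)) {φ ⟨ n ⟩} le (λ ws → alt (n ∷ ws)) (λ zs e → val (false ∷ zs) (cong suc e)))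

    scanˡ-hop : ∀ {m} xs k {φ} → length xs ℕ.≤ m → Alternating φ →
      (∀ zs → length zs ≡ m → + k zs * c ≡ d * φ (zeros 0 zs)) →
      + scanˡ (full m) xs k * c ≡ d * hop φ (ones 0 xs)
    scanˡ-hop {m} [] k {φ} _ alt val =
      trans (val (full m) (length-replicate m)) (cong (λ z → d * φ z) (zeros-full 0 m))
    scanˡ-hop (false ∷ xs) k (s≤s le) alt val = scan-hop 0 xs k le alt val
    scanˡ-hop (true ∷ xs) k {φ} (s≤s le) alt val = scan-hop-used 0 xs k {φ} le alt val

    mutual
      -- Between consecutive empty sites h < h′ of `xs` there are h′ - h - 1 cells for the h′ - h
      -- sites of [h , h′) in `ys`: cells move left up to some place and right after it, leaving
      -- exactly one site free. After the last empty site all cells move left.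
      scan-interlace : ∀ n {m} xs k {φ} → length xs ≡ m →
        (∀ zs → length zs ≡ m → + k zs * c ≡ d * φ (ones n zs)) →
        + scan (full m) xs k * c ≡ d * interlace n φ (zeros (suc n) xs)
      scan-interlace n [] k refl val = val [] refl
      scan-interlace n (false ∷ xs) k {φ} refl val = begin
        + scan (full (length xs)) xs (k ∘ (true ∷_)) * c
          ≡⟨ scan-interlace (suc n) xs (k ∘ (true ∷_)) {φ ⟨ n ⟩} refl (λ zs e → val (true ∷ zs) (cong suc e)) ⟩
        d * interlace (suc n) (φ ⟨ n ⟩) hs
          ≡⟨ cong (d *_) (sym (cancel (Σ< Φ n) (Φ n))) ⟩
        d * ((Σ< Φ n + Φ n) - Σ< Φ n) ∎
        where
        hs = zeros (suc (suc n)) xs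
        Φ : Fn
        Φ b = interlace (suc n) (φ ⟨ b ⟩) hs
        cancel : ∀ x y → (x + y) - x ≡ y
        cancel = solve-∀
      scan-interlace n (true ∷ xs) k {φ} refl val = begin
        + (scan (full (length xs)) xs (k ∘ (false ∷_)) ℕ.+ R) * c
          -- If the cell takes site n, the interval effectively starts at n + 1; if it takes n + 1,
          -- site n is the free one and the next interval starts at the first empty site.
          ≡⟨ add (scan (full (length xs)) xs (k ∘ (false ∷_))) R c d _ _
               (scan-interlace (suc n) xs (k ∘ (false ∷_)) {φ} refl (λ zs e → val (false ∷ zs) (cong suc e)))
               (used xs val) ⟩
        d * (interlace (suc n) φ hs + Φ n)
          ≡⟨ cong (λ z → d * (interlace (suc n) φ hs + z)) (sym (cancel (Σ< Φ n) (Φ n))) ⟩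
        d * (interlace (suc n) φ hs + ((Σ< Φ n + Φ n) - Σ< Φ n))
          ≡⟨ cong (d *_) (sym (interlace-split n (suc n) φ hs)) ⟩
        d * interlace n φ hs ∎
        where
        hs = zeros (suc (suc n)) xs
        R = if first (full (length xs)) then scan (false ∷ drop 1 (full (length xs))) xs (k ∘ (true ∷_)) else 0
        Φ : Fn
        Φ b = J (φ ⟨ b ⟩) hs
        cancel : ∀ x y → (x + y) - x ≡ y
        cancel = solve-∀
        used : ∀ xs → (∀ zs → length zs ≡ suc (length xs) → + k zs * c ≡ d * φ (ones n zs)) →
          + (if first (full (length xs)) then scan (false ∷ drop 1 (full (length xs))) xs (k ∘ (true ∷_)) else 0) * c
            ≡ d * J (φ ⟨ n ⟩) (zeros (suc (suc n)) xs)
        -- The last cell of the row has no right neighbour, in accordance with `J` being 0 on the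
        -- empty list.
        used []       val = none c d refl
        used (x ∷ xs) val = scan-interlace-used (suc n) (x ∷ xs) (k ∘ (true ∷_)) {φ ⟨ n ⟩} refl
                              (λ zs e → val (true ∷ zs) (cong suc e))

      -- As site n is taken, all cells before the first empty site are pushed to the right and leave
      -- no site free; the first interval starts at that empty site, hence `J`.
      scan-interlace-used : ∀ n {m} xs k {φ} → length xs ≡ suc m →
        (∀ zs → length zs ≡ suc m → + k zs * c ≡ d * φ (ones n zs)) →
        + scan (false ∷ full m) xs k * c ≡ d * J φ (zeros (suc n) xs)
      scan-interlace-used n (false ∷ xs) k refl val =
        scan-interlace (suc n) xs (k ∘ (false ∷_)) refl (λ zs e → val (false ∷ zs) (cong suc e))
      scan-interlace-used n (true ∷ [])     k refl val = none c d refl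
      scan-interlace-used n (true ∷ x ∷ xs) k refl val =
        scan-interlace-used (suc n) (x ∷ xs) (k ∘ (false ∷_)) refl (λ zs e → val (false ∷ zs) (cong suc e))

    scanˡ-interlace : ∀ {m} xs k {φ} → length xs ≡ suc m →
      (∀ zs → length zs ≡ m → + k zs * c ≡ d * φ (ones 0 zs)) →
      + scanˡ (full m) xs k * c ≡ d * J φ (zeros 0 xs)
    scanˡ-interlace (false ∷ xs)    k refl val = scan-interlace 0 xs k refl val
    scanˡ-interlace (true ∷ [])     k refl val = none c d refl
    scanˡ-interlace (true ∷ x ∷ xs) k refl val = scan-interlace-used 0 (x ∷ xs) k refl val

  prodℕ : (ℕ → ℕ) → ℕ → ℕ
  prodℕ e zero    = 1
  prodℕ e (suc k) = e k ℕ.* prodℕ e k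

  ∣∏∣ : ∀ e k → ∣ ∏ (+_ ∘ e) k ∣ ≡ prodℕ e k
  ∣∏∣ e zero    = refl
  ∣∏∣ e (suc k) = trans (abs-* (+ e k) (∏ (+_ ∘ e) k)) (cong (e k ℕ.*_) (∣∏∣ e k))

  ∣sgn∣ : ∀ k → ∣ sgn k ∣ ≡ 1
  ∣sgn∣ zero    = refl
  ∣sgn∣ (suc k) = trans (∣-i∣≡∣i∣ (sgn k)) (∣sgn∣ k)

  -- On rows of length m, T · C = ± D · det (f (k-1) , … , f 0) evaluated at the sites of the row.
  record Formula (sites : List Bool → List ℕ) (m : ℕ) (f : ℕ → Fn) (k C D : ℕ) (T : List Bool → ℕ) : Set where
    constructor formula
    field
      c d   : ℤ
      ∣c∣   : ∣ c ∣ ≡ C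
      ∣d∣   : ∣ d ∣ ≡ D
      value : ∀ xs → length xs ≡ m → + T xs * c ≡ d * det (below f k) (sites xs)

  Part Hole : ℕ → (ℕ → Fn) → ℕ → ℕ → ℕ → (List Bool → ℕ) → Set
  Part = Formula (ones 0)
  Hole = Formula (zeros 0)

  det-shift-ones : ∀ f k xs → det (below f k) (ones 1 xs) ≡ det (below (λ i → f i ∘ suc) k) (ones 0 xs)
  det-shift-ones f k xs = trans (cong (det (below f k)) (ones-suc 0 xs)) (det-map suc f k (ones 0 xs))

  det-shift-zeros : ∀ f k xs → det (below f k) (zeros 1 xs) ≡ det (below (λ i → f i ∘ suc) k) (zeros 0 xs)
  det-shift-zeros f k xs = trans (cong (det (below f k)) (zeros-suc 0 xs)) (det-map suc f k (zeros 0 xs))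

  part-scanˡ : ∀ {m f k C D T m′} → Hole m f k C D T → m′ ℕ.≤ m →
    Part m′ (hopFn ∘ f) k C D (λ xs → scanˡ (full m) xs T)
  part-scanˡ {m} {f} {k} {T = T} (formula c d ∣c∣ ∣d∣ val) le = formula c d ∣c∣ ∣d∣ λ { xs refl →
    trans (scanˡ-hop c d xs T le (det-alternating (below f k)) val)
          (cong (d *_) (hop-det f k (ones 0 xs))) }

  part-scan : ∀ {m f k C D T m′} → Hole (suc m) f k C D T → m′ ℕ.≤ m →
    Part m′ (λ i → hopFn (f i) ∘ suc) k C D (λ xs → scan (full (suc m)) xs T)
  part-scan {m} {f} {k} {T = T} (formula c d ∣c∣ ∣d∣ val) le = formula c d ∣c∣ ∣d∣ λ { xs refl →
    trans (scan-hop c d 0 xs T le (det-alternating (below f k)) val)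
          (cong (d *_) (trans (hop-det f k (ones 1 xs)) (det-shift-ones (hopFn ∘ f) k xs))) }

  hole-scanˡ : ∀ {m k C D T} b → b 0 ≗ one → Part m (λ i → Δ (b (suc i))) k C D T →
    Hole (suc m) b (suc k) C D (λ xs → scanˡ (full m) xs T)
  hole-scanˡ {m} {k} {T = T} b b0 (formula c d ∣c∣ ∣d∣ val) =
    formula c (d * sgn k) ∣c∣
      (trans (abs-* d (sgn k)) (trans (cong₂ ℕ._*_ ∣d∣ (∣sgn∣ k)) (ℕₚ.*-identityʳ _)))
      λ xs e → begin
    + scanˡ (full m) xs T * c                                  ≡⟨ scanˡ-interlace c d xs T e val ⟩
    d * J (det (below (λ i → Δ (b (suc i))) k)) (zeros 0 xs)   ≡⟨ cong (d *_) (J-det b b0 k (zeros 0 xs)) ⟩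
    d * (sgn k * det (below b (suc k)) (zeros 0 xs))           ≡⟨ assoc d (sgn k) _ ⟩
    (d * sgn k) * det (below b (suc k)) (zeros 0 xs)           ∎
    where
    assoc : ∀ a b c → a * (b * c) ≡ (a * b) * c
    assoc = solve-∀

  -- The first interval starts at a virtual empty site 0 to the left of the row, where `F` vanishes;
  -- the sites of the row itself are numbered from 1 in `F`, hence the `suc`.
  hole-scan : ∀ {m k C D T} F → (∀ i → F i 0 ≡ 0ℤ) → Part m (Δ ∘ F) k C D T →
    Hole m (λ i → F i ∘ suc) k C D (λ xs → scan (full m) xs T)
  hole-scan {m} {k} {T = T} F F0 (formula c d ∣c∣ ∣d∣ val) = formula c d ∣c∣ ∣d∣ λ xs e → begin
    + scan (full m) xs T * c                                ≡⟨ scan-interlace c d 0 xs T e val ⟩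
    d * J (det (below (Δ ∘ F) k)) (0 ∷ zeros 1 xs)          ≡⟨ cong (d *_) (J-det-0 F F0 k (zeros 1 xs)) ⟩
    d * det (below F k) (zeros 1 xs)                        ≡⟨ cong (d *_) (det-shift-zeros F k xs) ⟩
    d * det (below (λ i → F i ∘ suc) k) (zeros 0 xs)        ∎

  formula-lead : ∀ {s m f k C D T} b e → (∀ i → Lead b i (+ e i) (f i)) →
    Formula s m f k C D T → Formula s m b k C (D ℕ.* prodℕ e k) T
  formula-lead {s} {k = k} b e lead (formula c d ∣c∣ ∣d∣ val) =
    formula c (d * ∏ (+_ ∘ e) k) ∣c∣ (trans (abs-* d _) (cong₂ ℕ._*_ ∣d∣ (∣∏∣ e k))) λ xs eq →
      trans (val xs eq) (trans (cong (d *_) (det-lead b _ (+_ ∘ e) lead k (s xs))) (assoc d _ _))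
    where
    assoc : ∀ a b c → a * (b * c) ≡ (a * b) * c
    assoc = solve-∀

  -- Prepares integration: the basis is traded for differences `Δ F`, whose leading coefficients go
  -- to the side of the count instead of being divided out.
  formula-unlead : ∀ {s m b k C D T} f e → (∀ i → Lead b i (+ e i) (f i)) →
    Formula s m b k C D T → Formula s m f k (C ℕ.* prodℕ e k) D T
  formula-unlead {s} {b = b} {k} {T = T} f e lead (formula c d ∣c∣ ∣d∣ val) =
    formula (c * P) d (trans (abs-* c _) (cong₂ ℕ._*_ ∣c∣ (∣∏∣ e k))) ∣d∣ λ xs eq → begin
      + T xs * (c * P)                        ≡⟨ assoc (+ T xs) c P ⟩
      (+ T xs * c) * P                        ≡⟨ cong (_* P) (val xs eq) ⟩
      d * det (below b k) (s xs) * P          ≡⟨ swap d _ P ⟩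
      d * (P * det (below b k) (s xs))        ≡⟨ cong (d *_) (sym (det-lead b f (+_ ∘ e) lead k (s xs))) ⟩
      d * det (below f k) (s xs)              ∎
    where
    P = ∏ (+_ ∘ e) k
    assoc : ∀ a b c → a * (b * c) ≡ (a * b) * c
    assoc = solve-∀
    swap : ∀ a b c → a * b * c ≡ a * (c * b)
    swap = solve-∀

-- Leading coefficients of sums and differences of even and odd polynomials.

module EvenPolynomials where

  open Determinants
  open import Data.Nat as ℕ using (ℕ; zero; suc)
  import Data.Nat.Properties as ℕₚ
  open import Data.Integer using (ℤ; +_; -_; _+_; _-_; _*_; 0ℤ; 1ℤ)
  open import Data.Integer.Properties using (*-zeroʳ; pos-*; +-identityˡ)
  open import Data.Integer.Tactic.RingSolver using (solve-∀)
  open import Function using (_∘_)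
  open import Relation.Binary.PropositionalEquality using (_≡_; _≗_; refl; sym; trans; cong; cong₂)

  module _ {X : Set} {b : ℕ → X → ℤ} where

    lead-cong : ∀ {i c c′ f g} → c ≡ c′ → f ≗ g → Lead b i c f → Lead b i c′ g
    lead-cong refl e (base l)   = base (λ x → trans (sym (e x)) (l x))
    lead-cong refl e (step l q) = step l (λ x → trans (sym (e x)) (q x))

    lead-+ : ∀ {i c c′ f g} → Lead b i c f → Lead b i c′ g → Lead b i (c + c′) (f ⊕ g)
    lead-+ {c = c} {c′} (base l) (base l′) = base λ x → trans (cong₂ _+_ (l x) (l′ x)) (lemma c c′ (b 0 x))
      where
      lemma : ∀ c c′ y → c * y + c′ * y ≡ (c + c′) * y
      lemma = solve-∀
    lead-+ {c = c} {c′} (step {i} {g = g} l q) (step {g = g′} l′ q′) =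
      step (lead-+ l l′) λ x → trans (cong₂ _+_ (q x) (q′ x)) (lemma c c′ (b (suc i) x) (g x) (g′ x))
      where
      lemma : ∀ c c′ y u v → (c * y + u) + (c′ * y + v) ≡ (c + c′) * y + (u + v)
      lemma = solve-∀

    lead-· : ∀ s {i c f} → Lead b i c f → Lead b i (s * c) (s · f)
    lead-· s {c = c} (base l) = base λ x → trans (cong (s *_) (l x)) (lemma s c (b 0 x))
      where
      lemma : ∀ s c y → s * (c * y) ≡ s * c * y
      lemma = solve-∀
    lead-· s {c = c} (step {i} {g = g} l q) =
      step (lead-· s l) λ x → trans (cong (s *_) (q x)) (lemma s c (b (suc i) x) (g x))
      where
      lemma : ∀ s c y u → s * (c * y + u) ≡ s * c * y + s * u
      lemma = solve-∀

    lead-up : ∀ {i c f} → Lead b i c f → Lead b (suc i) 0ℤ f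
    lead-up {i} {c} {f} l = step l λ x → lemma (b (suc i) x) (f x)
      where
      lemma : ∀ y u → u ≡ 0ℤ * y + u
      lemma = solve-∀

    lead-∘ : ∀ {Y : Set} (p : Y → X) {i c f} → Lead b i c f → Lead (λ i y → b i (p y)) i c (f ∘ p)
    lead-∘ p (base l)   = base (l ∘ p)
    lead-∘ p (step l q) = step (lead-∘ p l) (q ∘ p)

    lead-weight : ∀ (w : X → ℤ) {i c f} → Lead b i c f → Lead (λ i y → w y * b i y) i c (λ y → w y * f y)
    lead-weight w {c = c} (base l) = base λ y → trans (cong (w y *_) (l y)) (lemma (w y) c (b 0 y))
      where
      lemma : ∀ w c y → w * (c * y) ≡ c * (w * y)
      lemma = solve-∀
    lead-weight w {c = c} (step {i} {g = g} l q) =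
      step (lead-weight w l) λ y → trans (cong (w y *_) (q y)) (lemma (w y) c (b (suc i) y) (g y))
      where
      lemma : ∀ w c y u → w * (c * y + u) ≡ c * (w * y) + w * u
      lemma = solve-∀

  E : ℕ → ℤ → ℤ
  E zero    x = 1ℤ
  E (suc i) x = x * x * E i x

  lead-² : ∀ {i c f} → Lead E i c f → Lead E (suc i) c (λ x → x * x * f x)
  lead-² {c = c} (base l) = step (base {c = 0ℤ} (λ _ → refl)) λ x → trans (cong (x * x *_) (l x)) (lemma x c)
    where
    lemma : ∀ x c → x * x * (c * 1ℤ) ≡ c * (x * x * 1ℤ) + 0ℤ * 1ℤ
    lemma = solve-∀
  lead-² {c = c} (step {i} {g = g} l q) =
    step (lead-² l) λ x → trans (cong (x * x *_) (q x)) (lemma x c (E i x) (g x))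
    where
    lemma : ∀ x c y u → x * x * (c * (x * x * y) + u) ≡ c * (x * x * (x * x * y)) + x * x * u
    lemma = solve-∀

  -- (x ± 1)^2i = A i x ± x · C i x.
  mutual
    A C : ℕ → ℤ → ℤ
    A zero    x = 1ℤ
    A (suc i) x = x * x * A i x + (A i x + + 2 * (x * x * C i x))
    C zero    x = 0ℤ
    C (suc i) x = x * x * C i x + (C i x + + 2 * A i x)

  E-suc : ∀ i x → E i (x + 1ℤ) ≡ A i x + x * C i x
  E-suc zero    x = lemma x
    where
    lemma : ∀ x → 1ℤ ≡ 1ℤ + x * 0ℤ
    lemma = solve-∀
  E-suc (suc i) x rewrite E-suc i x = lemma x (A i x) (C i x)
    where
    lemma : ∀ x a c → (x + 1ℤ) * (x + 1ℤ) * (a + x * c) ≡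
      x * x * a + (a + + 2 * (x * x * c)) + x * (x * x * c + (c + + 2 * a))
    lemma = solve-∀

  E-pred : ∀ i x → E i (x - 1ℤ) ≡ A i x - x * C i x
  E-pred zero    x = lemma x
    where
    lemma : ∀ x → 1ℤ ≡ 1ℤ - x * 0ℤ
    lemma = solve-∀
  E-pred (suc i) x rewrite E-pred i x = lemma x (A i x) (C i x)
    where
    lemma : ∀ x a c → (x - 1ℤ) * (x - 1ℤ) * (a - x * c) ≡
      x * x * a + (a + + 2 * (x * x * c)) - x * (x * x * c + (c + + 2 * a))
    lemma = solve-∀

  mutual
    lead-A : ∀ i → Lead E i 1ℤ (A i)
    lead-A zero    = base λ x → refl
    lead-A (suc i) = lead-+ (lead-² (lead-A i)) (lead-+ (lead-up (lead-A i)) (lead-· (+ 2) (lead-up (lead-x²C i))))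

    -- `x * C i x` is the odd part of (x + 1)^2i, which starts with 2i x^(2i-1); one more factor x
    -- makes it even.
    lead-x²C : ∀ i → Lead E i (+ (2 ℕ.* i)) (λ x → x * x * C i x)
    lead-x²C zero    = base λ x → *-zeroʳ (x * x)
    lead-x²C (suc i) = lead-² (lead-C i)

    lead-C₀ : ∀ i → Lead E i 0ℤ (C i)
    lead-C₀ zero    = base λ x → refl
    lead-C₀ (suc i) = lead-up (lead-C i)

    lead-C : ∀ i → Lead E i (+ (2 ℕ.* suc i)) (C (suc i))
    lead-C i = lead-cong (cong +_ (trans (ℕₚ.+-comm (2 ℕ.* i) 2) (sym (ℕₚ.*-suc 2 i)))) (λ _ → refl)
      (lead-+ (lead-x²C i) (lead-+ (lead-C₀ i) (lead-· (+ 2) (lead-A i))))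

  -- The position s + 2j, defined so that index `suc j` with start s reduces to index j with start s
  -- + 2: `Δ` and `hopFn` of `ev s` and `od s` then unfold to values with the starts s and 2 + s.
  pos : ℕ → ℕ → ℤ
  pos s zero    = + s
  pos s (suc j) = pos (suc (suc s)) j

  pos-suc : ∀ s j → pos (suc s) j ≡ pos s j + 1ℤ
  pos-suc s zero    = cong +_ (ℕₚ.+-comm 1 s)
  pos-suc s (suc j) = pos-suc (suc (suc s)) j

  pos-pred : ∀ s j → pos s j ≡ pos (suc s) j - 1ℤ
  pos-pred s j = trans (lemma (pos s j)) (cong (_- 1ℤ) (sym (pos-suc s j)))
    where
    lemma : ∀ x → x ≡ x + 1ℤ - 1ℤ
    lemma = solve-∀

  ev od : ℕ → ℕ → Fn
  ev s i j = E i (pos s j)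
  od s i j = pos s j * E i (pos s j)

  -- Twice the weights one half on the wall and one elsewhere, which keeps them integral.
  w : Fn
  w zero    = 1ℤ
  w (suc _) = + 2

  wev : ℕ → Fn
  wev i j = w j * E i (pos 0 j)

  lead-A+C : ∀ i → Lead E i 1ℤ (A i ⊕ C i)
  lead-A+C i = lead-+ (lead-A i) (lead-C₀ i)

  lead-A+x²C : ∀ i → Lead E i (+ (1 ℕ.+ 2 ℕ.* i)) (λ x → A i x + x * x * C i x)
  lead-A+x²C i = lead-+ (lead-A i) (lead-x²C i)

  module _ (s i : ℕ) where

    private
      shift : (F G : ℤ → ℤ) → (∀ x → F (x + 1ℤ) ≡ G x) → ∀ j → F (pos (2 ℕ.+ s) j) ≡ G (pos (suc s) j)
      shift F G e j = trans (cong F (pos-suc (suc s) j)) (e (pos (suc s) j))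

      shift⁻ : (F G : ℤ → ℤ) → (∀ x → F (x - 1ℤ) ≡ G x) → ∀ j → F (pos s j) ≡ G (pos (suc s) j)
      shift⁻ F G e j = trans (cong F (pos-pred s j)) (e (pos (suc s) j))

      ev⁺ : ∀ i j → let x = pos (suc s) j in ev (2 ℕ.+ s) i j ≡ A i x + x * C i x
      ev⁺ i = shift (E i) _ (E-suc i)
      ev⁻ : ∀ i j → let x = pos (suc s) j in ev s i j ≡ A i x - x * C i x
      ev⁻ i = shift⁻ (E i) _ (E-pred i)
      od⁺ : ∀ j → let x = pos (suc s) j in od (2 ℕ.+ s) i j ≡ (x + 1ℤ) * (A i x + x * C i x)
      od⁺ = shift (λ x → x * E i x) _ (λ x → cong ((x + 1ℤ) *_) (E-suc i x))
      od⁻ : ∀ j → let x = pos (suc s) j in od s i j ≡ (x - 1ℤ) * (A i x - x * C i x)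
      od⁻ = shift⁻ (λ x → x * E i x) _ (λ x → cong ((x - 1ℤ) *_) (E-pred i x))

    -- Among the values A ± x C at the two neighbours, a sum keeps 2 A and a difference 2 x C. The
    -- factor 2 in this and the next three coefficients has this origin.
    lead-ev-sum : Lead (ev (suc s)) i (+ 2) (λ j → ev s i j + ev (2 ℕ.+ s) i j)
    lead-ev-sum = lead-cong refl (λ j → sym (trans (cong₂ _+_ (ev⁻ i j) (ev⁺ i j)) (lemma (pos (suc s) j) (A i (pos (suc s) j)) (C i (pos (suc s) j)))))
      (lead-∘ (pos (suc s)) (lead-· (+ 2) (lead-A i)))
      where
      lemma : ∀ x a c → (a - x * c) + (a + x * c) ≡ + 2 * a
      lemma = solve-∀

    lead-ev-diff : Lead (od (suc s)) i (+ (2 ℕ.* (2 ℕ.* suc i))) (λ j → ev (2 ℕ.+ s) (suc i) j - ev s (suc i) j)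
    lead-ev-diff = lead-cong (sym (pos-* 2 (2 ℕ.* suc i)))
      (λ j → sym (trans (cong₂ _-_ (ev⁺ (suc i) j) (ev⁻ (suc i) j)) (lemma (pos (suc s) j) (A (suc i) (pos (suc s) j)) (C (suc i) (pos (suc s) j)))))
      (lead-∘ (pos (suc s)) (lead-· (+ 2) (lead-weight (λ x → x) (lead-C i))))
      where
      lemma : ∀ x a c → (a + x * c) - (a - x * c) ≡ + 2 * (x * c)
      lemma = solve-∀

    lead-od-sum : Lead (od (suc s)) i (+ 2) (λ j → od s i j + od (2 ℕ.+ s) i j)
    lead-od-sum = lead-cong refl (λ j → sym (trans (cong₂ _+_ (od⁻ j) (od⁺ j)) (lemma (pos (suc s) j) (A i (pos (suc s) j)) (C i (pos (suc s) j)))))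
      (lead-∘ (pos (suc s)) (lead-· (+ 2) (lead-weight (λ x → x) (lead-A+C i))))
      where
      lemma : ∀ x a c → (x - 1ℤ) * (a - x * c) + (x + 1ℤ) * (a + x * c) ≡ + 2 * (x * (a + c))
      lemma = solve-∀

    lead-od-diff : Lead (ev (suc s)) i (+ (2 ℕ.* (1 ℕ.+ 2 ℕ.* i))) (λ j → od (2 ℕ.+ s) i j - od s i j)
    lead-od-diff = lead-cong (sym (pos-* 2 (1 ℕ.+ 2 ℕ.* i)))
      (λ j → sym (trans (cong₂ _-_ (od⁺ j) (od⁻ j)) (lemma (pos (suc s) j) (A i (pos (suc s) j)) (C i (pos (suc s) j)))))
      (lead-∘ (pos (suc s)) (lead-· (+ 2) (lead-A+x²C i)))
      where
      lemma : ∀ x a c → (x + 1ℤ) * (a + x * c) - (x - 1ℤ) * (a - x * c) ≡ + 2 * (a + x * x * c)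
      lemma = solve-∀

  -- Next to the wall an even function is summed over the half-line: 0 has weight one half.
  od₀ : ℕ → Fn
  od₀ i zero    = 0ℤ
  od₀ i (suc j) = od 1 i j

  -- The interior is `lead-od-diff` with its factor 2 absorbed by `w`. At 0 the full difference
  -- od(1) - od(-1) would be 2 od(1), and half of it is taken.
  lead-od₀-diff : ∀ i → Lead wev i (+ (1 ℕ.+ 2 ℕ.* i)) (Δ (od₀ i))
  lead-od₀-diff i = lead-cong refl eq (lead-weight w (lead-∘ (pos 0) (lead-A+x²C i)))
    where
    eq : ∀ j → w j * (A i (pos 0 j) + pos 0 j * pos 0 j * C i (pos 0 j)) ≡ od₀ i (suc j) - od₀ i j
    eq zero    = trans (lemma (A i 0ℤ) (C i 0ℤ)) (cong (λ z → 1ℤ * z - 0ℤ) (sym (E-suc i 0ℤ)))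
      where
      lemma : ∀ a c → 1ℤ * (a + 0ℤ * 0ℤ * c) ≡ 1ℤ * (a + 0ℤ * c) - 0ℤ
      lemma = solve-∀
    eq (suc j) = trans (lemma (pos 2 j) (A i (pos 2 j)) (C i (pos 2 j))) (sym (cong₂ _-_
        (trans (cong (λ x → x * E i x) (pos-suc 2 j)) (cong ((pos 2 j + 1ℤ) *_) (E-suc i (pos 2 j))))
        (trans (cong (λ x → x * E i x) (pos-pred 1 j)) (cong ((pos 2 j - 1ℤ) *_) (E-pred i (pos 2 j))))))
      where
      lemma : ∀ x a c → + 2 * (a + x * x * c) ≡ (x + 1ℤ) * (a + x * c) - (x - 1ℤ) * (a - x * c)
      lemma = solve-∀

  -- At the wall only one of two neighbours exists; by evenness it gives half of their sum, which is
  -- the weight 1 in `w`.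
  lead-ev-hop : ∀ i → Lead wev i 1ℤ (hopFn (ev 1 i))
  lead-ev-hop i = lead-cong refl eq (lead-weight w (lead-∘ (pos 0) (lead-A i)))
    where
    eq : ∀ j → w j * A i (pos 0 j) ≡ hopFn (ev 1 i) j
    eq zero    = trans (lemma (A i 0ℤ) (C i 0ℤ)) (sym (E-suc i 0ℤ))
      where
      lemma : ∀ a c → 1ℤ * a ≡ a + 0ℤ * c
      lemma = solve-∀
    eq (suc j) = trans (lemma (pos 2 j) (A i (pos 2 j)) (C i (pos 2 j))) (sym (cong₂ _+_
        (trans (cong (E i) (pos-pred 1 j)) (E-pred i (pos 2 j)))
        (trans (cong (E i) (pos-suc 2 j)) (E-suc i (pos 2 j)))))
      where
      lemma : ∀ x a c → + 2 * a ≡ (a - x * c) + (a + x * c)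
      lemma = solve-∀

  -- The neighbour missing at the wall would have position 0, where odd functions vanish, so the
  -- formula for interior sites persists.
  lead-od-hop : ∀ i → Lead (od 1) i (+ 2) (hopFn (od 2 i))
  lead-od-hop i = lead-cong refl eq (lead-od-sum 0 i)
    where
    eq : ∀ j → od 0 i j + od 2 i j ≡ hopFn (od 2 i) j
    eq zero    = +-identityˡ _
    eq (suc j) = refl

-- Transfer of the determinant formula through the four classes of rows.

module Recursion where

  open Determinants
  open RowMatching
  open EvenPolynomials
  open import Data.Bool using (Bool; true; false)
  open import Data.Nat as ℕ using (ℕ; zero; suc)
  import Data.Nat.Properties as ℕₚ
  open import Data.Integer using (+_; _+_; _*_; 1ℤ)
  open import Data.Integer.Properties using (*-identityˡ)
  open import Data.List using (List; []; _∷_)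
  open import Relation.Binary.PropositionalEquality using (_≡_; refl; trans; cong; subst)

  -- Row r of the region has class r mod 4 (shifted by 2 for K_na).
  data Class : Set where
    c0 c1 c2 c3 : Class

  next : Class → Class
  next c0 = c1
  next c1 = c2
  next c2 = c3
  next c3 = c0

  -- Rows of classes 0, 1, 2, 3 start at p = 1, 0, 1, 2, so the next row starts one step to the left
  -- after `c0` and `c3` and one step to the right after `c1` and `c2`.
  match : Class → List Bool → List Bool → (List Bool → ℕ) → ℕ
  match c0 = scan
  match c1 = scanˡ
  match c2 = scanˡ
  match c3 = scan

  count : (Class → ℕ) → Class → ℕ → List Bool → ℕ
  count len c zero    xs = scan [] xs (λ _ → 1)
  count len c (suc d) xs = match c (full (len (next c))) xs (count len (next c) d)

  -- The last row has nothing above it, so all its cells must already be used: `ε`, the determinant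
  -- of no functions, tests exactly this.
  top : ∀ len c m f → Part m f 0 1 1 (count len c 0)
  top len c m f = formula 1ℤ 1ℤ refl refl λ xs _ → go 0 xs
    where
    go : ∀ n xs → + scan [] xs (λ _ → 1) * 1ℤ ≡ 1ℤ * ε (ones n xs)
    go n []           = refl
    go n (true ∷ xs)  = refl
    go n (false ∷ xs) = go (suc n) xs

  -- The accumulated leading coefficients: `α` for integrating even functions, `α′` for the
  -- half-weighted ones, `β` for integrating odd functions, `τ` for sums over two neighbours.
  α α′ β τ : ℕ → ℕ
  α  = prodℕ (λ i → 2 ℕ.* (1 ℕ.+ 2 ℕ.* i))
  α′ = prodℕ (λ i → 1 ℕ.+ 2 ℕ.* i)
  β  = prodℕ (λ i → 2 ℕ.* (2 ℕ.* suc i))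
  τ  = prodℕ (λ i → 2)

  -- Aztec order 2h: eᵢ passes from rows of class i + 1 to rows of class i.  Rows with an even number
  -- of rows above them are described by their cells, the others by their empty sites.
  module Even (h : ℕ) where

    len : Class → ℕ
    len c1 = suc h
    len _  = h

    -- The site p = 0, absent from rows of class 3, is the virtual empty site at which the odd
    -- antiderivative `od 0` vanishes.
    e3 : ∀ {k c d n} → Part h (ev 1) k c d (count len c0 n) → Hole h (od 2) k (c ℕ.* α k) d (count len c3 (suc n))
    e3 p = hole-scan (od 0) (λ _ → refl) (formula-unlead _ _ (lead-od-diff 0) p)

    e2 : ∀ {k c d n} → Hole h (od 2) k c d (count len c3 n) → Part h (od 1) k c (d ℕ.* τ k) (count len c2 (suc n))
    e2 p = formula-lead (od 1) _ lead-od-hop (part-scanˡ p ℕₚ.≤-refl)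

    -- The row reaches p = 0 and its first site has only a right neighbour, so the first interval
    -- starts at a genuine empty site: this is the step of the cycle in which k grows.
    e1 : ∀ {k c d n} → Part h (od 1) k c d (count len c2 n) → Hole (suc h) (ev 0) (suc k) (c ℕ.* β k) d (count len c1 (suc n))
    e1 p = hole-scanˡ (ev 0) (λ _ → refl) (formula-unlead _ _ (lead-ev-diff 0) p)

    e0 : ∀ {k c d n} → Hole (suc h) (ev 0) k c d (count len c1 n) → Part h (ev 1) k c (d ℕ.* τ k) (count len c0 (suc n))
    e0 p = formula-lead (ev 1) _ (lead-ev-sum 0) (part-scan p ℕₚ.≤-refl)

  -- Aztec order 2h + 1.
  module Odd (h : ℕ) where

    len : Class → ℕ
    len c3 = h
    len _  = suc h

    o0 : ∀ {k c d n} → Part (suc h) wev k c d (count len c1 n) → Hole (suc h) (od 1) k (c ℕ.* α′ k) d (count len c0 (suc n))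
    o0 p = hole-scan od₀ (λ _ → refl) (formula-unlead _ _ lead-od₀-diff p)

    o3 : ∀ {k c d n} → Hole (suc h) (od 1) k c d (count len c0 n) → Part h (od 2) k c (d ℕ.* τ k) (count len c3 (suc n))
    o3 p = formula-lead (od 2) _ (lead-od-sum 1) (part-scan p ℕₚ.≤-refl)

    o2 : ∀ {k c d n} → Part h (od 2) k c d (count len c3 n) → Hole (suc h) (ev 1) (suc k) (c ℕ.* β k) d (count len c2 (suc n))
    o2 p = hole-scanˡ (ev 1) (λ _ → refl) (formula-unlead _ _ (lead-ev-diff 1) p)

    o1 : ∀ {k c d n} → Hole (suc h) (ev 1) k c d (count len c2 n) → Part (suc h) wev k c d (count len c1 (suc n))
    o1 {k} {d = d} p = subst (λ z → Part (suc h) wev k _ z _) (trans (cong (d ℕ.*_) (ones≡1 k)) (ℕₚ.*-identityʳ d))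
      (formula-lead wev (λ _ → 1) lead-ev-hop (part-scanˡ p ℕₚ.≤-refl))
      where
      ones≡1 : ∀ k → prodℕ (λ _ → 1) k ≡ 1
      ones≡1 zero    = refl
      ones≡1 (suc k) = trans (ℕₚ.*-identityˡ _) (ones≡1 k)

-- Evaluation of the determinants on row 0.

module Vandermonde where

  open Determinants
  open RowMatching
  open EvenPolynomials
  open import Defs using (prod; prodLt)
  open import Data.Bool using (Bool; true; false; not)
  open import Data.Nat as ℕ using (ℕ; zero; suc)
  import Data.Nat.Properties as ℕₚ
  open import Data.Nat.Tactic.RingSolver using () renaming (solve-∀ to solve-ℕ)
  open import Data.Integer using (ℤ; +_; -_; ∣_∣; _+_; _-_; _*_; 0ℤ; 1ℤ)
  open import Data.Integer.Properties using (*-zeroʳ; *-identityˡ; pos-+; +-identityʳ; abs-*; ∣i-j∣≡∣j-i∣; *-identityʳ)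
  open import Data.Integer.Tactic.RingSolver using (solve-∀)
  open import Data.List using (List; []; _∷_; length; _++_)
  open import Data.List.Relation.Unary.All using (All; []; _∷_)
  import Data.List.Relation.Unary.All as All
  open import Function using (_∘_)
  open import Relation.Binary.PropositionalEquality using (_≡_; refl; sym; trans; cong; cong₂; subst; module ≡-Reasoning)
  open ≡-Reasoning

  D-vanish : ∀ f φ {xs} → All (λ x → f x ≡ 0ℤ) xs → D f φ xs ≡ 0ℤ
  D-vanish f φ []                 = refl
  D-vanish f φ (_∷_ {x} {xs} e p) rewrite e | D-vanish f (φ ⟨ x ⟩) p = refl

  module _ (X : ℕ → ℤ) where

    -- The product of the factors x² - X(y)², multiplied out so that `lead-²` and `lead-+` give its
    -- leading coefficient.
    roots : List ℕ → ℤ → ℤ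
    roots []       x = 1ℤ
    roots (y ∷ ys) x = x * x * roots ys x + - (X y * X y) * roots ys x

    lead-roots : ∀ ys → Lead E (length ys) 1ℤ (roots ys)
    lead-roots []       = base λ _ → refl
    lead-roots (y ∷ ys) = lead-+ (lead-² (lead-roots ys))
      (lead-cong (*-zeroʳ (- (X y * X y))) (λ _ → refl) (lead-· (- (X y * X y)) (lead-up (lead-roots ys))))

    roots-vanish : ∀ ys → All (λ y → roots ys (X y) ≡ 0ℤ) ys
    roots-vanish []       = []
    roots-vanish (y ∷ ys) = lemma (X y) (roots ys (X y)) ∷ All.map (λ {x} e → trans (cong (λ z → X x * X x * z + - (X y * X y) * z) e) (zero′ (X x) (X y))) (roots-vanish ys)
      where
      lemma : ∀ x r → x * x * r + - (x * x) * r ≡ 0ℤ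
      lemma = solve-∀
      zero′ : ∀ x y → x * x * 0ℤ + - (y * y) * 0ℤ ≡ 0ℤ
      zero′ = solve-∀

    vandermonde : List ℕ → ℤ
    vandermonde []       = 1ℤ
    vandermonde (x ∷ xs) = roots xs (X x) * vandermonde xs

    -- Expanding along the monic polynomial that vanishes at all points but the first.
    det-vandermonde : ∀ xs → det (below (λ i → E i ∘ X) (length xs)) xs ≡ vandermonde xs
    det-vandermonde []       = refl
    det-vandermonde (x ∷ xs) = begin
      det (below b (suc k)) (x ∷ xs)                               ≡⟨ sym (*-identityˡ _) ⟩
      1ℤ * det (below b (suc k)) (x ∷ xs)                          ≡⟨ sym (D-lead b q (lead-∘ X (lead-roots xs)) (x ∷ xs)) ⟩
      q x * det (below b k) xs - D q (det (below b k) ⟨ x ⟩) xs    ≡⟨ cong₂ _-_ (cong (q x *_) (det-vandermonde xs)) (D-vanish q _ (roots-vanish xs)) ⟩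
      q x * vandermonde xs - 0ℤ                                    ≡⟨ +-identityʳ _ ⟩
      q x * vandermonde xs                                         ∎
      where
      k = length xs
      b = λ i → E i ∘ X
      q = roots xs ∘ X

  weight : Fn → List ℕ → ℤ
  weight w []       = 1ℤ
  weight w (x ∷ xs) = w x * weight w xs

  det-weight : ∀ (w : Fn) (f : ℕ → Fn) k xs → det (below (λ i x → w x * f i x) k) xs ≡ weight w xs * det (below f k) xs
  det-weight w f zero    []       = refl
  det-weight w f zero    (x ∷ xs) = sym (*-zeroʳ (weight w (x ∷ xs)))
  det-weight w f (suc k) xs = trans (D-cong (λ _ → refl) (det-weight w f k) xs) (D-weight (f k) (det (below f k)) xs)
    where
    D-weight : ∀ g φ xs → D (λ x → w x * g x) (λ ys → weight w ys * φ ys) xs ≡ weight w xs * D g φ xs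
    D-weight g φ []       = refl
    D-weight g φ (x ∷ xs) = begin
      w x * g x * (weight w xs * φ xs) - D wg (λ ys → w x * weight w ys * φ (x ∷ ys)) xs
        ≡⟨ cong (λ z → w x * g x * (weight w xs * φ xs) - z)
             (trans (D-cong (λ _ → refl) (λ ys → assoc (w x) (weight w ys) (φ (x ∷ ys))) xs)
             (trans (D-·ʳ (w x) wg (λ ys → weight w ys * φ (x ∷ ys)) xs)
                    (cong (w x *_) (D-weight g (φ ⟨ x ⟩) xs)))) ⟩
      w x * g x * (weight w xs * φ xs) - w x * (weight w xs * D g (φ ⟨ x ⟩) xs)
        ≡⟨ lemma (w x) (g x) (weight w xs) (φ xs) _ ⟩
      w x * weight w xs * (g x * φ xs - D g (φ ⟨ x ⟩) xs) ∎
      where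
      wg = λ x → w x * g x
      assoc : ∀ a b c → a * b * c ≡ a * (b * c)
      assoc = solve-∀
      lemma : ∀ w g v p d → w * g * (v * p) - w * (v * d) ≡ w * v * (g * p - d)
      lemma = solve-∀

  alt : Bool → ℕ → List Bool
  alt b zero    = []
  alt b (suc m) = b ∷ alt (not b) m

  length-alt : ∀ b m → length (alt b m) ≡ m
  length-alt b zero    = refl
  length-alt b (suc m) = cong suc (length-alt (not b) m)

  ap : ℕ → ℕ → List ℕ
  ap n zero    = []
  ap n (suc k) = n ∷ ap (suc (suc n)) k

  length-ap : ∀ n k → length (ap n k) ≡ k
  length-ap n zero    = refl
  length-ap n (suc k) = cong suc (length-ap (suc (suc n)) k)

  ap-snoc : ∀ n k → ap n (suc k) ≡ ap n k ++ (n ℕ.+ 2 ℕ.* k) ∷ []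
  ap-snoc n zero    = cong (_∷ []) (sym (ℕₚ.+-identityʳ n))
  ap-snoc n (suc k) = cong (n ∷_) (trans (ap-snoc (suc (suc n)) k) (cong (λ z → ap (suc (suc n)) k ++ z ∷ []) (lemma n k)))
    where
    lemma : ∀ n k → suc (suc n) ℕ.+ 2 ℕ.* k ≡ n ℕ.+ 2 ℕ.* suc k
    lemma = solve-ℕ

  zeros-alt : ∀ n b m → zeros n (alt b m) ≡ ones n (alt (not b) m)
  zeros-alt n b     zero    = refl
  zeros-alt n true  (suc m) = zeros-alt (suc n) false m
  zeros-alt n false (suc m) = cong (n ∷_) (zeros-alt (suc n) true m)

  ones-true-even : ∀ n k → ones n (alt true (k ℕ.* 2)) ≡ ap n k
  ones-true-even n zero    = refl
  ones-true-even n (suc k) = cong (n ∷_) (ones-true-even (suc (suc n)) k)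

  ones-true-odd : ∀ n k → ones n (alt true (suc (k ℕ.* 2))) ≡ ap n (suc k)
  ones-true-odd n zero    = refl
  ones-true-odd n (suc k) = cong (n ∷_) (ones-true-odd (suc (suc n)) k)

  ones-false-even : ∀ n k → ones n (alt false (k ℕ.* 2)) ≡ ap (suc n) k
  ones-false-even n zero    = refl
  ones-false-even n (suc k) = cong (suc n ∷_) (ones-false-even (suc (suc n)) k)

  ones-false-odd : ∀ n k → ones n (alt false (suc (k ℕ.* 2))) ≡ ap (suc n) k
  ones-false-odd n zero    = refl
  ones-false-odd n (suc k) = cong (suc n ∷_) (ones-false-odd (suc (suc n)) k)

  prod-cong : ∀ n {f g} → (∀ i → i ℕ.< n → f (suc i) ≡ g (suc i)) → prod n f ≡ prod n g
  prod-cong zero    e = refl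
  prod-cong (suc n) e = cong₂ ℕ._*_ (prod-cong n (λ i i<n → e i (ℕₚ.m≤n⇒m≤1+n i<n))) (e n (ℕₚ.n<1+n n))

  module _ (X : ℕ → ℤ) where

    ∣weight-snoc∣ : ∀ xs y → ∣ weight X (xs ++ y ∷ []) ∣ ≡ ∣ weight X xs ∣ ℕ.* ∣ X y ∣
    ∣weight-snoc∣ []       y = trans (cong ∣_∣ (*-identityʳ (X y))) (sym (ℕₚ.*-identityˡ _))
    ∣weight-snoc∣ (x ∷ xs) y = begin
      ∣ X x * weight X (xs ++ y ∷ []) ∣         ≡⟨ abs-* (X x) _ ⟩
      ∣ X x ∣ ℕ.* ∣ weight X (xs ++ y ∷ []) ∣   ≡⟨ cong (∣ X x ∣ ℕ.*_) (∣weight-snoc∣ xs y) ⟩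
      ∣ X x ∣ ℕ.* (∣ weight X xs ∣ ℕ.* ∣ X y ∣) ≡⟨ sym (ℕₚ.*-assoc ∣ X x ∣ _ _) ⟩
      ∣ X x ∣ ℕ.* ∣ weight X xs ∣ ℕ.* ∣ X y ∣   ≡⟨ cong (ℕ._* ∣ X y ∣) (sym (abs-* (X x) _)) ⟩
      ∣ X x * weight X xs ∣ ℕ.* ∣ X y ∣         ∎

    diff² : ℕ → ℕ → ℕ
    diff² x y = ∣ X x * X x - X y * X y ∣

    ∣roots-snoc∣ : ∀ xs y z → ∣ roots X (xs ++ z ∷ []) (X y) ∣ ≡ ∣ roots X xs (X y) ∣ ℕ.* diff² y z
    ∣roots-snoc∣ [] y z = trans (cong ∣_∣ (lemma (X y) (X z))) (sym (ℕₚ.*-identityˡ _))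
      where
      lemma : ∀ y z → y * y * 1ℤ + - (z * z) * 1ℤ ≡ y * y - z * z
      lemma = solve-∀
    ∣roots-snoc∣ (x ∷ xs) y z = begin
      ∣ Y * Y * q + - (X x * X x) * q ∣              ≡⟨ cong ∣_∣ (factor Y (X x) q) ⟩
      ∣ (Y * Y - X x * X x) * q ∣                    ≡⟨ abs-* (Y * Y - X x * X x) q ⟩
      diff² y x ℕ.* ∣ q ∣                            ≡⟨ cong (diff² y x ℕ.*_) (∣roots-snoc∣ xs y z) ⟩
      diff² y x ℕ.* (∣ p ∣ ℕ.* diff² y z)            ≡⟨ sym (ℕₚ.*-assoc (diff² y x) _ _) ⟩
      diff² y x ℕ.* ∣ p ∣ ℕ.* diff² y z              ≡⟨ cong (ℕ._* diff² y z) (sym (abs-* (Y * Y - X x * X x) p)) ⟩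
      ∣ (Y * Y - X x * X x) * p ∣ ℕ.* diff² y z      ≡⟨ cong (λ u → ∣ u ∣ ℕ.* diff² y z) (sym (factor Y (X x) p)) ⟩
      ∣ Y * Y * p + - (X x * X x) * p ∣ ℕ.* diff² y z ∎
      where
      Y = X y
      p = roots X xs (X y)
      q = roots X (xs ++ z ∷ []) (X y)
      factor : ∀ y x q → y * y * q + - (x * x) * q ≡ (y * y - x * x) * q
      factor = solve-∀

    -- Lists unfold at the front but the products over i < j at the largest index, so the last point
    -- is split off; absolute values absorb the reversed differences.
    ∣vandermonde-snoc∣ : ∀ xs y → ∣ vandermonde X (xs ++ y ∷ []) ∣ ≡ ∣ vandermonde X xs ∣ ℕ.* ∣ roots X xs (X y) ∣
    ∣vandermonde-snoc∣ []       y = refl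
    ∣vandermonde-snoc∣ (x ∷ xs) y = begin
      ∣ roots X (xs ++ y ∷ []) (X x) * vandermonde X (xs ++ y ∷ []) ∣
        ≡⟨ abs-* (roots X (xs ++ y ∷ []) (X x)) _ ⟩
      ∣ roots X (xs ++ y ∷ []) (X x) ∣ ℕ.* ∣ vandermonde X (xs ++ y ∷ []) ∣
        ≡⟨ cong₂ ℕ._*_ (trans (∣roots-snoc∣ xs x y) (cong (r ℕ.*_) (∣i-j∣≡∣j-i∣ (X x * X x) (X y * X y)))) (∣vandermonde-snoc∣ xs y) ⟩
      (r ℕ.* diff² y x) ℕ.* (v ℕ.* q)
        ≡⟨ lemma r (diff² y x) v q ⟩
      (r ℕ.* v) ℕ.* (diff² y x ℕ.* q)
        ≡⟨ cong₂ ℕ._*_ (sym (abs-* (roots X xs (X x)) _)) (trans (sym (abs-* (X y * X y - X x * X x) _)) (cong ∣_∣ (sym (factor (X y) (X x) _)))) ⟩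
      ∣ roots X xs (X x) * vandermonde X xs ∣ ℕ.* ∣ roots X (x ∷ xs) (X y) ∣ ∎
      where
      r = ∣ roots X xs (X x) ∣
      v = ∣ vandermonde X xs ∣
      q = ∣ roots X xs (X y) ∣
      lemma : ∀ r d v q → (r ℕ.* d) ℕ.* (v ℕ.* q) ≡ (r ℕ.* v) ℕ.* (d ℕ.* q)
      lemma = solve-ℕ
      factor : ∀ y x q → y * y * q + - (x * x) * q ≡ (y * y - x * x) * q
      factor = solve-∀

    ∣weight-ap∣ : ∀ n k → ∣ weight X (ap n k) ∣ ≡ prod k (λ i → ∣ X (n ℕ.+ 2 ℕ.* (i ℕ.∸ 1)) ∣)
    ∣weight-ap∣ n zero    = refl
    ∣weight-ap∣ n (suc k) = trans (cong (∣_∣ ∘ weight X) (ap-snoc n k))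
      (trans (∣weight-snoc∣ (ap n k) _) (cong (ℕ._* ∣ X (n ℕ.+ 2 ℕ.* k) ∣) (∣weight-ap∣ n k)))

    ∣roots-ap∣ : ∀ n k y → ∣ roots X (ap n k) (X y) ∣ ≡ prod k (λ i → diff² y (n ℕ.+ 2 ℕ.* (i ℕ.∸ 1)))
    ∣roots-ap∣ n zero    y = refl
    ∣roots-ap∣ n (suc k) y = trans (cong (λ zs → ∣ roots X zs (X y) ∣) (ap-snoc n k))
      (trans (∣roots-snoc∣ (ap n k) y _) (cong (ℕ._* diff² y (n ℕ.+ 2 ℕ.* k)) (∣roots-ap∣ n k y)))

    ∣vandermonde-ap∣ : ∀ n k → ∣ vandermonde X (ap n k) ∣ ≡
      prodLt k (λ i j → diff² (n ℕ.+ 2 ℕ.* (j ℕ.∸ 1)) (n ℕ.+ 2 ℕ.* (i ℕ.∸ 1)))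
    ∣vandermonde-ap∣ n zero    = refl
    ∣vandermonde-ap∣ n (suc k) = trans (cong (∣_∣ ∘ vandermonde X) (ap-snoc n k))
      (trans (∣vandermonde-snoc∣ (ap n k) _) (cong₂ ℕ._*_ (∣vandermonde-ap∣ n k) (∣roots-ap∣ n k _)))

  -- Writing j as i + 1 + t turns the truncated difference j - i into an honest number.
  prodLt-cong : ∀ n {f g} → (∀ i t → f (suc i) (suc (suc (i ℕ.+ t))) ≡ g (suc i) (suc (suc (i ℕ.+ t)))) → prodLt n f ≡ prodLt n g
  prodLt-cong n {f} {g} e = prod-cong n λ j _ → prod-cong j λ i i<j →
    subst (λ j → f (suc i) (suc j) ≡ g (suc i) (suc j)) (ℕₚ.m+[n∸m]≡n i<j) (e i (j ℕ.∸ suc i))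

  pos-value : ∀ s j → pos s j ≡ + (s ℕ.+ 2 ℕ.* j)
  pos-value s zero    = cong +_ (sym (ℕₚ.+-identityʳ s))
  pos-value s (suc j) = trans (pos-value (suc (suc s)) j) (cong +_ (lemma s j))
    where
    lemma : ∀ s j → suc (suc s) ℕ.+ 2 ℕ.* j ≡ s ℕ.+ 2 ℕ.* suc j
    lemma = solve-ℕ

  diff²-value : ∀ n i t → diff² (pos 1) (n ℕ.+ 2 ℕ.* (i ℕ.+ t)) (n ℕ.+ 2 ℕ.* i) ≡ 8 ℕ.* t ℕ.* (1 ℕ.+ 2 ℕ.* n ℕ.+ 4 ℕ.* i ℕ.+ 2 ℕ.* t)
  diff²-value n i t = begin
    ∣ Y * Y - Z * Z ∣                              ≡⟨ cong ∣_∣ (cong₂ (λ y z → y * y - z * z) Y≡ (pos-value 1 (n ℕ.+ 2 ℕ.* i))) ⟩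
    ∣ + (a ℕ.+ b) * + (a ℕ.+ b) - + a * + a ∣      ≡⟨ cong (λ z → ∣ z * z - + a * + a ∣) (pos-+ a b) ⟩
    ∣ (+ a + + b) * (+ a + + b) - + a * + a ∣      ≡⟨ cong ∣_∣ (lemma (+ a) (+ b)) ⟩
    ∣ + b * (+ a + + a + + b) ∣                    ≡⟨ abs-* (+ b) (+ (a ℕ.+ a ℕ.+ b)) ⟩
    b ℕ.* (a ℕ.+ a ℕ.+ b)                          ≡⟨ arith n i t ⟩
    8 ℕ.* t ℕ.* (1 ℕ.+ 2 ℕ.* n ℕ.+ 4 ℕ.* i ℕ.+ 2 ℕ.* t) ∎
    where
    Y = pos 1 (n ℕ.+ 2 ℕ.* (i ℕ.+ t))
    Z = pos 1 (n ℕ.+ 2 ℕ.* i)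
    a = 1 ℕ.+ 2 ℕ.* (n ℕ.+ 2 ℕ.* i)
    b = 4 ℕ.* t
    split : ∀ n i t → 1 ℕ.+ 2 ℕ.* (n ℕ.+ 2 ℕ.* (i ℕ.+ t)) ≡ 1 ℕ.+ 2 ℕ.* (n ℕ.+ 2 ℕ.* i) ℕ.+ 4 ℕ.* t
    split = solve-ℕ
    Y≡ : Y ≡ + (a ℕ.+ b)
    Y≡ = trans (pos-value 1 (n ℕ.+ 2 ℕ.* (i ℕ.+ t))) (cong +_ (split n i t))
    lemma : ∀ a b → (a + b) * (a + b) - a * a ≡ b * (a + a + b)
    lemma = solve-∀
    arith : ∀ n i t → 4 ℕ.* t ℕ.* (1 ℕ.+ 2 ℕ.* (n ℕ.+ 2 ℕ.* i) ℕ.+ (1 ℕ.+ 2 ℕ.* (n ℕ.+ 2 ℕ.* i)) ℕ.+ 4 ℕ.* t) ≡ 8 ℕ.* t ℕ.* (1 ℕ.+ 2 ℕ.* n ℕ.+ 4 ℕ.* i ℕ.+ 2 ℕ.* t)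
    arith = solve-ℕ

  -- The points are p_i = 4i - e, hence p_j² - p_i² = 4(j - i) · 2(2i + 2j - e).
  spread : ℕ → ℕ → ℕ
  spread e k = prodLt k (λ i j → 8 ℕ.* (j ℕ.∸ i) ℕ.* (2 ℕ.* i ℕ.+ 2 ℕ.* j ℕ.∸ e))

  -- The hypothesis says that the first point 1 + 2n equals 4 - e: e = 3 stands for the points 1, 5,
  -- 9, ... and e = 1 for 3, 7, 11, ....
  ∣det-ev∣ : ∀ n e → 1 ℕ.+ 2 ℕ.* n ℕ.+ e ≡ 4 → ∀ k → ∣ det (below (ev 1) k) (ap n k) ∣ ≡ spread e k
  ∣det-ev∣ n e n+e k = begin
    ∣ det (below (ev 1) k) (ap n k) ∣                        ≡⟨ cong (λ l → ∣ det (below (ev 1) l) (ap n k) ∣) (sym (length-ap n k)) ⟩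
    ∣ det (below (ev 1) (length (ap n k))) (ap n k) ∣        ≡⟨ cong ∣_∣ (det-vandermonde (pos 1) (ap n k)) ⟩
    ∣ vandermonde (pos 1) (ap n k) ∣                         ≡⟨ ∣vandermonde-ap∣ (pos 1) n k ⟩
    prodLt k (λ i j → diff² (pos 1) (n ℕ.+ 2 ℕ.* (j ℕ.∸ 1)) (n ℕ.+ 2 ℕ.* (i ℕ.∸ 1)))
                                                             ≡⟨ prodLt-cong k step′ ⟩
    spread e k ∎
    where
    step′ : ∀ i t → diff² (pos 1) (n ℕ.+ 2 ℕ.* suc (i ℕ.+ t)) (n ℕ.+ 2 ℕ.* i) ≡
      8 ℕ.* (suc (i ℕ.+ t) ℕ.∸ i) ℕ.* (2 ℕ.* suc i ℕ.+ 2 ℕ.* suc (suc (i ℕ.+ t)) ℕ.∸ e)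
    step′ i t = begin
      diff² (pos 1) (n ℕ.+ 2 ℕ.* suc (i ℕ.+ t)) (n ℕ.+ 2 ℕ.* i)
        ≡⟨ cong (λ z → diff² (pos 1) (n ℕ.+ 2 ℕ.* z) (n ℕ.+ 2 ℕ.* i)) (sym (ℕₚ.+-suc i t)) ⟩
      diff² (pos 1) (n ℕ.+ 2 ℕ.* (i ℕ.+ suc t)) (n ℕ.+ 2 ℕ.* i)
        ≡⟨ diff²-value n i (suc t) ⟩
      8 ℕ.* suc t ℕ.* (1 ℕ.+ 2 ℕ.* n ℕ.+ 4 ℕ.* i ℕ.+ 2 ℕ.* suc t)
        ≡⟨ cong₂ (λ x y → 8 ℕ.* x ℕ.* y)
             (sym (trans (cong (ℕ._∸ i) (sym (ℕₚ.+-suc i t))) (ℕₚ.m+n∸m≡n i (suc t))))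
             (sym (trans (cong (ℕ._∸ e) (trans (arith i t) (trans (cong (ℕ._+ (4 ℕ.* i ℕ.+ 2 ℕ.* suc t)) (sym n+e)) (arith′ n e i t))))
                         (ℕₚ.m+n∸n≡m _ e))) ⟩
      8 ℕ.* (suc (i ℕ.+ t) ℕ.∸ i) ℕ.* (2 ℕ.* suc i ℕ.+ 2 ℕ.* suc (suc (i ℕ.+ t)) ℕ.∸ e) ∎
      where
      arith : ∀ i t → 2 ℕ.* suc i ℕ.+ 2 ℕ.* suc (suc (i ℕ.+ t)) ≡ 4 ℕ.+ (4 ℕ.* i ℕ.+ 2 ℕ.* suc t)
      arith = solve-ℕ
      arith′ : ∀ n e i t → 1 ℕ.+ 2 ℕ.* n ℕ.+ e ℕ.+ (4 ℕ.* i ℕ.+ 2 ℕ.* suc t) ≡ 1 ℕ.+ 2 ℕ.* n ℕ.+ 4 ℕ.* i ℕ.+ 2 ℕ.* suc t ℕ.+ e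
      arith′ = solve-ℕ

  ∣det-od∣ : ∀ n e → 1 ℕ.+ 2 ℕ.* n ℕ.+ e ≡ 4 → ∀ k →
    ∣ det (below (od 1) k) (ap n k) ∣ ≡ prod k (λ j → 2 ℕ.* j ℕ.+ 2 ℕ.* j ℕ.∸ e) ℕ.* spread e k
  ∣det-od∣ n e n+e k = begin
    ∣ det (below (od 1) k) (ap n k) ∣                                      ≡⟨ cong ∣_∣ (det-weight (pos 1) (ev 1) k (ap n k)) ⟩
    ∣ weight (pos 1) (ap n k) * det (below (ev 1) k) (ap n k) ∣            ≡⟨ abs-* (weight (pos 1) (ap n k)) _ ⟩
    ∣ weight (pos 1) (ap n k) ∣ ℕ.* ∣ det (below (ev 1) k) (ap n k) ∣      ≡⟨ cong₂ ℕ._*_ (trans (∣weight-ap∣ (pos 1) n k) (prod-cong k λ i _ → step′ i)) (∣det-ev∣ n e n+e k) ⟩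
    prod k (λ j → 2 ℕ.* j ℕ.+ 2 ℕ.* j ℕ.∸ e) ℕ.* spread e k                ∎
    where
    step′ : ∀ i → ∣ pos 1 (n ℕ.+ 2 ℕ.* i) ∣ ≡ 2 ℕ.* suc i ℕ.+ 2 ℕ.* suc i ℕ.∸ e
    step′ i = trans (cong ∣_∣ (pos-value 1 (n ℕ.+ 2 ℕ.* i)))
      (sym (trans (cong (ℕ._∸ e) (trans (arith i) (trans (cong (ℕ._+ 4 ℕ.* i) (sym n+e)) (arith′ n e i)))) (ℕₚ.m+n∸n≡m _ e)))
      where
      arith : ∀ i → 2 ℕ.* suc i ℕ.+ 2 ℕ.* suc i ≡ 4 ℕ.+ 4 ℕ.* i
      arith = solve-ℕ
      arith′ : ∀ n e i → 1 ℕ.+ 2 ℕ.* n ℕ.+ e ℕ.+ 4 ℕ.* i ≡ 1 ℕ.+ 2 ℕ.* (n ℕ.+ 2 ℕ.* i) ℕ.+ e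
      arith′ = solve-ℕ

-- Arithmetic of the constants and of the product formulas.

module Products where

  open import Defs using (prod; prodLt; prodLe)
  open RowMatching using (prodℕ)
  open Recursion using (α; α′; β; τ)
  open Vandermonde using (spread; prod-cong)
  open import Data.Nat
  open import Data.Nat.Properties
  open import Data.Nat.Tactic.RingSolver using (solve-∀)
  open import Relation.Binary.PropositionalEquality
  open ≡-Reasoning

  prod-* : ∀ n f g → prod n (λ i → f i * g i) ≡ prod n f * prod n g
  prod-* zero    f g = refl
  prod-* (suc n) f g rewrite prod-* n f g = lemma (prod n f) (prod n g) (f (suc n)) (g (suc n))
    where
    lemma : ∀ a b c d → a * b * (c * d) ≡ a * c * (b * d)
    lemma = solve-∀

  prod-head : ∀ n f → prod (suc n) f ≡ f 1 * prod n (λ i → f (suc i))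
  prod-head zero    f = *-comm 1 (f 1)
  prod-head (suc n) f = trans (cong (_* f (suc (suc n))) (prod-head n f)) (*-assoc (f 1) _ _)

  prodLe-diagonal : ∀ n f → prodLe n f ≡ prodLt n f * prod n (λ j → f j j)
  prodLe-diagonal n f = trans (prod-cong n λ _ _ → refl) (prod-* n (λ j → prod (j ∸ 1) (λ i → f i j)) (λ j → f j j))

  τ≡2^ : ∀ k → τ k ≡ 2 ^ k
  τ≡2^ zero    = refl
  τ≡2^ (suc k) = cong (2 *_) (τ≡2^ k)

  α≡τα′ : ∀ k → α k ≡ τ k * α′ k
  α≡τα′ zero    = refl
  α≡τα′ (suc k) rewrite α≡τα′ k = lemma (1 + 2 * k) (τ k) (α′ k)
    where
    lemma : ∀ x t a → 2 * x * (t * a) ≡ 2 * t * (x * a)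
    lemma = solve-∀

  -- Both sides are 8^k k!, since `β k` is 4^k k!.
  prod-τβ : ∀ k → prod k (λ i → 8 * (suc k ∸ i)) ≡ τ k * β k
  prod-τβ zero    = refl
  prod-τβ (suc k) = begin
    prod (suc k) (λ i → 8 * (suc (suc k) ∸ i))      ≡⟨ prod-head k _ ⟩
    8 * suc k * prod k (λ i → 8 * (suc k ∸ i))      ≡⟨ cong (8 * suc k *_) (prod-τβ k) ⟩
    8 * suc k * (τ k * β k)                         ≡⟨ lemma (suc k) (τ k) (β k) ⟩
    2 * τ k * (2 * (2 * suc k) * β k)               ∎
    where
    lemma : ∀ x t b → 8 * x * (t * b) ≡ 2 * t * (2 * (2 * x) * b)
    lemma = solve-∀

  -- (k+1)⋯(2k) = 2^k · 1 · 3 ⋯ (2k-1)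
  prod-α : ∀ k → prod k (λ i → i + k) ≡ α k
  prod-α zero    = refl
  prod-α (suc k) = *-cancelˡ-≡ _ _ (suc k) (begin
    suc k * (P * (suc k + suc k))             ≡⟨ *-assoc (suc k) P _ ⟨
    suc k * P * (suc k + suc k)               ≡⟨ cong (_* (suc k + suc k)) shift ⟩
    prod k (λ i → i + k) * (suc k + k) * (suc k + suc k)
                                              ≡⟨ cong (λ z → z * (suc k + k) * (suc k + suc k)) (prod-α k) ⟩
    α k * (suc k + k) * (suc k + suc k)       ≡⟨ lemma k (α k) ⟩
    suc k * (2 * (1 + 2 * k) * α k)           ∎)
    where
    P = prod k (λ i → i + suc k)
    shift : suc k * P ≡ prod (suc k) (λ i → i + k)
    shift = sym (trans (prod-head k (λ i → i + k)) (cong (suc k *_) (prod-cong k λ i _ → sym (+-suc (suc i) k))))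
    lemma : ∀ k a → a * (suc k + k) * (suc k + suc k) ≡ suc k * (2 * (1 + 2 * k) * a)
    lemma = solve-∀

  denominator : ℕ → ℕ
  denominator n = prodLt n (λ i j → i + j ∸ 1)

  numerator : ℕ → ℕ → ℕ
  numerator e n = prodLt n (λ i j → 2 * i + 2 * j ∸ e)

  prod-denominator : ∀ k → prod k (λ i → i + suc k ∸ 1) ≡ α k
  prod-denominator k = trans (prod-cong k λ i _ → cong (_∸ 1) (+-suc (suc i) k)) (prod-α k)

  spread-step : ∀ e k → prod k (λ i → 8 * (suc k ∸ i) * (2 * i + 2 * suc k ∸ e)) ≡ τ k * β k * prod k (λ i → 2 * i + 2 * suc k ∸ e)
  spread-step e k = trans (prod-* k (λ i → 8 * (suc k ∸ i)) _) (cong (_* prod k (λ i → 2 * i + 2 * suc k ∸ e)) (prod-τβ k))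

  -- Constants gathered in cycles of four rows, for even and odd order. In even order one of the two
  -- sums over neighbours comes after k has grown, hence `τ (suc k)`. The exponents of two grow by
  -- 3k + 1 and 3k per cycle.
  Cₑ Dₑ Cₒ Dₒ xₑ xₒ : ℕ → ℕ
  Cₑ zero    = 1
  Cₑ (suc k) = Cₑ k * α k * β k
  Dₑ zero    = 1
  Dₑ (suc k) = Dₑ k * τ k * τ (suc k)
  Cₒ zero    = 1
  Cₒ (suc k) = Cₒ k * α′ k * β k
  Dₒ zero    = 1
  Dₒ (suc k) = Dₒ k * τ k
  xₑ zero    = 0
  xₑ (suc k) = xₑ k + (k + k + suc k)
  xₒ zero    = 0
  xₒ (suc k) = xₒ k + (k + k + k)

  2^-xₑ : ∀ k → 2 ^ xₑ (suc k) ≡ 2 ^ xₑ k * (τ k * τ k * τ (suc k))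
  2^-xₑ k rewrite τ≡2^ k = trans (^-distribˡ-+-* 2 (xₑ k) (k + k + suc k))
    (cong (2 ^ xₑ k *_) (trans (^-distribˡ-+-* 2 (k + k) (suc k)) (cong (_* 2 ^ suc k) (^-distribˡ-+-* 2 k k))))

  2^-xₒ : ∀ k → 2 ^ xₒ (suc k) ≡ 2 ^ xₒ k * (τ k * τ k * τ k)
  2^-xₒ k rewrite τ≡2^ k = trans (^-distribˡ-+-* 2 (xₒ k) (k + k + k))
    (cong (2 ^ xₒ k *_) (trans (^-distribˡ-+-* 2 (k + k) k) (cong (_* 2 ^ k) (^-distribˡ-+-* 2 k k))))

  -- The new index j = k + 1 contributes `τ k * β k` through the differences j - i, and `α k`
  -- through the denominator. So `α` and `β` match the growth of `Cₑ`, and three powers of two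
  -- remain.
  even-product : ∀ e k → Dₑ k * spread e k * denominator k ≡ Cₑ k * (2 ^ xₑ k * numerator e k)
  even-product e zero    = refl
  even-product e (suc k) = begin
    Dₑ k * τ k * τ (suc k) * (spread e k * S) * (denominator k * Q)
      ≡⟨ cong₂ (λ s q → Dₑ k * τ k * τ (suc k) * (spread e k * s) * (denominator k * q)) (spread-step e k) (prod-denominator k) ⟩
    Dₑ k * τ k * τ (suc k) * (spread e k * (τ k * β k * M)) * (denominator k * α k)
      ≡⟨ lemma₁ (Dₑ k) (τ k) (τ (suc k)) (spread e k) (β k) M (denominator k) (α k) ⟩
    Dₑ k * spread e k * denominator k * (α k * β k * (τ k * τ k * τ (suc k)) * M)
      ≡⟨ cong (_* (α k * β k * (τ k * τ k * τ (suc k)) * M)) (even-product e k) ⟩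
    Cₑ k * (2 ^ xₑ k * numerator e k) * (α k * β k * (τ k * τ k * τ (suc k)) * M)
      ≡⟨ lemma₂ (Cₑ k) (2 ^ xₑ k) (numerator e k) (α k) (β k) (τ k * τ k * τ (suc k)) M ⟩
    Cₑ k * α k * β k * (2 ^ xₑ k * (τ k * τ k * τ (suc k)) * (numerator e k * M))
      ≡⟨ cong (λ z → Cₑ k * α k * β k * (z * (numerator e k * M))) (2^-xₑ k) ⟨
    Cₑ k * α k * β k * (2 ^ xₑ (suc k) * (numerator e k * M)) ∎
    where
    S = prod k (λ i → 8 * (suc k ∸ i) * (2 * i + 2 * suc k ∸ e))
    Q = prod k (λ i → i + suc k ∸ 1)
    M = prod k (λ i → 2 * i + 2 * suc k ∸ e)
    lemma₁ : ∀ d t t′ s b m p a → d * t * t′ * (s * (t * b * m)) * (p * a) ≡ d * s * p * (a * b * (t * t * t′) * m)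
    lemma₁ = solve-∀
    lemma₂ : ∀ c x n a b t m → c * (x * n) * (a * b * t * m) ≡ c * a * b * (x * t * (n * m))
    lemma₂ = solve-∀

  -- Here `Dₒ` supplies a single `τ k` per cycle and the differences j - i another; the third splits
  -- off from the denominator through `α` = `τ` · `α′`.
  odd-product : ∀ e k → Dₒ k * spread e k * denominator k ≡ Cₒ k * (2 ^ xₒ k * numerator e k)
  odd-product e zero    = refl
  odd-product e (suc k) = begin
    Dₒ k * τ k * (spread e k * S) * (denominator k * Q)
      ≡⟨ cong₂ (λ s q → Dₒ k * τ k * (spread e k * s) * (denominator k * q)) (spread-step e k) (trans (prod-denominator k) (α≡τα′ k)) ⟩
    Dₒ k * τ k * (spread e k * (τ k * β k * M)) * (denominator k * (τ k * α′ k))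
      ≡⟨ lemma₁ (Dₒ k) (τ k) (spread e k) (β k) M (denominator k) (α′ k) ⟩
    Dₒ k * spread e k * denominator k * (α′ k * β k * (τ k * τ k * τ k) * M)
      ≡⟨ cong (_* (α′ k * β k * (τ k * τ k * τ k) * M)) (odd-product e k) ⟩
    Cₒ k * (2 ^ xₒ k * numerator e k) * (α′ k * β k * (τ k * τ k * τ k) * M)
      ≡⟨ lemma₂ (Cₒ k) (2 ^ xₒ k) (numerator e k) (α′ k) (β k) (τ k * τ k * τ k) M ⟩
    Cₒ k * α′ k * β k * (2 ^ xₒ k * (τ k * τ k * τ k) * (numerator e k * M))
      ≡⟨ cong (λ z → Cₒ k * α′ k * β k * (z * (numerator e k * M))) (2^-xₒ k) ⟨
    Cₒ k * α′ k * β k * (2 ^ xₒ (suc k) * (numerator e k * M)) ∎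
    where
    S = prod k (λ i → 8 * (suc k ∸ i) * (2 * i + 2 * suc k ∸ e))
    Q = prod k (λ i → i + suc k ∸ 1)
    M = prod k (λ i → 2 * i + 2 * suc k ∸ e)
    lemma₁ : ∀ d t s b m p a → d * t * (s * (t * b * m)) * (p * (t * a)) ≡ d * s * p * (a * b * (t * t * t) * m)
    lemma₁ = solve-∀
    lemma₂ : ∀ c x n a b t m → c * (x * n) * (a * b * t * m) ≡ c * a * b * (x * t * (n * m))
    lemma₂ = solve-∀

  double/2 : ∀ {m} n → m ≡ n + n → ⌊ m /2⌋ ≡ n
  double/2 n refl = trans (cong ⌊_/2⌋ (cong (n +_) (sym (+-identityʳ n)))) (half n)
    where
    half : ∀ n → ⌊ n + (n + 0) /2⌋ ≡ n
    half zero    = refl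
    half (suc n) rewrite +-suc n (n + 0) = cong suc (half n)

  xₑ-closed : ∀ n → ⌊ n * (3 * n ∸ 1) /2⌋ ≡ xₑ n
  xₑ-closed n = double/2 (xₑ n) (go n)
    where
    closed : ∀ k → k * (3 * k) ≡ xₑ k + xₑ k + k
    closed zero    = refl
    closed (suc k) = trans (lemma k) (trans (cong (_+ (6 * k + 3)) (closed k)) (lemma′ (xₑ k) k))
      where
      lemma : ∀ k → suc k * (3 * suc k) ≡ k * (3 * k) + (6 * k + 3)
      lemma = solve-∀
      lemma′ : ∀ x k → x + x + k + (6 * k + 3) ≡ x + (k + k + suc k) + (x + (k + k + suc k)) + suc k
      lemma′ = solve-∀
    go : ∀ n → n * (3 * n ∸ 1) ≡ xₑ n + xₑ n
    go n = trans (*-distribˡ-∸ n (3 * n) 1) (trans (cong₂ _∸_ (closed n) (*-identityʳ n)) (m+n∸n≡m (xₑ n + xₑ n) n))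

  xₒ-closed : ∀ n → ⌊ n * (3 * n ∸ 3) /2⌋ ≡ xₒ n
  xₒ-closed n = double/2 (xₒ n) (go n)
    where
    closed : ∀ k → k * (3 * k) ≡ xₒ k + xₒ k + k * 3
    closed zero    = refl
    closed (suc k) = trans (lemma k) (trans (cong (_+ (6 * k + 3)) (closed k)) (lemma′ (xₒ k) k))
      where
      lemma : ∀ k → suc k * (3 * suc k) ≡ k * (3 * k) + (6 * k + 3)
      lemma = solve-∀
      lemma′ : ∀ x k → x + x + k * 3 + (6 * k + 3) ≡ x + (k + k + k) + (x + (k + k + k)) + suc k * 3
      lemma′ = solve-∀
    go : ∀ n → n * (3 * n ∸ 3) ≡ xₒ n + xₒ n
    go n = trans (*-distribˡ-∸ n (3 * n) 3) (trans (cong (_∸ n * 3) (closed n)) (m+n∸n≡m (xₒ n + xₒ n) (n * 3)))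

  -- The factors with i = 0 turn 2i + 2j - 3 over i ≤ j into 2i + 2j - 1 over i < j.
  numerator-shift : ∀ k → prod k (λ j → 2 * j + 2 * j ∸ 3) * numerator 3 k ≡ α′ k * numerator 1 k
  numerator-shift zero    = refl
  numerator-shift (suc k) = begin
    W * w * (numerator 3 k * N)                     ≡⟨ lemma W w (numerator 3 k) N ⟩
    W * numerator 3 k * (N * w)                     ≡⟨ cong₂ _*_ (numerator-shift k) row ⟩
    α′ k * numerator 1 k * ((1 + 2 * k) * N′)       ≡⟨ lemma′ (α′ k) (numerator 1 k) (1 + 2 * k) N′ ⟩
    (1 + 2 * k) * α′ k * (numerator 1 k * N′)       ∎
    where
    W = prod k (λ j → 2 * j + 2 * j ∸ 3)
    w = 2 * suc k + 2 * suc k ∸ 3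
    N = prod k (λ i → 2 * i + 2 * suc k ∸ 3)
    N′ = prod k (λ i → 2 * i + 2 * suc k ∸ 1)
    arith : ∀ i k → 2 * suc i + 2 * suc k ∸ 3 ≡ 2 * i + 2 * suc k ∸ 1
    arith i k = cong (λ z → z + 2 * suc k ∸ 3) (*-suc 2 i)
    row : N * w ≡ (1 + 2 * k) * N′
    row = trans (prod-head k (λ i → 2 * i + 2 * suc k ∸ 3))
      (cong₂ _*_ (trans (arith 0 k) (cong (_∸ 1) (*-suc 2 k))) (prod-cong k λ i _ → arith (suc i) k))
    lemma : ∀ a b c d → a * b * (c * d) ≡ a * c * (d * b)
    lemma = solve-∀
    lemma′ : ∀ a n x p → a * n * (x * p) ≡ x * a * (n * p)
    lemma′ = solve-∀

  xₑ≡n+xₒ : ∀ n → 2 ^ xₑ n ≡ 2 ^ n * 2 ^ xₒ n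
  xₑ≡n+xₒ n = trans (cong (2 ^_) (go n)) (^-distribˡ-+-* 2 n (xₒ n))
    where
    go : ∀ n → xₑ n ≡ n + xₒ n
    go zero    = refl
    go (suc n) rewrite go n = lemma n (xₒ n)
      where
      lemma : ∀ n x → n + x + (n + n + suc n) ≡ suc n + (x + (n + n + n))
      lemma = solve-∀

  prodℕ-nonZero : ∀ e → (∀ i → NonZero (e i)) → ∀ k → NonZero (prodℕ e k)
  prodℕ-nonZero e nz zero    = _
  prodℕ-nonZero e nz (suc k) = m*n≢0 (e k) (prodℕ e k) ⦃ nz k ⦄ ⦃ prodℕ-nonZero e nz k ⦄

  α-nonZero : ∀ k → NonZero (α k)
  α-nonZero = prodℕ-nonZero _ (λ _ → _)

  α′-nonZero : ∀ k → NonZero (α′ k)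
  α′-nonZero = prodℕ-nonZero _ (λ _ → _)

  β-nonZero : ∀ k → NonZero (β k)
  β-nonZero = prodℕ-nonZero _ (λ _ → _)

  Cₑ-nonZero : ∀ k → NonZero (Cₑ k)
  Cₑ-nonZero zero    = _
  Cₑ-nonZero (suc k) = m*n≢0 (Cₑ k * α k) (β k) ⦃ m*n≢0 (Cₑ k) (α k) ⦃ Cₑ-nonZero k ⦄ ⦃ α-nonZero k ⦄ ⦄ ⦃ β-nonZero k ⦄

  Cₒ-nonZero : ∀ k → NonZero (Cₒ k)
  Cₒ-nonZero zero    = _
  Cₒ-nonZero (suc k) = m*n≢0 (Cₒ k * α′ k) (β k) ⦃ m*n≢0 (Cₒ k) (α′ k) ⦃ Cₒ-nonZero k ⦄ ⦃ α′-nonZero k ⦄ ⦄ ⦃ β-nonZero k ⦄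

  prod-nonZero : ∀ n f → (∀ i → i < n → NonZero (f (suc i))) → NonZero (prod n f)
  prod-nonZero zero    f nz = _
  prod-nonZero (suc n) f nz = m*n≢0 (prod n f) (f (suc n)) ⦃ prod-nonZero n f (λ i i<n → nz i (m≤n⇒m≤1+n i<n)) ⦄ ⦃ nz n (n<1+n n) ⦄

  denominator-nonZero : ∀ n → NonZero (denominator n)
  denominator-nonZero n = prod-nonZero n _ λ j _ → prod-nonZero j _ λ i _ →
    subst NonZero (sym (+-suc i j)) _

-- Counting tilings by the domino that covers a corner.

module Tilings where

  open import Defs
  open import Data.Nat as ℕ using (ℕ; zero; suc)
  open import Data.Integer as ℤ using (ℤ; +_; 1ℤ)
  open import Data.Empty using (⊥-elim)
  open import Data.Fin as Fin using (Fin; zero; suc)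
  import Data.Fin.Properties as Finₚ
  open import Data.List using (List; []; _∷_; length; lookup)
  open import Data.List.Membership.Propositional using (_∈_)
  open import Data.List.Membership.Propositional.Properties using (∈-lookup)
  open import Data.List.Relation.Unary.Any using (here; there; index)
  open import Data.List.Relation.Unary.Any.Properties using (lookup-index)
  open import Data.Product using (Σ; _×_; _,_; proj₁; proj₂; ∃)
  open import Data.Sum using (_⊎_; inj₁; inj₂; [_,_]′)
  open import Data.Vec as Vec using (Vec; []; _∷_)
  import Data.Vec.Properties as Vecₚ
  open import Function using (_∘_)
  open import Relation.Nullary using (¬_; Dec; yes; no; contradiction)
  open import Relation.Nullary.Decidable using (_×-dec_; _⊎-dec_)
  open import Relation.Binary.PropositionalEquality using (_≡_; _≢_; refl; sym; trans; cong; subst)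

  module _ {A : Set} where

    remove : (ds : List A) → Fin (length ds) → List A
    remove (d ∷ ds) zero    = ds
    remove (d ∷ ds) (suc i) = d ∷ remove ds i

    punch : ∀ ds i → Fin (length (remove ds i)) → Fin (length ds)
    punch (d ∷ ds) zero    j       = suc j
    punch (d ∷ ds) (suc i) zero    = zero
    punch (d ∷ ds) (suc i) (suc j) = suc (punch ds i j)

    lookup-punch : ∀ ds i j → lookup (remove ds i) j ≡ lookup ds (punch ds i j)
    lookup-punch (d ∷ ds) zero    j       = refl
    lookup-punch (d ∷ ds) (suc i) zero    = refl
    lookup-punch (d ∷ ds) (suc i) (suc j) = lookup-punch ds i j

    punch≢ : ∀ ds i j → punch ds i j ≢ i
    punch≢ (d ∷ ds) (suc i) (suc j) e = punch≢ ds i j (Finₚ.suc-injective e)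

    punch-injective : ∀ ds i {j k} → punch ds i j ≡ punch ds i k → j ≡ k
    punch-injective (d ∷ ds) zero                      e = Finₚ.suc-injective e
    punch-injective (d ∷ ds) (suc i) {zero}  {zero}    e = refl
    punch-injective (d ∷ ds) (suc i) {suc j} {suc k}   e = cong suc (punch-injective ds i (Finₚ.suc-injective e))

    punch-surjective : ∀ ds i j → j ≢ i → ∃ λ k → punch ds i k ≡ j
    punch-surjective (d ∷ ds) zero    zero    ne = contradiction refl ne
    punch-surjective (d ∷ ds) zero    (suc j) ne = j , refl
    punch-surjective (d ∷ ds) (suc i) zero    ne = zero , refl
    punch-surjective (d ∷ ds) (suc i) (suc j) ne with punch-surjective ds i j (ne ∘ cong suc)
    ... | k , e = suc k , cong suc e

    ∈-remove⁻ : ∀ ds i {e : A} → e ∈ remove ds i → e ∈ ds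
    ∈-remove⁻ (d ∷ ds) zero    p         = there p
    ∈-remove⁻ (d ∷ ds) (suc i) (here e)  = here e
    ∈-remove⁻ (d ∷ ds) (suc i) (there p) = there (∈-remove⁻ ds i p)

    ∈-remove⁺ : ∀ ds i {e : A} → e ∈ ds → e ≡ lookup ds i ⊎ e ∈ remove ds i
    ∈-remove⁺ (d ∷ ds) zero    (here e)  = inj₁ e
    ∈-remove⁺ (d ∷ ds) zero    (there p) = inj₂ p
    ∈-remove⁺ (d ∷ ds) (suc i) (here e)  = inj₂ (here e)
    ∈-remove⁺ (d ∷ ds) (suc i) (there p) = [ inj₁ , inj₂ ∘ there ]′ (∈-remove⁺ ds i p)

  covers? : ∀ d x y → Dec (Covers d x y)
  covers? (hor a b) x y = ((x ℤ.≟ a) ×-dec (y ℤ.≟ b)) ⊎-dec ((x ℤ.≟ a ℤ.+ 1ℤ) ×-dec (y ℤ.≟ b))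
  covers? (ver a b) x y = ((x ℤ.≟ a) ×-dec (y ℤ.≟ b)) ⊎-dec ((x ℤ.≟ a) ×-dec (y ℤ.≟ b ℤ.+ 1ℤ))

  some-cell : ∀ d → ∃ λ x → ∃ λ y → Covers d x y
  some-cell (hor a b) = a , b , inj₁ (refl , refl)
  some-cell (ver a b) = a , b , inj₁ (refl , refl)

  _⊂_ : Domino → Region → Set
  d ⊂ X = ∀ x y → Covers d x y → X x y

  _∖_ : Region → Domino → Region
  (X ∖ d) x y = X x y × ¬ Covers d x y

  tiling-ext : ∀ {X Y : Region} ds → (∀ x y → X x y → Y x y) → (∀ x y → Y x y → X x y) → IsTiling X ds → IsTiling Y ds
  tiling-ext ds f g (sub , cov) = (λ i x y c → f x y (sub i x y c)) , λ x y p → cov x y (g x y p)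

  num-ext : ∀ {X Y : Region} {k} → (∀ x y → X x y → Y x y) → (∀ x y → Y x y → X x y) → NumTilings X k → NumTilings Y k
  num-ext f g (v , til , inj , sur) = v , (λ i → tiling-ext (Vec.lookup v i) f g (til i)) , inj , λ ds t → sur ds (tiling-ext ds g f t)

  ∼-refl : ∀ ds → ds ∼ ds
  ∼-refl ds d = (λ p → p) , (λ p → p)

  num-empty : ∀ {X : Region} → (∀ x y → ¬ X x y) → NumTilings X 1
  num-empty {X} empty = [] ∷ [] , (λ { zero → (λ ()) , λ x y p → ⊥-elim (empty x y p) }) , (λ { zero zero _ → refl }) , sur
    where
    sur : ∀ ds → IsTiling X ds → Σ (Fin 1) λ i → ds ∼ Vec.lookup ([] ∷ []) i
    sur []       t         = zero , ∼-refl []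
    sur (d ∷ ds) (sub , _) with some-cell d
    ... | x , y , c = ⊥-elim (empty x y (sub zero x y c))

  member-⊂ : ∀ {X ds d} → IsTiling X ds → d ∈ ds → d ⊂ X
  member-⊂ {X} (sub , _) p x y c = sub (index p) x y (subst (λ d → Covers d x y) (lookup-index p) c)

  member-unique : ∀ {X ds d e} → IsTiling X ds → d ∈ ds → e ∈ ds → ∀ x y → Covers d x y → Covers e x y → d ≡ e
  member-unique {X} {ds} t@(sub , cov) p q x y c c′ with cov x y (member-⊂ t p x y c)
  ... | i , _ , uniq = trans (lookup-index p) (trans (cong (lookup ds) (trans
          (uniq (index p) (subst (λ d → Covers d x y) (lookup-index p) c))
          (sym (uniq (index q) (subst (λ d → Covers d x y) (lookup-index q) c′))))) (sym (lookup-index q)))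

  NumContaining : Region → Domino → ℕ → Set
  NumContaining X d k =
    Σ (Vec (List Domino) k) λ v →
      (∀ i → IsTiling X (Vec.lookup v i) × d ∈ Vec.lookup v i) ×
      (∀ i j → Vec.lookup v i ∼ Vec.lookup v j → i ≡ j) ×
      (∀ ds → IsTiling X ds → d ∈ ds → Σ (Fin k) λ i → ds ∼ Vec.lookup v i)

  tiling-∷ : ∀ {X d ds} → d ⊂ X → IsTiling (X ∖ d) ds → IsTiling X (d ∷ ds)
  tiling-∷ {X} {d} {ds} d⊂X (sub , cov) = sub′ , cov′
    where
    sub′ : ∀ i x y → Covers (lookup (d ∷ ds) i) x y → X x y
    sub′ zero    x y c = d⊂X x y c
    sub′ (suc i) x y c = proj₁ (sub i x y c)
    cov′ : ∀ x y → X x y → Σ (Fin (suc (length ds))) λ i → Covers (lookup (d ∷ ds) i) x y ×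
             (∀ j → Covers (lookup (d ∷ ds) j) x y → j ≡ i)
    cov′ x y p with covers? d x y
    ... | yes c = zero , c , λ { zero _ → refl ; (suc j) c′ → contradiction c (proj₂ (sub j x y c′)) }
    ... | no ¬c with cov x y (p , ¬c)
    ...   | i , c , uniq = suc i , c , λ { zero c′ → contradiction c′ ¬c ; (suc j) c′ → cong suc (uniq j c′) }

  tiling-remove : ∀ {X} ds i → IsTiling X ds → IsTiling (X ∖ lookup ds i) (remove ds i)
  tiling-remove {X} ds i (sub , cov) = sub′ , cov′
    where
    to : ∀ j {x y} → Covers (lookup (remove ds i) j) x y → Covers (lookup ds (punch ds i j)) x y
    to j = subst (λ d → Covers d _ _) (lookup-punch ds i j)
    from : ∀ j {x y} → Covers (lookup ds (punch ds i j)) x y → Covers (lookup (remove ds i) j) x y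
    from j = subst (λ d → Covers d _ _) (sym (lookup-punch ds i j))
    sub′ : ∀ j x y → Covers (lookup (remove ds i) j) x y → (X ∖ lookup ds i) x y
    sub′ j x y c = p , λ c′ → let (l , _ , uniq) = cov x y p in
                               punch≢ ds i j (trans (uniq (punch ds i j) (to j c)) (sym (uniq i c′)))
      where p = sub (punch ds i j) x y (to j c)
    cov′ : ∀ x y → (X ∖ lookup ds i) x y → Σ (Fin (length (remove ds i))) λ j → Covers (lookup (remove ds i) j) x y ×
             (∀ k → Covers (lookup (remove ds i) k) x y → k ≡ j)
    cov′ x y (p , ¬c) with cov x y p
    ... | l , c , uniq with punch-surjective ds i l (λ { refl → ¬c c })
    ...   | j , refl = j , from j c , λ k c′ → punch-injective ds i (uniq (punch ds i k) (to k c′))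

  -- Adding `d` and removing it are inverse up to order. As `∼` compares lists as sets, injectivity
  -- rests on `d∉`: a tiling of the complement cannot contain `d`, which would cover a deleted
  -- square.
  num-containing : ∀ {X d k} → d ⊂ X → NumTilings (X ∖ d) k → NumContaining X d k
  num-containing {X} {d} {k} d⊂X (v , til , inj , sur) = Vec.map (d ∷_) v , til′ , inj′ , sur′
    where
    look : ∀ i → Vec.lookup (Vec.map (d ∷_) v) i ≡ d ∷ Vec.lookup v i
    look i = Vecₚ.lookup-map i (d ∷_) v
    til′ : ∀ i → IsTiling X (Vec.lookup (Vec.map (d ∷_) v) i) × d ∈ Vec.lookup (Vec.map (d ∷_) v) i
    til′ i rewrite look i = tiling-∷ d⊂X (til i) , here refl
    d∉ : ∀ i → ¬ d ∈ Vec.lookup v i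
    d∉ i p with some-cell d
    ... | x , y , c = proj₂ (member-⊂ (til i) p x y c) c
    strip : ∀ i j → (∀ e → e ∈ d ∷ Vec.lookup v i → e ∈ d ∷ Vec.lookup v j) → ∀ e → e ∈ Vec.lookup v i → e ∈ Vec.lookup v j
    strip i j s e p with s e (there p)
    ... | here refl = contradiction p (d∉ i)
    ... | there q   = q
    inj′ : ∀ i j → Vec.lookup (Vec.map (d ∷_) v) i ∼ Vec.lookup (Vec.map (d ∷_) v) j → i ≡ j
    inj′ i j s rewrite look i | look j = inj i j λ e → strip i j (proj₁ ∘ s) e , strip j i (proj₂ ∘ s) e
    sur′ : ∀ ds → IsTiling X ds → d ∈ ds → Σ (Fin k) λ i → ds ∼ Vec.lookup (Vec.map (d ∷_) v) i
    sur′ ds t p = result (sur (remove ds i) (subst (λ e → IsTiling (X ∖ e) (remove ds i)) (sym d≡) (tiling-remove ds i t)))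
      where
      i = index p
      d≡ : d ≡ lookup ds i
      d≡ = lookup-index p
      result : (Σ (Fin k) λ j → remove ds i ∼ Vec.lookup v j) → Σ (Fin k) λ j → ds ∼ Vec.lookup (Vec.map (d ∷_) v) j
      result (j , s) = j , subst (ds ∼_) (sym (look j)) λ e → fwd e , bwd e
        where
        fwd : ∀ e → e ∈ ds → e ∈ d ∷ Vec.lookup v j
        fwd e q with ∈-remove⁺ ds i q
        ... | inj₁ e≡ = here (trans e≡ (sym d≡))
        ... | inj₂ q′ = there (proj₁ (s e) q′)
        bwd : ∀ e → e ∈ d ∷ Vec.lookup v j → e ∈ ds
        bwd e (here refl) = p
        bwd e (there q)   = ∈-remove⁻ ds i (proj₂ (s e) q)

  num-not-containing : ∀ {X d} → ¬ (d ⊂ X) → NumContaining X d 0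
  num-not-containing ¬d⊂X = [] , (λ ()) , (λ ()) , λ ds t p → contradiction (member-⊂ t p) ¬d⊂X

  data Split (m n : ℕ) : Fin (m ℕ.+ n) → Set where
    left  : (i : Fin m) → Split m n (i Fin.↑ˡ n)
    right : (i : Fin n) → Split m n (m Fin.↑ʳ i)

  split : ∀ m n i → Split m n i
  split zero    n i       = right i
  split (suc m) n zero    = left zero
  split (suc m) n (suc i) with split m n i
  ... | left j  = left (suc j)
  ... | right j = right j

  num-+ : ∀ {X d e k l} → NumContaining X d k → NumContaining X e l →
    (∀ ds → IsTiling X ds → d ∈ ds ⊎ e ∈ ds) → (∀ ds → IsTiling X ds → d ∈ ds → ¬ e ∈ ds) → NumTilings X (k ℕ.+ l)
  num-+ {X} {d} {e} {k} {l} (v , til , inj , sur) (w , til′ , inj′ , sur′) some ¬both = v Vec.++ w , tilings , injective , surjective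
    where
    u = v Vec.++ w
    lookˡ : ∀ i → Vec.lookup u (i Fin.↑ˡ l) ≡ Vec.lookup v i
    lookˡ i = Vecₚ.lookup-++ˡ v w i
    lookʳ : ∀ i → Vec.lookup u (k Fin.↑ʳ i) ≡ Vec.lookup w i
    lookʳ i = Vecₚ.lookup-++ʳ v w i
    tilings : ∀ i → IsTiling X (Vec.lookup u i)
    tilings i with split k l i
    ... | left j  rewrite lookˡ j = proj₁ (til j)
    ... | right j rewrite lookʳ j = proj₁ (til′ j)
    apart : ∀ i j → ¬ (∀ a → a ∈ Vec.lookup w j → a ∈ Vec.lookup v i)
    apart i j s = ¬both _ (proj₁ (til i)) (proj₂ (til i)) (s e (proj₂ (til′ j)))
    injective : ∀ i j → Vec.lookup u i ∼ Vec.lookup u j → i ≡ j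
    injective i j s with split k l i | split k l j
    ... | left a  | left b  rewrite lookˡ a | lookˡ b = cong (Fin._↑ˡ l) (inj a b s)
    ... | left a  | right b rewrite lookˡ a | lookʳ b = contradiction (proj₂ ∘ s) (apart a b)
    ... | right a | left b  rewrite lookʳ a | lookˡ b = contradiction (proj₁ ∘ s) (apart b a)
    ... | right a | right b rewrite lookʳ a | lookʳ b = cong (k Fin.↑ʳ_) (inj′ a b s)
    surjective : ∀ ds → IsTiling X ds → Σ (Fin (k ℕ.+ l)) λ i → ds ∼ Vec.lookup u i
    surjective ds t with some ds t
    ... | inj₁ p = let (i , s) = sur ds t p in i Fin.↑ˡ l , subst (ds ∼_) (sym (lookˡ i)) s
    ... | inj₂ p = let (i , s) = sur′ ds t p in k Fin.↑ʳ i , subst (ds ∼_) (sym (lookʳ i)) s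

  -- A square without west and south neighbours can only be the anchor of the domino that covers it.
  num-corner : ∀ {X : Region} {x y k l} → X x y →
    (∀ a → x ≡ a ℤ.+ 1ℤ → ¬ X a y) → (∀ b → y ≡ b ℤ.+ 1ℤ → ¬ X x b) →
    NumContaining X (hor x y) k → NumContaining X (ver x y) l → NumTilings X (k ℕ.+ l)
  num-corner {X} {x} {y} p ¬west ¬south h v = num-+ h v some ¬both
    where
    ¬both : ∀ ds → IsTiling X ds → hor x y ∈ ds → ¬ ver x y ∈ ds
    ¬both ds t q q′ with member-unique t q q′ x y (inj₁ (refl , refl)) (inj₁ (refl , refl))
    ... | ()
    which : ∀ d → Covers d x y → d ⊂ X → d ≡ hor x y ⊎ d ≡ ver x y
    which (hor a b) (inj₁ (refl , refl)) _ = inj₁ refl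
    which (hor a b) (inj₂ (e , refl))    s = ⊥-elim (¬west a e (s a b (inj₁ (refl , refl))))
    which (ver a b) (inj₁ (refl , refl)) _ = inj₂ refl
    which (ver a b) (inj₂ (refl , e))    s = ⊥-elim (¬south b e (s a b (inj₁ (refl , refl))))
    some : ∀ ds → IsTiling X ds → hor x y ∈ ds ⊎ ver x y ∈ ds
    some ds t@(sub , cov) with cov x y p
    ... | i , c , _ with which (lookup ds i) c (sub i)
    ...   | inj₁ e = inj₁ (subst (_∈ ds) e (∈-lookup i))
    ...   | inj₂ e = inj₂ (subst (_∈ ds) e (∈-lookup i))

-- Rotated coordinates for both orientations of the quarters.

module Coordinates where

  open import Defs
  open Tilings
  open import Data.Nat as ℕ using (ℕ; suc)
  import Data.Nat.Properties as ℕₚ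
  open import Data.Integer as ℤ using (ℤ; +_; 1ℤ)
  import Data.Integer.Properties as ℤₚ
  open import Data.Integer.Tactic.RingSolver using (solve-∀)
  open import Data.Product using (Σ; _×_; _,_; proj₁; proj₂; ∃)
  open import Data.Sum using (_⊎_; inj₁; inj₂; [_,_]′)
  open import Function using (_∘_)
  open import Relation.Nullary using (¬_)
  open import Relation.Binary.PropositionalEquality using (_≡_; refl; sym; trans; cong; cong₂; subst)

  -- Row r, index t: the cell (r , t) has the two neighbours (suc r , t) and (suc r , suc t) in the next row.
  Cells : Set₁
  Cells = ℕ → ℕ → Set

  record Cell (r t : ℕ) (x y : ℤ) : Set where
    constructor at
    field
      index-eq : y ≡ + t
      row-eq   : x ℤ.+ y ℤ.+ 1ℤ ≡ + r
  open Cell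

  place : Cells → Region
  place Q x y = Σ ℕ λ r → Σ ℕ λ t → Cell r t x y × Q r t

  abscissa : ℕ → ℕ → ℤ
  abscissa r t = + r ℤ.- 1ℤ ℤ.- + t

  cell : ∀ r t → Cell r t (abscissa r t) (+ t)
  cell r t = at refl (lemma (+ r) (+ t))
    where
    lemma : ∀ r t → r ℤ.- 1ℤ ℤ.- t ℤ.+ t ℤ.+ 1ℤ ≡ r
    lemma = solve-∀

  cell-abscissa : ∀ {r t x y} → Cell r t x y → x ≡ abscissa r t
  cell-abscissa {r} {t} {x} (at refl e) = trans (lemma x (+ t)) (cong (λ z → z ℤ.- 1ℤ ℤ.- + t) e)
    where
    lemma : ∀ x t → x ≡ x ℤ.+ t ℤ.+ 1ℤ ℤ.- 1ℤ ℤ.- t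
    lemma = solve-∀

  cell-injective : ∀ {r t r′ t′ x y} → Cell r t x y → Cell r′ t′ x y → r ≡ r′ × t ≡ t′
  cell-injective (at e f) (at e′ f′) = ℤₚ.+-injective (trans (sym f) f′) , ℤₚ.+-injective (trans (sym e) e′)

  +suc : ∀ n → + suc n ≡ + n ℤ.+ 1ℤ
  +suc n = cong +_ (ℕₚ.+-comm 1 n)

  abscissa-suc : ∀ r t → abscissa (suc r) t ≡ abscissa r t ℤ.+ 1ℤ
  abscissa-suc r t = trans (cong (λ z → z ℤ.- 1ℤ ℤ.- + t) (+suc r)) (lemma (+ r) (+ t))
    where
    lemma : ∀ r t → r ℤ.+ 1ℤ ℤ.- 1ℤ ℤ.- t ≡ r ℤ.- 1ℤ ℤ.- t ℤ.+ 1ℤ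
    lemma = solve-∀

  abscissa-suc² : ∀ r t → abscissa (suc r) (suc t) ≡ abscissa r t
  abscissa-suc² r t = trans (cong₂ (λ y z → y ℤ.- 1ℤ ℤ.- z) (+suc r) (+suc t)) (lemma (+ r) (+ t))
    where
    lemma : ∀ r t → r ℤ.+ 1ℤ ℤ.- 1ℤ ℤ.- (t ℤ.+ 1ℤ) ≡ r ℤ.- 1ℤ ℤ.- t
    lemma = solve-∀

  Pair : ℕ → ℕ → ℕ → ℤ → ℤ → Set
  Pair r t t′ x y = Cell r t x y ⊎ Cell (suc r) t′ x y

  Delete : Cells → ℕ → ℕ → ℕ → Cells
  Delete Q r t t′ r₁ t₁ = Q r₁ t₁ × ¬ (r₁ ≡ r × t₁ ≡ t) × ¬ (r₁ ≡ suc r × t₁ ≡ t′)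

  module _ (σ τ : ℤ → ℤ → ℤ) where

    private
      At : Cells → Region
      At Q a b = place Q (σ a b) (τ a b)

    -- `σ` and `τ` will be the two projections in either order. A domino whose upper cell is present
    -- deletes a pair of cells; otherwise it occurs in no tiling.
    containing : ∀ {Q r t t′ k} d → (∀ a b → Covers d a b → Pair r t t′ (σ a b) (τ a b)) →
      (∀ a b → Pair r t t′ (σ a b) (τ a b) → Covers d a b) →
      (∃ λ a → ∃ λ b → Cell (suc r) t′ (σ a b) (τ a b)) → Q r t →
      (Q (suc r) t′ × NumTilings (At (Delete Q r t t′)) k) ⊎ (¬ Q (suc r) t′ × k ≡ 0) →
      NumContaining (At Q) d k
    containing {Q} {r} {t} {t′} d cov cov⁻ wit q (inj₁ (q′ , num)) = num-containing d⊂ (num-ext to from num)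
      where
      d⊂ : d ⊂ At Q
      d⊂ a b c with cov a b c
      ... | inj₁ l = r , t , l , q
      ... | inj₂ l = suc r , t′ , l , q′
      to : ∀ a b → At (Delete Q r t t′) a b → (At Q ∖ d) a b
      to a b (r₁ , t₁ , l , q₁ , n , n′) = (r₁ , t₁ , l , q₁) , λ c → [ n ∘ cell-injective l , n′ ∘ cell-injective l ]′ (cov a b c)
      from : ∀ a b → (At Q ∖ d) a b → At (Delete Q r t t′) a b
      from a b ((r₁ , t₁ , l , q₁) , ¬c) = r₁ , t₁ , l , q₁ ,
        (λ { (refl , refl) → ¬c (cov⁻ a b (inj₁ l)) }) , (λ { (refl , refl) → ¬c (cov⁻ a b (inj₂ l)) })
    containing {Q} {r} {t} {t′} d cov cov⁻ (a , b , l) q (inj₂ (¬q , refl)) = num-not-containing λ d⊂ → absurd (d⊂ a b (cov⁻ a b (inj₂ l)))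
      where
      absurd : ¬ At Q a b
      absurd (r₁ , t₁ , l₁ , q₁) with cell-injective l l₁
      ... | refl , refl = ¬q q₁

  straight : ∀ r t a b → let A = abscissa r t in
    ((a ≡ A × b ≡ + t) ⊎ (a ≡ A ℤ.+ 1ℤ × b ≡ + t) → Pair r t t a b) ×
    (Pair r t t a b → (a ≡ A × b ≡ + t) ⊎ (a ≡ A ℤ.+ 1ℤ × b ≡ + t))
  straight r t a b = to , from
    where
    to : _ → Pair r t t a b
    to (inj₁ (refl , refl)) = inj₁ (cell r t)
    to (inj₂ (refl , refl)) = inj₂ (subst (λ x → Cell (suc r) t x (+ t)) (abscissa-suc r t) (cell (suc r) t))
    from : Pair r t t a b → _
    from (inj₁ l) = inj₁ (cell-abscissa l , index-eq l)
    from (inj₂ l) = inj₂ (trans (cell-abscissa l) (abscissa-suc r t) , index-eq l)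

  diagonal : ∀ r t a b → let A = abscissa r t in
    ((a ≡ A × b ≡ + t) ⊎ (a ≡ A × b ≡ + t ℤ.+ 1ℤ) → Pair r t (suc t) a b) ×
    (Pair r t (suc t) a b → (a ≡ A × b ≡ + t) ⊎ (a ≡ A × b ≡ + t ℤ.+ 1ℤ))
  diagonal r t a b = to , from
    where
    to : _ → Pair r t (suc t) a b
    to (inj₁ (refl , refl)) = inj₁ (cell r t)
    to (inj₂ (refl , refl)) = inj₂ (subst (λ y → Cell (suc r) (suc t) (abscissa r t) y) (+suc t)
                                (subst (λ x → Cell (suc r) (suc t) x (+ suc t)) (abscissa-suc² r t) (cell (suc r) (suc t))))
    from : Pair r t (suc t) a b → _
    from (inj₁ l) = inj₁ (cell-abscissa l , index-eq l)
    from (inj₂ l) = inj₂ (trans (cell-abscissa l) (abscissa-suc² r t) , trans (index-eq l) (+suc t))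

  -- West and south neighbours have a + b smaller by one, so they lie in row r - 1.
  lower-row : ∀ Q r t a b → abscissa r t ℤ.+ + t ≡ a ℤ.+ b ℤ.+ 1ℤ →
    (∀ r′ t′ → r′ ℕ.< r → ¬ Q r′ t′) → ¬ place Q a b
  lower-row Q r t a b e′ ¬below (r′ , t′ , at _ f , q) = ¬below r′ t′ r′<r q
    where
    r′<r : r′ ℕ.< r
    r′<r = ℕₚ.≤-reflexive (ℤₚ.+-injective (trans (+suc r′) (trans (cong (ℤ._+ 1ℤ) (trans (sym f) (sym e′))) (row-eq (cell r t)))))

  -- An interface for the row-by-row argument, so that it can be run once for both orders of the
  -- coordinates; K_na needs the exchanged one.
  record Counting (N : Cells → ℕ → Set) : Set₁ where
    field
      ext    : ∀ {Q Q′ k} → (∀ r t → Q r t → Q′ r t) → (∀ r t → Q′ r t → Q r t) → N Q k → N Q′ k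
      empty  : ∀ {Q} → (∀ r t → ¬ Q r t) → N Q 1
      corner : ∀ {Q r t k l} → Q r t → (∀ r′ t′ → r′ ℕ.< r → ¬ Q r′ t′) →
        (Q (suc r) t × N (Delete Q r t t) k) ⊎ (¬ Q (suc r) t × k ≡ 0) →
        (Q (suc r) (suc t) × N (Delete Q r t (suc t)) l) ⊎ (¬ Q (suc r) (suc t) × l ≡ 0) →
        N Q (k ℕ.+ l)

  N⁺ N⁻ : Cells → ℕ → Set
  N⁺ Q = NumTilings (place Q)
  N⁻ Q = NumTilings (λ a b → place Q b a)

  counting⁺ : Counting N⁺
  counting⁺ = record
    { ext    = λ f g → num-ext (λ { _ _ (r , t , l , q) → r , t , l , f r t q }) (λ { _ _ (r , t , l , q) → r , t , l , g r t q })
    ; empty  = λ e → num-empty λ { _ _ (r , t , _ , q) → e r t q }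
    ; corner = λ {Q} {r} {t} q ¬below o o′ →
        num-corner {x = abscissa r t} {+ t} (r , t , cell r t , q)
          (λ a e → lower-row Q r t a (+ t) (trans (cong (λ z → z ℤ.+ + t) e) (lemma₁ a (+ t))) ¬below)
          (λ b e → lower-row Q r t (abscissa r t) b (trans (cong (λ z → abscissa r t ℤ.+ z) e) (lemma₂ (abscissa r t) b)) ¬below)
          (containing (λ a b → a) (λ a b → b) (hor _ _) (λ a b → proj₁ (straight r t a b)) (λ a b → proj₂ (straight r t a b))
            (abscissa (suc r) t , + t , cell (suc r) t) q o)
          (containing (λ a b → a) (λ a b → b) (ver _ _) (λ a b → proj₁ (diagonal r t a b)) (λ a b → proj₂ (diagonal r t a b))
            (abscissa (suc r) (suc t) , + suc t , cell (suc r) (suc t)) q o′)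
    }
    where
    lemma₁ : ∀ a t → a ℤ.+ 1ℤ ℤ.+ t ≡ a ℤ.+ t ℤ.+ 1ℤ
    lemma₁ = solve-∀
    lemma₂ : ∀ a t → a ℤ.+ (t ℤ.+ 1ℤ) ≡ a ℤ.+ t ℤ.+ 1ℤ
    lemma₂ = solve-∀

  counting⁻ : Counting N⁻
  counting⁻ = record
    { ext    = λ f g → num-ext (λ { _ _ (r , t , l , q) → r , t , l , f r t q }) (λ { _ _ (r , t , l , q) → r , t , l , g r t q })
    ; empty  = λ e → num-empty λ { _ _ (r , t , _ , q) → e r t q }
    -- Exchanging the coordinates makes the straight domino vertical and the diagonal one
    -- horizontal, so the two counts appear in the opposite order.
    ; corner = λ {Q} {r} {t} {k} {l} q ¬below o o′ → subst (N⁻ Q) (ℕₚ.+-comm l k)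
        (num-corner {x = + t} {abscissa r t} (r , t , cell r t , q)
          (λ b e → lower-row Q r t (abscissa r t) b (trans (cong (λ z → abscissa r t ℤ.+ z) e) (lemma₂ (abscissa r t) b)) ¬below)
          (λ a e → lower-row Q r t a (+ t) (trans (cong (λ z → z ℤ.+ + t) e) (lemma₁ a (+ t))) ¬below)
          (containing (λ a b → b) (λ a b → a) (hor _ _)
            (λ a b → proj₁ (diagonal r t b a) ∘ flip×) (λ a b → flip× ∘ proj₂ (diagonal r t b a))
            (+ suc t , abscissa (suc r) (suc t) , cell (suc r) (suc t)) q o′)
          (containing (λ a b → b) (λ a b → a) (ver _ _)
            (λ a b → proj₁ (straight r t b a) ∘ flip×) (λ a b → flip× ∘ proj₂ (straight r t b a))
            (+ t , abscissa (suc r) t , cell (suc r) t) q o))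
    }
    where
    flip× : ∀ {A B C D : Set} → (A × B) ⊎ (C × D) → (B × A) ⊎ (D × C)
    flip× (inj₁ (a , b)) = inj₁ (b , a)
    flip× (inj₂ (c , d)) = inj₂ (d , c)
    lemma₁ : ∀ a t → a ℤ.+ 1ℤ ℤ.+ t ≡ a ℤ.+ t ℤ.+ 1ℤ
    lemma₁ = solve-∀
    lemma₂ : ∀ a t → a ℤ.+ (t ℤ.+ 1ℤ) ≡ a ℤ.+ t ℤ.+ 1ℤ
    lemma₂ = solve-∀

-- The recursive count equals the number of tilings of a stack of rows.

module RowByRow where

  open RowMatching using (scan; scanˡ; first; full)
  open Recursion using (Class; c0; c1; c2; c3; next; match; count)
  open Coordinates
  open import Data.Bool using (Bool; true; false; if_then_else_)
  open import Data.Nat as ℕ using (ℕ; zero; suc; _≤_; _<_; s≤s)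
  open import Data.Nat.Properties
  open import Data.Empty using (⊥)
  open import Data.List using (List; []; _∷_; drop)
  open import Data.Product using (_×_; _,_; proj₁; proj₂)
  open import Data.Sum using (_⊎_; inj₁; inj₂; [_,_]′)
  open import Function using (_∘_)
  open import Relation.Nullary using (¬_; contradiction)
  open import Relation.Binary.PropositionalEquality using (_≡_; _≢_; refl; sym)

  data At : ℕ → List Bool → ℕ → Set where
    here  : ∀ {t xs} → At t (true ∷ xs) t
    there : ∀ {t t′ x xs} → At (suc t) xs t′ → At t (x ∷ xs) t′

  at-≥ : ∀ {t xs t′} → At t xs t′ → t ≤ t′
  at-≥ here      = ≤-refl
  at-≥ (there p) = <⇒≤ (at-≥ p)

  at-≢ : ∀ {t xs} → ¬ At (suc t) xs t
  at-≢ p = 1+n≰n (at-≥ p)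

  at-single : ∀ {t x xs t′} → At t (x ∷ []) t′ → At t (x ∷ xs) t′
  at-single here = here

  at-single-≡ : ∀ {t x t′} → At t (x ∷ []) t′ → t′ ≡ t
  at-single-≡ here = refl

  at-uncons : ∀ {t x xs t′} → At t (x ∷ xs) t′ → At t (x ∷ []) t′ ⊎ At (suc t) xs t′
  at-uncons here      = inj₁ here
  at-uncons (there p) = inj₂ p

  infixr 5 _∪_
  _∪_ : Cells → Cells → Cells
  (P ∪ Q) r t = P r t ⊎ Q r t

  Row : ℕ → ℕ → List Bool → Cells
  Row r t xs r′ t′ = r′ ≡ r × At t xs t′

  -- `U` holds the higher rows together with the sites of row r + 1 that the scan has already
  -- passed.
  Above : ℕ → ℕ → Cells → Set
  Above r t U = ∀ r′ t′ → U r′ t′ → r < r′ × (r′ ≡ suc r → t′ < t)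

  module _ {N : Cells → ℕ → Set} (C : Counting N) where
    open Counting C

    private
      above-suc : ∀ {r t U} → Above r t U → Above r (suc t) U
      above-suc ab r′ t′ u = proj₁ (ab r′ t′ u) , λ e → m<n⇒m<1+n (proj₂ (ab r′ t′ u) e)

      above-extend : ∀ {r t U} y → Above r t U → Above r (suc t) (U ∪ Row (suc r) t (y ∷ []))
      above-extend y ab r′ t′ (inj₁ u)          = above-suc ab r′ t′ u
      above-extend y ab r′ t′ (inj₂ (refl , p)) = ≤-refl , λ _ → s≤s (≤-reflexive (at-single-≡ p))

      no-row : ∀ {r t U} → Above r t U → ¬ U r t
      no-row ab u = 1+n≰n (proj₁ (ab _ _ u))

      no-left : ∀ {r t U} → Above r t U → ∀ {t′} → t ≤ t′ → ¬ U (suc r) t′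
      no-left ab le u = <⇒≱ (proj₂ (ab _ _ u) refl) le

      below : ∀ {r t t₁ t₂ U ys xs} → Above r t U → ∀ r′ t′ → r′ < r → ¬ (U ∪ Row (suc r) t₁ ys ∪ Row r t₂ xs) r′ t′
      below ab r′ t′ lt (inj₁ u)                    = <-asym lt (proj₁ (ab r′ t′ u))
      below ab r′ t′ lt (inj₂ (inj₁ (refl , _)))    = <-asym lt (n<1+n _)
      below ab r′ t′ lt (inj₂ (inj₂ (refl , _)))    = <-irrefl refl lt

      r≢suc : ∀ {r : ℕ} → r ≢ suc r
      r≢suc e = 1+n≢n (sym e)

      hyp-cons : ∀ {r t U} y {k : List Bool → ℕ} → (∀ zs → N (U ∪ Row (suc r) t zs) (k zs)) →
        ∀ zs → N ((U ∪ Row (suc r) t (y ∷ [])) ∪ Row (suc r) (suc t) zs) (k (y ∷ zs))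
      hyp-cons {r} {t} {U} y hyp zs = ext to from (hyp (y ∷ zs))
        where
        to : ∀ r′ t′ → (U ∪ Row (suc r) t (y ∷ zs)) r′ t′ → ((U ∪ Row (suc r) t (y ∷ [])) ∪ Row (suc r) (suc t) zs) r′ t′
        to r′ t′ (inj₁ u)       = inj₁ (inj₁ u)
        to r′ t′ (inj₂ (e , p)) = [ (λ q → inj₁ (inj₂ (e , q))) , (λ q → inj₂ (e , q)) ]′ (at-uncons p)
        from : ∀ r′ t′ → ((U ∪ Row (suc r) t (y ∷ [])) ∪ Row (suc r) (suc t) zs) r′ t′ → (U ∪ Row (suc r) t (y ∷ zs)) r′ t′
        from r′ t′ (inj₁ (inj₁ u))       = inj₁ u
        from r′ t′ (inj₁ (inj₂ (e , q))) = inj₂ (e , at-single q)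
        from r′ t′ (inj₂ (e , q))        = inj₂ (e , there q)

      hyp-false : ∀ {r t U} {k : List Bool → ℕ} → (∀ zs → N (U ∪ Row (suc r) t zs) (k zs)) →
        ∀ zs → N (U ∪ Row (suc r) (suc t) zs) (k (false ∷ zs))
      hyp-false {r} {t} {U} hyp zs = ext to from (hyp (false ∷ zs))
        where
        to : ∀ r′ t′ → (U ∪ Row (suc r) t (false ∷ zs)) r′ t′ → (U ∪ Row (suc r) (suc t) zs) r′ t′
        to r′ t′ (inj₁ u)             = inj₁ u
        to r′ t′ (inj₂ (e , there p)) = inj₂ (e , p)
        from : ∀ r′ t′ → (U ∪ Row (suc r) (suc t) zs) r′ t′ → (U ∪ Row (suc r) t (false ∷ zs)) r′ t′
        from r′ t′ (inj₁ u)       = inj₁ u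
        from r′ t′ (inj₂ (e , p)) = inj₂ (e , there p)

    scan-nil : ∀ xs {r t U k} → Above r t U → N U (k []) → N (U ∪ Row (suc r) t [] ∪ Row r t xs) (scan [] xs k)
    scan-nil [] ab n = ext (λ _ _ → inj₁) (λ { _ _ (inj₁ u) → u ; _ _ (inj₂ (inj₁ (_ , ()))) ; _ _ (inj₂ (inj₂ (_ , ()))) }) n
    scan-nil (false ∷ xs) {r} {t} {U} ab n = ext to from (scan-nil xs (above-suc ab) n)
      where
      to : ∀ r′ t′ → (U ∪ Row (suc r) (suc t) [] ∪ Row r (suc t) xs) r′ t′ → (U ∪ Row (suc r) t [] ∪ Row r t (false ∷ xs)) r′ t′
      to r′ t′ (inj₁ u)                    = inj₁ u
      to r′ t′ (inj₂ (inj₂ (e , p)))       = inj₂ (inj₂ (e , there p))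
      from : ∀ r′ t′ → (U ∪ Row (suc r) t [] ∪ Row r t (false ∷ xs)) r′ t′ → (U ∪ Row (suc r) (suc t) [] ∪ Row r (suc t) xs) r′ t′
      from r′ t′ (inj₁ u)                    = inj₁ u
      from r′ t′ (inj₂ (inj₂ (e , there p))) = inj₂ (inj₂ (e , p))
    scan-nil (true ∷ xs) {r} {t} {U} ab n =
      corner {k = 0} {0} (inj₂ (inj₂ (refl , here))) (below ab) (inj₂ (none ≤-refl , refl)) (inj₂ (none (n≤1+n t) , refl))
      where
      none : ∀ {t′} → t ≤ t′ → ¬ (U ∪ Row (suc r) t [] ∪ Row r t (true ∷ xs)) (suc r) t′
      none le (inj₁ u)                 = no-left ab le u
      none le (inj₂ (inj₂ (e , _)))    = 1+n≢n e

    mutual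
      -- The leftmost remaining cell of the lowest row is a corner. When the scan moves on, the
      -- passed site of row r + 1 goes into `U` and its bit into the continuation.
      scan-count : ∀ xs ys {r t U k} → Above r t U → (∀ zs → N (U ∪ Row (suc r) t zs) (k zs)) →
        N (U ∪ Row (suc r) t ys ∪ Row r t xs) (scan ys xs k)
      scan-count [] ys ab hyp = ext
        (λ { _ _ (inj₁ u) → inj₁ u ; _ _ (inj₂ p) → inj₂ (inj₁ p) })
        (λ { _ _ (inj₁ u) → inj₁ u ; _ _ (inj₂ (inj₁ p)) → inj₂ p ; _ _ (inj₂ (inj₂ (_ , ()))) }) (hyp ys)
      scan-count (x ∷ xs) [] ab hyp = scan-nil (x ∷ xs) ab
        (ext (λ { _ _ (inj₁ u) → u ; _ _ (inj₂ (_ , ())) }) (λ _ _ → inj₁) (hyp []))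
      scan-count (false ∷ xs) (y ∷ ys) {r} {t} {U} ab hyp =
        ext to from (scan-count xs ys (above-extend y ab) (hyp-cons y hyp))
        where
        to : ∀ r′ t′ → ((U ∪ Row (suc r) t (y ∷ [])) ∪ Row (suc r) (suc t) ys ∪ Row r (suc t) xs) r′ t′ →
          (U ∪ Row (suc r) t (y ∷ ys) ∪ Row r t (false ∷ xs)) r′ t′
        to r′ t′ (inj₁ (inj₁ u))             = inj₁ u
        to r′ t′ (inj₁ (inj₂ (e , q)))       = inj₂ (inj₁ (e , at-single q))
        to r′ t′ (inj₂ (inj₁ (e , p)))       = inj₂ (inj₁ (e , there p))
        to r′ t′ (inj₂ (inj₂ (e , p)))       = inj₂ (inj₂ (e , there p))
        from : ∀ r′ t′ → (U ∪ Row (suc r) t (y ∷ ys) ∪ Row r t (false ∷ xs)) r′ t′ →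
          ((U ∪ Row (suc r) t (y ∷ [])) ∪ Row (suc r) (suc t) ys ∪ Row r (suc t) xs) r′ t′
        from r′ t′ (inj₁ u)                    = inj₁ (inj₁ u)
        from r′ t′ (inj₂ (inj₁ (e , p)))       = [ (λ q → inj₁ (inj₂ (e , q))) , (λ q → inj₂ (inj₁ (e , q))) ]′ (at-uncons p)
        from r′ t′ (inj₂ (inj₂ (e , there p))) = inj₂ (inj₂ (e , p))
      scan-count (true ∷ xs) (y ∷ ys) {r} {t} {U} {k} ab hyp =
        corner (inj₂ (inj₂ (refl , here))) (below ab) (choose-left y hyp) (choose-right ys)
        where
        Q : Bool → List Bool → Cells
        Q y ys = U ∪ Row (suc r) t (y ∷ ys) ∪ Row r t (true ∷ xs)
        choose-left : ∀ y → (∀ zs → N (U ∪ Row (suc r) t zs) (k zs)) →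
          (Q y ys (suc r) t × N (Delete (Q y ys) r t t) (if y then scan ys xs (k ∘ (false ∷_)) else 0)) ⊎
          (¬ Q y ys (suc r) t × (if y then scan ys xs (k ∘ (false ∷_)) else 0) ≡ 0)
        choose-left false hyp = inj₂ (absent , refl)
          where
          absent : ¬ Q false ys (suc r) t
          absent (inj₁ u)                          = no-left ab ≤-refl u
          absent (inj₂ (inj₁ (_ , there p)))       = at-≢ p
          absent (inj₂ (inj₂ (e , _)))             = 1+n≢n e
        choose-left true hyp = inj₁ (inj₂ (inj₁ (refl , here)) , ext to from (scan-count xs ys (above-suc ab) (hyp-false hyp)))
          where
          to : ∀ r′ t′ → (U ∪ Row (suc r) (suc t) ys ∪ Row r (suc t) xs) r′ t′ → Delete (Q true ys) r t t r′ t′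
          to r′ t′ (inj₁ u) = inj₁ u , (λ { (refl , refl) → no-row ab u }) , (λ { (refl , refl) → no-left ab ≤-refl u })
          to r′ t′ (inj₂ (inj₁ (refl , p))) = inj₂ (inj₁ (refl , there p)) , (λ { (e , _) → 1+n≢n e }) , (λ { (_ , refl) → at-≢ p })
          to r′ t′ (inj₂ (inj₂ (refl , p))) = inj₂ (inj₂ (refl , there p)) , (λ { (_ , refl) → at-≢ p }) , (λ { (e , _) → r≢suc e })
          from : ∀ r′ t′ → Delete (Q true ys) r t t r′ t′ → (U ∪ Row (suc r) (suc t) ys ∪ Row r (suc t) xs) r′ t′
          from r′ t′ (inj₁ u , _)                             = inj₁ u
          from r′ t′ (inj₂ (inj₁ (refl , here)) , _ , n)      = contradiction (refl , refl) n
          from r′ t′ (inj₂ (inj₁ (refl , there p)) , _)       = inj₂ (inj₁ (refl , p))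
          from r′ t′ (inj₂ (inj₂ (refl , here)) , n , _)      = contradiction (refl , refl) n
          from r′ t′ (inj₂ (inj₂ (refl , there p)) , _)       = inj₂ (inj₂ (refl , p))
        absent : ∀ ys → ¬ At (suc t) ys (suc t) → ¬ Q y ys (suc r) (suc t)
        absent ys n (inj₁ u)                    = no-left ab (n≤1+n t) u
        absent ys n (inj₂ (inj₁ (_ , p)))       = [ (λ q → 1+n≢n (at-single-≡ q)) , n ]′ (at-uncons p)
        absent ys n (inj₂ (inj₂ (e , _)))       = 1+n≢n e
        choose-right : ∀ ys →
          (Q y ys (suc r) (suc t) × N (Delete (Q y ys) r t (suc t)) (if first ys then scan (false ∷ drop 1 ys) xs (k ∘ (y ∷_)) else 0)) ⊎
          (¬ Q y ys (suc r) (suc t) × (if first ys then scan (false ∷ drop 1 ys) xs (k ∘ (y ∷_)) else 0) ≡ 0)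
        choose-right []           = inj₂ (absent [] (λ ()) , refl)
        choose-right (false ∷ ys) = inj₂ (absent (false ∷ ys) (λ { (there p) → at-≢ p }) , refl)
        choose-right (true ∷ ys)  = inj₁ (inj₂ (inj₁ (refl , there here)) ,
          ext to from (scan-count xs (false ∷ ys) (above-extend y ab) (hyp-cons y hyp)))
          where
          to : ∀ r′ t′ → ((U ∪ Row (suc r) t (y ∷ [])) ∪ Row (suc r) (suc t) (false ∷ ys) ∪ Row r (suc t) xs) r′ t′ →
            Delete (Q y (true ∷ ys)) r t (suc t) r′ t′
          to r′ t′ (inj₁ (inj₁ u)) = inj₁ u , (λ { (refl , refl) → no-row ab u }) , (λ { (refl , refl) → no-left ab (n≤1+n t) u })
          to r′ t′ (inj₁ (inj₂ (refl , q))) = inj₂ (inj₁ (refl , at-single q)) , (λ { (e , _) → 1+n≢n e }) , (λ { (_ , refl) → 1+n≢n (at-single-≡ q) })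
          to r′ t′ (inj₂ (inj₁ (refl , there p))) = inj₂ (inj₁ (refl , there (there p))) , (λ { (e , _) → 1+n≢n e }) , (λ { (_ , refl) → at-≢ p })
          to r′ t′ (inj₂ (inj₂ (refl , p))) = inj₂ (inj₂ (refl , there p)) , (λ { (_ , refl) → at-≢ p }) , (λ { (e , _) → r≢suc e })
          from : ∀ r′ t′ → Delete (Q y (true ∷ ys)) r t (suc t) r′ t′ →
            ((U ∪ Row (suc r) t (y ∷ [])) ∪ Row (suc r) (suc t) (false ∷ ys) ∪ Row r (suc t) xs) r′ t′
          from r′ t′ (inj₁ u , _)                                 = inj₁ (inj₁ u)
          from r′ t′ (inj₂ (inj₁ (refl , here)) , _)              = inj₁ (inj₂ (refl , here))
          from r′ t′ (inj₂ (inj₁ (refl , there here)) , _ , n)    = contradiction (refl , refl) n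
          from r′ t′ (inj₂ (inj₁ (refl , there (there p))) , _)   = inj₂ (inj₁ (refl , there p))
          from r′ t′ (inj₂ (inj₂ (refl , here)) , n , _)          = contradiction (refl , refl) n
          from r′ t′ (inj₂ (inj₂ (refl , there p)) , _)           = inj₂ (inj₂ (refl , p))

    scanˡ-count : ∀ xs ys {r t U k} → Above r t U → (∀ zs → N (U ∪ Row (suc r) (suc t) zs) (k zs)) →
      N (U ∪ Row (suc r) (suc t) ys ∪ Row r t xs) (scanˡ ys xs k)
    scanˡ-count [] ys ab hyp = ext
      (λ { _ _ (inj₁ u) → inj₁ u ; _ _ (inj₂ p) → inj₂ (inj₁ p) })
      (λ { _ _ (inj₁ u) → inj₁ u ; _ _ (inj₂ (inj₁ p)) → inj₂ p ; _ _ (inj₂ (inj₂ (_ , ()))) }) (hyp ys)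
    scanˡ-count (false ∷ xs) ys {r} {t} {U} ab hyp = ext
      (λ { _ _ (inj₁ u) → inj₁ u ; _ _ (inj₂ (inj₁ p)) → inj₂ (inj₁ p) ; _ _ (inj₂ (inj₂ (e , p))) → inj₂ (inj₂ (e , there p)) })
      (λ { _ _ (inj₁ u) → inj₁ u ; _ _ (inj₂ (inj₁ p)) → inj₂ (inj₁ p) ; _ _ (inj₂ (inj₂ (e , there p))) → inj₂ (inj₂ (e , p)) })
      (scan-count xs ys (above-suc ab) hyp)
    scanˡ-count (true ∷ xs) ys {r} {t} {U} {k} ab hyp =
      corner {k = 0} (inj₂ (inj₂ (refl , here))) (below ab) (inj₂ (absentˡ , refl)) (choose ys)
      where
      Q : List Bool → Cells
      Q ys = U ∪ Row (suc r) (suc t) ys ∪ Row r t (true ∷ xs)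
      absentˡ : ¬ Q ys (suc r) t
      absentˡ (inj₁ u)              = no-left ab ≤-refl u
      absentˡ (inj₂ (inj₁ (_ , p))) = at-≢ p
      absentˡ (inj₂ (inj₂ (e , _))) = 1+n≢n e
      absent : ∀ ys → ¬ At (suc t) ys (suc t) → ¬ Q ys (suc r) (suc t)
      absent ys n (inj₁ u)              = no-left ab (n≤1+n t) u
      absent ys n (inj₂ (inj₁ (_ , p))) = n p
      absent ys n (inj₂ (inj₂ (e , _))) = 1+n≢n e
      choose : ∀ ys →
        (Q ys (suc r) (suc t) × N (Delete (Q ys) r t (suc t)) (if first ys then scan (false ∷ drop 1 ys) xs k else 0)) ⊎
        (¬ Q ys (suc r) (suc t) × (if first ys then scan (false ∷ drop 1 ys) xs k else 0) ≡ 0)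
      choose []           = inj₂ (absent [] (λ ()) , refl)
      choose (false ∷ ys) = inj₂ (absent (false ∷ ys) (λ { (there p) → at-≢ p }) , refl)
      choose (true ∷ ys)  = inj₁ (inj₂ (inj₁ (refl , here)) , ext to from (scan-count xs (false ∷ ys) (above-suc ab) hyp))
        where
        to : ∀ r′ t′ → (U ∪ Row (suc r) (suc t) (false ∷ ys) ∪ Row r (suc t) xs) r′ t′ → Delete (Q (true ∷ ys)) r t (suc t) r′ t′
        to r′ t′ (inj₁ u) = inj₁ u , (λ { (refl , refl) → no-row ab u }) , (λ { (refl , refl) → no-left ab (n≤1+n t) u })
        to r′ t′ (inj₂ (inj₁ (refl , there p))) = inj₂ (inj₁ (refl , there p)) , (λ { (e , _) → 1+n≢n e }) , (λ { (_ , refl) → at-≢ p })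
        to r′ t′ (inj₂ (inj₂ (refl , p))) = inj₂ (inj₂ (refl , there p)) , (λ { (_ , refl) → at-≢ p }) , (λ { (e , _) → r≢suc e })
        from : ∀ r′ t′ → Delete (Q (true ∷ ys)) r t (suc t) r′ t′ → (U ∪ Row (suc r) (suc t) (false ∷ ys) ∪ Row r (suc t) xs) r′ t′
        from r′ t′ (inj₁ u , _)                          = inj₁ u
        from r′ t′ (inj₂ (inj₁ (refl , here)) , _ , n)   = contradiction (refl , refl) n
        from r′ t′ (inj₂ (inj₁ (refl , there p)) , _)    = inj₂ (inj₁ (refl , there p))
        from r′ t′ (inj₂ (inj₂ (refl , here)) , n , _)   = contradiction (refl , refl) n
        from r′ t′ (inj₂ (inj₂ (refl , there p)) , _)    = inj₂ (inj₂ (refl , p))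

  -- The index of the first site of the next row: of the neighbours t and t + 1 of the first cell, t
  -- is missing at the wall for `c1` and `c2`.
  shift : Class → ℕ → ℕ
  shift c0 t = t
  shift c1 t = suc t
  shift c2 t = suc t
  shift c3 t = t

  Rows : (Class → ℕ) → Class → ℕ → ℕ → ℕ → Cells
  Rows len c r t zero    r′ t′ = ⊥
  Rows len c r t (suc d) = Rows len (next c) (suc r) (shift c t) d ∪ Row (suc r) (shift c t) (full (len (next c)))

  rows-above : ∀ {len} c {r t} d {r′ t′} → Rows len c r t d r′ t′ → r < r′
  rows-above c (suc d) (inj₁ p)          = <⇒≤ (rows-above (next c) d p)
  rows-above c (suc d) (inj₂ (refl , _)) = ≤-refl

  module _ {N : Cells → ℕ → Set} (C : Counting N) (len : Class → ℕ) where
    open Counting C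

    count-correct : ∀ d c {r t} xs → N (Rows len c r t d ∪ Row r t xs) (count len c d xs)
    count-correct zero c {r} {t} xs = ext
      (λ { _ _ (inj₁ ()) ; _ _ (inj₂ (inj₁ (_ , ()))) ; _ _ (inj₂ (inj₂ p)) → inj₂ p }) (λ { _ _ (inj₁ ()) ; _ _ (inj₂ p) → inj₂ (inj₂ p) })
      (scan-nil C xs {r} {t} {λ _ _ → ⊥} {λ _ → 1} (λ _ _ ()) (empty λ _ _ ()))
    count-correct (suc d) c {r} {t} xs = ext
      (λ { _ _ (inj₁ u) → inj₁ (inj₁ u) ; _ _ (inj₂ (inj₁ p)) → inj₁ (inj₂ p) ; _ _ (inj₂ (inj₂ p)) → inj₂ p })
      (λ { _ _ (inj₁ (inj₁ u)) → inj₁ u ; _ _ (inj₁ (inj₂ p)) → inj₂ (inj₁ p) ; _ _ (inj₂ p) → inj₂ (inj₂ p) })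
      (go c)
      where
      above : ∀ c → Above r t (Rows len (next c) (suc r) (shift c t) d)
      above c r′ t′ p = <⇒≤ lt , λ { refl → contradiction lt (<-irrefl refl) }
        where lt = rows-above (next c) d p
      go : ∀ c → N (Rows len (next c) (suc r) (shift c t) d ∪ Row (suc r) (shift c t) (full (len (next c))) ∪ Row r t xs)
                   (match c (full (len (next c))) xs (count len (next c) d))
      go c0 = scan-count  C xs (full (len c1)) (above c0) (count-correct d c1)
      go c1 = scanˡ-count C xs (full (len c2)) (above c1) (count-correct d c2)
      go c2 = scanˡ-count C xs (full (len c3)) (above c2) (count-correct d c3)
      go c3 = scan-count  C xs (full (len c0)) (above c3) (count-correct d c0)

-- The stack of rows as a wedge given by inequalities.

module Shapes where

  open RowMatching using (full)
  open Recursion using (Class; c0; c1; c2; c3; next; count; module Even; module Odd)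
  open Vandermonde using (alt)
  open Coordinates
  open RowByRow
  open import Data.Bool using (Bool; true; not)
  open import Data.Bool.Properties using (not-involutive)
  open import Data.Nat as ℕ using (ℕ; zero; suc; _+_; _≤_; _<_; s≤s; z≤n)
  open import Data.Nat.Properties
  open import Data.Nat.Tactic.RingSolver using (solve-∀)
  open import Data.Empty using (⊥-elim)
  open import Data.Product using (_×_; _,_; proj₁; proj₂; ∃)
  open import Data.Sum using (inj₁; inj₂)
  open import Relation.Nullary using (¬_; contradiction; yes; no)
  open import Relation.Binary.PropositionalEquality using (_≡_; refl; sym; trans; cong; subst)

  κ : Class → ℕ → Class
  κ c zero    = c
  κ c (suc r) = next (κ c r)

  -- The first site of a row of class c has 2t + 1 - r = offset c.
  offset : Class → ℕ
  offset c0 = 1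
  offset c1 = 0
  offset c2 = 1
  offset c3 = 2

  even : ℕ → Bool
  even zero    = true
  even (suc n) = not (even n)

  not-swap : ∀ {a b} → not a ≡ b → a ≡ not b
  not-swap {a} refl = sym (not-involutive a)

  at-full⁻ : ∀ {t t′} m → At t (full m) t′ → ∃ λ i → i < m × t′ ≡ t + i
  at-full⁻ {t} (suc m) here      = 0 , s≤s z≤n , sym (+-identityʳ t)
  at-full⁻ {t} (suc m) (there p) with at-full⁻ m p
  ... | i , lt , e = suc i , s≤s lt , trans e (sym (+-suc t i))

  at-full⁺ : ∀ t {m i} → i < m → At t (full m) (t + i)
  at-full⁺ t {suc m} {zero}  (s≤s _)  rewrite +-identityʳ t = here
  at-full⁺ t {suc m} {suc i} (s≤s lt) rewrite +-suc t i     = there (at-full⁺ (suc t) lt)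

  at-alt⁻ : ∀ {t t′} b m → At t (alt b m) t′ → ∃ λ i → i < m × t′ ≡ t + i × even i ≡ b
  at-alt⁻ {t} true (suc m) here      = 0 , s≤s z≤n , sym (+-identityʳ t) , refl
  at-alt⁻ {t} b    (suc m) (there p) with at-alt⁻ (not b) m p
  ... | i , lt , e , ev = suc i , s≤s lt , trans e (sym (+-suc t i)) , trans (cong not ev) (not-involutive b)

  at-alt⁺ : ∀ t b {m i} → i < m → even i ≡ b → At t (alt b m) (t + i)
  at-alt⁺ t b {suc m} {zero}  (s≤s _)  refl rewrite +-identityʳ t = here
  at-alt⁺ t b {suc m} {suc i} (s≤s lt) e    rewrite +-suc t i     = there (at-alt⁺ (suc t) (not b) lt (not-swap e))

  -- In terms of p = 2t + 1 - r: 0 ≤ p ≤ w, and p = 0 only in class 1.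
  Wedge : Class → ℕ → Cells
  Wedge c w r t = r ≤ suc (t + t) × (r ≡ suc (t + t) → c ≡ c1) × suc (t + t) ≤ w + r

  Fits : (Class → ℕ) → ℕ → Set
  Fits len w = ∀ c i → (i < len c → offset c + (i + i) ≤ w) × (offset c + (i + i) ≤ w → i < len c)

  module _ {len : Class → ℕ} {w : ℕ} (fits : Fits len w) where

    private
      double : ∀ t i r o → suc (t + t) ≡ r + o → suc ((t + i) + (t + i)) ≡ r + (o + (i + i))
      double t i r o e = trans (lemma t i) (trans (cong (_+ (i + i)) e) (+-assoc r o (i + i)))
        where
        lemma : ∀ t i → suc ((t + i) + (t + i)) ≡ suc (t + t) + (i + i)
        lemma = solve-∀

    row-wedge : ∀ c {r t t′} → suc (t + t) ≡ r + offset c → At t (full (len c)) t′ → Wedge c w r t′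
    row-wedge c {r} {t} inv p with at-full⁻ (len c) p
    ... | i , lt , refl =
      subst (r ≤_) (sym e) (m≤m+n r _) ,
      (λ q → wall c (+-cancelˡ-≡ r _ _ (trans (sym e) (trans (sym q) (sym (+-identityʳ r)))))) ,
      ≤-trans (≤-reflexive (trans e (+-comm r _))) (+-monoˡ-≤ r (proj₁ (fits c i) lt))
      where
      e = double t i r (offset c) inv
      wall : ∀ c → offset c + (i + i) ≡ 0 → c ≡ c1
      wall c1 _ = refl

    -- Each step to the left of the first site lowers p by 2. This makes p negative, except that one
    -- step in class 3 leads to p = 0, which the wall condition excludes.
    wedge-row : ∀ c {r t t′} → suc (t + t) ≡ r + offset c → Wedge c w r t′ → At t (full (len c)) t′
    wedge-row c {r} {t} {t′} inv (lo , wall , hi) with t ≤? t′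
    ... | yes le with m≤n⇒∃[o]m+o≡n le
    ...   | i , refl = at-full⁺ t (proj₂ (fits c i) (+-cancelʳ-≤ r _ _
            (≤-trans (≤-reflexive (trans (+-comm _ r) (sym (double t i r (offset c) inv)))) hi)))
    wedge-row c {r} {t} {t′} inv (lo , wall , hi) | no t≰t′ with m≤n⇒∃[o]m+o≡n (≰⇒> t≰t′)
    ...   | j , refl = ⊥-elim (absurd c wall (trans (sym inv) (lemma t′ j)))
      where
      s = suc (t′ + t′)
      lemma : ∀ t j → suc ((suc t + j) + (suc t + j)) ≡ suc (t + t) + (j + j) + 2
      lemma = solve-∀
      small : ¬ (r + 1 ≡ s + (j + j) + 2)
      small e = 1+n≰n (≤-trans (≤-reflexive (suc-injective (trans (+-comm 2 (s + (j + j))) (trans (sym e) (+-comm r 1))))) (≤-trans lo (m≤m+n s (j + j))))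
      absurd : ∀ c → (r ≡ s → c ≡ c1) → ¬ (r + offset c ≡ s + (j + j) + 2)
      absurd c0 _    e = small e
      absurd c1 _    e = small′ e
        where
        small′ : ¬ (r + 0 ≡ s + (j + j) + 2)
        small′ e = 1+n≰n (≤-trans (s≤s (≤-trans lo (m≤m+n s (j + j)))) (≤-trans (≤-trans (n≤1+n _) (≤-reflexive (+-comm 2 (s + (j + j))))) (≤-reflexive (trans (sym e) (+-identityʳ r)))))
      absurd c2 _    e = small e
      absurd c3 wall e with wall (≤-antisym lo (≤-trans (m≤m+n s (j + j)) (≤-reflexive (sym (+-cancelʳ-≡ 2 _ _ e)))))
      ... | ()

    private
      advance : ∀ c r t → suc (t + t) ≡ r + offset c → suc (shift c t + shift c t) ≡ suc r + offset (next c)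
      advance c0 r t e = trans e (lemma r)
        where
        lemma : ∀ r → r + 1 ≡ suc r + 0
        lemma = solve-∀
      advance c1 r t e = trans (lemma₁ t) (trans (cong (_+ 2) e) (lemma₂ r))
        where
        lemma₁ : ∀ t → suc (suc t + suc t) ≡ suc (t + t) + 2
        lemma₁ = solve-∀
        lemma₂ : ∀ r → r + 0 + 2 ≡ suc r + 1
        lemma₂ = solve-∀
      advance c2 r t e = trans (lemma₁ t) (trans (cong (_+ 2) e) (lemma₂ r))
        where
        lemma₁ : ∀ t → suc (suc t + suc t) ≡ suc (t + t) + 2
        lemma₁ = solve-∀
        lemma₂ : ∀ r → r + 1 + 2 ≡ suc r + 2
        lemma₂ = solve-∀
      advance c3 r t e = trans e (lemma r)
        where
        lemma : ∀ r → r + 2 ≡ suc r + 1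
        lemma = solve-∀

    rows-wedge : ∀ c d {r t r′ t′} → suc (t + t) ≡ r + offset (κ c r) → Rows len (κ c r) r t d r′ t′ →
      r′ ≤ r + d × Wedge (κ c r′) w r′ t′
    rows-wedge c (suc d) {r} {t} {r′} inv (inj₁ p) with rows-wedge c d {suc r} (advance (κ c r) r t inv) p
    ... | le , wd = subst (r′ ≤_) (sym (+-suc r d)) le , wd
    rows-wedge c (suc d) {r} {t} inv (inj₂ (refl , p)) =
      subst (suc r ≤_) (sym (+-suc r d)) (s≤s (m≤m+n r d)) , row-wedge (κ c (suc r)) (advance (κ c r) r t inv) p

    wedge-rows : ∀ c d {r t r′ t′} → suc (t + t) ≡ r + offset (κ c r) → r < r′ → r′ ≤ r + d → Wedge (κ c r′) w r′ t′ →
      Rows len (κ c r) r t d r′ t′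
    wedge-rows c zero {r} inv lt le wd = contradiction (≤-trans lt (subst (_ ≤_) (+-identityʳ r) le)) 1+n≰n
    wedge-rows c (suc d) {r} {t} {r′} inv lt le wd with m≤n⇒m<n∨m≡n lt
    ... | inj₁ lt′  = inj₁ (wedge-rows c d (advance (κ c r) r t inv) lt′ (subst (r′ ≤_) (+-suc r d) le) wd)
    ... | inj₂ refl = inj₂ (refl , wedge-row (κ c (suc r)) (advance (κ c r) r t inv) wd)

  Shape : Class → Bool → ℕ → Cells
  Shape c b n r t = r ≤ n × Wedge (κ c r) n r t × (r ≡ 0 → even t ≡ b)

  shape-count : ∀ {N} → Counting N → ∀ {len n} → Fits len n → ∀ c → offset c ≡ 1 → ∀ b →
    N (Shape c b n) (count len c n (alt b (len c)))
  shape-count C {len} {n} fits c o b = Counting.ext C to from (count-correct C len n c (alt b (len c)))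
    where
    inv : 1 ≡ 0 + offset (κ c 0)
    inv = sym o
    to : ∀ r t → (Rows len c 0 0 n ∪ Row 0 0 (alt b (len c))) r t → Shape c b n r t
    to r t (inj₁ p) = proj₁ q , proj₂ q , λ { refl → contradiction (rows-above c n p) (λ ()) }
      where q = rows-wedge fits c n {0} {0} inv p
    to r t (inj₂ (refl , p)) with at-alt⁻ b (len c) p
    ... | i , lt , refl , ev = z≤n , row-wedge fits c {0} {0} inv (at-full⁺ 0 lt) , λ _ → ev
    from : ∀ r t → Shape c b n r t → (Rows len c 0 0 n ∪ Row 0 0 (alt b (len c))) r t
    from (suc r) t (le , wd , _) = inj₁ (wedge-rows fits c n {0} {0} inv (s≤s z≤n) le wd)
    from zero    t (le , wd , ev) with at-full⁻ (len c) (wedge-row fits c {0} {0} inv wd)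
    ... | i , lt , refl = inj₂ (refl , at-alt⁺ 0 b lt (ev refl))

  fits-even : ∀ h → Fits (Even.len h) (h + h)
  fits-even h c0 i = (λ lt → ≤-trans (n≤1+n _) (≤-trans (≤-reflexive (cong suc (sym (+-suc i i)))) (+-mono-≤ lt lt))) , λ le → ≰⇒> λ ge → 1+n≰n (≤-trans le (+-mono-≤ ge ge))
  fits-even h c1 i = (λ { (s≤s le) → +-mono-≤ le le }) , λ le → s≤s (≮⇒≥ λ lt → <⇒≱ (+-mono-< lt lt) le)
  fits-even h c2 i = (λ lt → ≤-trans (n≤1+n _) (≤-trans (≤-reflexive (cong suc (sym (+-suc i i)))) (+-mono-≤ lt lt))) , λ le → ≰⇒> λ ge → 1+n≰n (≤-trans le (+-mono-≤ ge ge))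
  fits-even h c3 i = (λ lt → ≤-trans (≤-reflexive (cong suc (sym (+-suc i i)))) (+-mono-≤ lt lt)) , λ le → ≰⇒> λ ge → 1+n≰n (≤-trans (n≤1+n _) (≤-trans le (+-mono-≤ ge ge)))

  fits-odd : ∀ h → Fits (Odd.len h) (suc (h + h))
  fits-odd h c0 i = (λ { (s≤s le) → s≤s (+-mono-≤ le le) }) , λ { (s≤s le) → s≤s (≮⇒≥ λ lt → <⇒≱ (+-mono-< lt lt) le) }
  fits-odd h c1 i = (λ { (s≤s le) → ≤-trans (+-mono-≤ le le) (n≤1+n _) }) , λ le → s≤s (≮⇒≥ λ lt → <⇒≱ (≤-trans (≤-reflexive (cong suc (sym (+-suc h h)))) (+-mono-≤ lt lt)) le)
  fits-odd h c2 i = (λ { (s≤s le) → s≤s (+-mono-≤ le le) }) , λ { (s≤s le) → s≤s (≮⇒≥ λ lt → <⇒≱ (+-mono-< lt lt) le) }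
  fits-odd h c3 i = (λ lt → ≤-trans (≤-reflexive (cong suc (sym (+-suc i i)))) (≤-trans (+-mono-≤ lt lt) (n≤1+n _))) , λ { (s≤s le) → ≰⇒> λ ge → 1+n≰n (≤-trans le (+-mono-≤ ge ge)) }

-- The quartered Aztec diamonds are these shapes.

module Quarters where

  open import Defs
  open Recursion using (Class; c0; c1; c2; c3; next)
  open Coordinates
  open Shapes
  open import Data.Bool using (Bool; true; false; if_then_else_)
  open import Data.Bool.Properties using (not-involutive)
  open import Data.Nat as ℕ using (ℕ; zero; suc; _+_; _*_; _≤_; _<_; s≤s; ⌈_/2⌉)
  open import Data.Nat.Properties
  open import Data.Nat.Tactic.RingSolver using (solve-∀)
  open import Data.Integer as ℤ using (ℤ; +_; -[1+_]; ∣_∣; 1ℤ)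
  import Data.Integer.Properties as ℤₚ
  open import Data.Integer.Tactic.RingSolver using () renaming (solve-∀ to solve-ℤ)
  open import Data.Empty using (⊥-elim)
  open import Data.Product using (_×_; _,_; proj₁; proj₂)
  open import Data.Sum using (_⊎_; inj₁; inj₂)
  open import Relation.Nullary using (¬_; contradiction)
  open import Relation.Binary.PropositionalEquality using (_≡_; refl; sym; trans; cong; subst)

  -- |x + 1/2| = mag x + 1/2, so reflection of a square in an axis preserves `mag`.
  mag : ℤ → ℕ
  mag (+ m)    = m
  mag -[1+ m ] = m

  -- A zigzag with steps of length 2 follows the diagonal m = t and keeps the diagonal squares of
  -- one parity.
  Cond : Bool → ℕ → ℕ → Set
  Cond b m t = m ≤ t × (m ≡ t → even t ≡ b)

  side : Bool → Bool → ℤ → Bool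
  side β b (+ _)    = β
  side β b -[1+ _ ] = b

  -- For x ≥ 0 the boundary mag x = t is the wall p = 0; for x < 0 the row number is t - mag x, and
  -- the boundary is row 0.
  Coords : Bool → Bool → ℕ → ℤ → ℕ → Set
  Coords β b n x t = mag x + suc t ≤ n × Cond (side β b x) (mag x) t

  -- The wall site with index t lies in row 2t + 1; as classes have period 4 in the row number,
  -- class 1 occurs there for one parity of t.
  Wall : Class → Bool → Set
  Wall c β = ∀ t → (κ c (suc (t + t)) ≡ c1 → even t ≡ β) × (even t ≡ β → κ c (suc (t + t)) ≡ c1)

  neg-row : ∀ m r → -[1+ m ] ℤ.+ + (r + m) ℤ.+ 1ℤ ≡ + r
  neg-row m r = trans (cong (λ z → -[1+ m ] ℤ.+ z ℤ.+ 1ℤ) (ℤₚ.pos-+ r m)) (lemma (+ m) (+ r))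
    where
    lemma : ∀ m r → ℤ.- (1ℤ ℤ.+ m) ℤ.+ (r ℤ.+ m) ℤ.+ 1ℤ ≡ r
    lemma = solve-ℤ

  neg-row⁻ : ∀ m r t → -[1+ m ] ℤ.+ + t ℤ.+ 1ℤ ≡ + r → t ≡ r + m
  neg-row⁻ m r t e = ℤₚ.+-injective (trans (lemma (+ m) (+ t)) (trans (cong (ℤ._+ + m) e) (sym (ℤₚ.pos-+ r m))))
    where
    lemma : ∀ m t → t ≡ ℤ.- (1ℤ ℤ.+ m) ℤ.+ t ℤ.+ 1ℤ ℤ.+ m
    lemma = solve-ℤ

  module _ {c : Class} {β : Bool} (wall : Wall c β) (b : Bool) (n : ℕ) where

    private
      +-row : ∀ m t → m + t + 1 ≡ m + suc t
      +-row = solve-∀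
      +-row′ : ∀ m t → m + t + 1 ≡ suc (m + t)
      +-row′ = solve-∀

    place-shape : ∀ x t → Coords β b n x t → place (Shape c b n) x (+ t)
    place-shape (+ m) t (le , m≤t , cond) = m + t + 1 , t , at refl refl ,
      subst (_≤ n) (sym (+-row m t)) le ,
      (subst (_≤ suc (t + t)) (sym (+-row′ m t)) (s≤s (+-monoˡ-≤ t m≤t)) ,
       (λ e → subst (λ z → κ c z ≡ c1) (sym e) (proj₂ (wall t) (cond (+-cancelʳ-≡ t m t (suc-injective (trans (sym (+-row′ m t)) e)))))) ,
       ≤-trans (s≤s (+-monoʳ-≤ t (m≤n+m t m))) (≤-trans (+-monoˡ-≤ (m + t) (≤-trans (m≤n+m (suc t) m) le)) (+-monoʳ-≤ n (m≤m+n (m + t) 1)))) ,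
      λ e → ⊥-elim (1+n≢0 (trans (sym (+-row′ m t)) e))
    place-shape -[1+ m ] t (le , m≤t , cond) with m≤n⇒∃[o]m+o≡n m≤t
    ... | r , refl = r , m + r ,
      at refl (trans (cong (λ z → -[1+ m ] ℤ.+ + z ℤ.+ 1ℤ) (+-comm m r)) (neg-row m r)) ,
      ≤-trans (≤-trans (m≤n+m r m) (≤-trans (n≤1+n _) (m≤n+m (suc (m + r)) m))) le ,
      (≤-trans (m≤n+m r m) (≤-trans (m≤m+n (m + r) (m + r)) (n≤1+n _)) ,
       (λ e → ⊥-elim (<-irrefl e (s≤s (≤-trans (m≤n+m r m) (m≤m+n (m + r) (m + r)))))) ,
       ≤-trans (≤-reflexive (lemma m r)) (+-monoˡ-≤ r le)) ,
      λ { refl → cond (sym (+-identityʳ m)) }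
      where
      lemma : ∀ m r → suc (m + r + (m + r)) ≡ m + suc (m + r) + r
      lemma = solve-∀

    place-shape⁻ : ∀ x t → place (Shape c b n) x (+ t) → Coords β b n x t
    place-shape⁻ (+ m) t (r , _ , at refl refl , le , (lo , w , _) , _) =
      subst (_≤ n) (+-row m t) le ,
      +-cancelʳ-≤ t m t (≤-pred (subst (_≤ suc (t + t)) (+-row′ m t) lo)) ,
      λ { refl → proj₁ (wall t) (subst (λ z → κ c z ≡ c1) (+-row′ t t) (w (+-row′ t t))) }
    place-shape⁻ -[1+ m ] t (r , _ , at refl e , le , (_ , _ , hi) , base) with neg-row⁻ m r t e
    ... | refl = +-cancelʳ-≤ r _ _ (≤-trans (≤-reflexive (lemma m r)) hi) , m≤n+m m r ,
      λ eq → base (+-cancelʳ-≡ m r 0 (sym eq))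
      where
      lemma : ∀ m r → m + suc (r + m) + r ≡ suc (r + m + (r + m))
      lemma = solve-∀

  place-negative : ∀ {Q x q} → ¬ place Q x -[1+ q ]
  place-negative (_ , _ , at () _ , _)

  κ-step : ∀ c t → κ c (suc (suc t + suc t)) ≡ next (next (κ c (suc (t + t))))
  κ-step c t = cong (λ z → next (next (κ c z))) (+-suc t t)

  wall-c0 : Wall c0 true
  wall-c0 t = subst (λ k → (k ≡ c1 → even t ≡ true) × (even t ≡ true → k ≡ c1)) (sym (go t)) (lemma (even t))
    where
    go : ∀ t → κ c0 (suc (t + t)) ≡ (if even t then c1 else c3)
    go zero    = refl
    go (suc t) rewrite κ-step c0 t | go t with even t
    ... | true  = refl
    ... | false = refl
    lemma : ∀ e → ((if e then c1 else c3) ≡ c1 → e ≡ true) × (e ≡ true → (if e then c1 else c3) ≡ c1)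
    lemma true  = (λ _ → refl) , (λ _ → refl)
    lemma false = (λ ()) , (λ ())

  wall-c2 : Wall c2 false
  wall-c2 t = subst (λ k → (k ≡ c1 → even t ≡ false) × (even t ≡ false → k ≡ c1)) (sym (go t)) (lemma (even t))
    where
    go : ∀ t → κ c2 (suc (t + t)) ≡ (if even t then c3 else c1)
    go zero    = refl
    go (suc t) rewrite κ-step c2 t | go t with even t
    ... | true  = refl
    ... | false = refl
    lemma : ∀ e → ((if e then c3 else c1) ≡ c1 → e ≡ false) × (e ≡ false → (if e then c3 else c1) ≡ c1)
    lemma true  = (λ ()) , (λ ())
    lemma false = (λ _ → refl) , (λ _ → refl)

  roundUp : ℕ → ℕ
  roundUp m = 2 * ⌈ m /2⌉

  roundUp-value : ∀ m → (even m ≡ true × roundUp m ≡ m) ⊎ (even m ≡ false × roundUp m ≡ suc m)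
  roundUp-value zero          = inj₁ (refl , refl)
  roundUp-value (suc zero)    = inj₂ (refl , refl)
  roundUp-value (suc (suc m)) with roundUp-value m
  ... | inj₁ (e , f) = inj₁ (trans (not-involutive _) e , trans (*-suc 2 ⌈ m /2⌉) (cong (λ z → suc (suc z)) f))
  ... | inj₂ (e , f) = inj₂ (trans (not-involutive _) e , trans (*-suc 2 ⌈ m /2⌉) (cong (λ z → suc (suc z)) f))

  -- Rounding m up excludes the diagonal m = t exactly for odd m, whereas rounding t up, in
  -- `<-roundUp`, admits it exactly for odd t. This is the origin of the two parities.
  roundUp-≤ : ∀ m t → roundUp m ≤ t → Cond true m t
  roundUp-≤ m t le with roundUp-value m
  ... | inj₁ (e , f) = subst (_≤ t) f le , λ { refl → e }
  ... | inj₂ (e , f) = <⇒≤ (subst (_≤ t) f le) , λ { refl → ⊥-elim (1+n≰n (subst (_≤ t) f le)) }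

  roundUp-≤⁻ : ∀ m t → Cond true m t → roundUp m ≤ t
  roundUp-≤⁻ m t (le , cond) with roundUp-value m
  ... | inj₁ (e , f) = subst (_≤ t) (sym f) le
  ... | inj₂ (e , f) = subst (_≤ t) (sym f) (≤∧≢⇒< le λ { refl → contradiction (trans (sym e) (cond refl)) (λ ()) })

  <-roundUp : ∀ m t → m < roundUp t → Cond false m t
  <-roundUp m t lt with roundUp-value t
  ... | inj₁ (e , f) = <⇒≤ (subst (m <_) f lt) , λ { refl → ⊥-elim (<-irrefl refl (subst (m <_) f lt)) }
  ... | inj₂ (e , f) = ≤-pred (subst (m <_) f lt) , λ _ → e

  <-roundUp⁻ : ∀ m t → Cond false m t → m < roundUp t
  <-roundUp⁻ m t (le , cond) with roundUp-value t
  ... | inj₁ (e , f) = subst (m <_) (sym f) (≤∧≢⇒< le λ { refl → contradiction (trans (sym e) (cond refl)) (λ ()) })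
  ... | inj₂ (e , f) = subst (m <_) (sym f) (s≤s le)

  abs-odd : ∀ a → ∣ + 2 ℤ.* a ℤ.+ 1ℤ ∣ ≡ suc (mag a + mag a)
  abs-odd (+ m) = trans (cong (λ z → ∣ z ℤ.+ 1ℤ ∣) (sym (ℤₚ.pos-* 2 m))) (lemma m)
    where
    lemma : ∀ m → 2 * m + 1 ≡ suc (m + m)
    lemma = solve-∀
  abs-odd -[1+ m ] = trans (cong ∣_∣ (lemma (+ m))) (ℤₚ.∣-i∣≡∣i∣ (1ℤ ℤ.+ (+ m ℤ.+ + m)))
    where
    lemma : ∀ m → + 2 ℤ.* ℤ.- (1ℤ ℤ.+ m) ℤ.+ 1ℤ ≡ ℤ.- (1ℤ ℤ.+ (m ℤ.+ m))
    lemma = solve-ℤ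

  aztec : ∀ n a b → Aztec n a b → mag a + suc (mag b) ≤ n
  aztec n a b le rewrite abs-odd a | abs-odd b =
    *-cancelˡ-≤ 2 (≤-trans (≤-reflexive (lemma (mag a) (mag b))) le)
    where
    lemma : ∀ x y → 2 * (x + suc y) ≡ suc (x + x) + suc (y + y)
    lemma = solve-∀

  aztec⁻ : ∀ n a b → mag a + suc (mag b) ≤ n → Aztec n a b
  aztec⁻ n a b le rewrite abs-odd a | abs-odd b =
    ≤-trans (≤-reflexive (lemma (mag a) (mag b))) (*-monoʳ-≤ 2 le)
    where
    lemma : ∀ x y → suc (x + x) + suc (y + y) ≡ 2 * (x + suc y)
    lemma = solve-∀

  ceil-+ : ∀ m → + 2 ℤ.* ceilHalf (+ m) ≡ + roundUp m
  ceil-+ m = sym (ℤₚ.pos-* 2 ⌈ m /2⌉)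

  ceil-neg : ∀ m → + 2 ℤ.* ceilHalf -[1+ m ] ≡ ℤ.- + roundUp m
  ceil-neg m = trans (sym (ℤₚ.neg-distribʳ-* (+ 2) (+ ⌈ m /2⌉))) (cong ℤ.-_ (sym (ℤₚ.pos-* 2 ⌈ m /2⌉)))

  ceil-abs : ∀ a → + 2 ℤ.* (+ ∣ ceilHalf a ∣) ≡ + roundUp (mag a)
  ceil-abs (+ m)    = ceil-+ m
  ceil-abs -[1+ m ] = trans (cong (λ z → + 2 ℤ.* + z) (ℤₚ.∣-i∣≡∣i∣ (+ ⌈ m /2⌉))) (ceil-+ m)

  side-const : ∀ b x → side b b x ≡ b
  side-const b (+ _)    = refl
  side-const b -[1+ _ ] = refl

  Ka-shape : ∀ n a b → Ka n a b → place (Shape c0 true n) a b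
  Ka-shape n a (+ t) (az , le) = place-shape wall-c0 true n a t
    (aztec n a (+ t) az , subst (λ β → Cond β (mag a) t) (sym (side-const true a))
      (roundUp-≤ (mag a) t (ℤₚ.drop‿+≤+ (subst (ℤ._≤ + t) (ceil-abs a) le))))
  Ka-shape n a -[1+ q ] (az , le) with subst (ℤ._≤ -[1+ q ]) (ceil-abs a) le
  ... | ()

  shape-Ka : ∀ n a b → place (Shape c0 true n) a b → Ka n a b
  shape-Ka n a (+ t) p with place-shape⁻ wall-c0 true n a t p
  ... | le , cond = aztec⁻ n a (+ t) le , subst (ℤ._≤ + t) (sym (ceil-abs a))
        (ℤ.+≤+ (roundUp-≤⁻ (mag a) t (subst (λ β → Cond β (mag a) t) (side-const true a) cond)))
  shape-Ka n a -[1+ q ] p = ⊥-elim (place-negative p)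

  R-shape : ∀ n a b → R n a b → place (Shape c0 false n) a b
  R-shape n (+ m) (+ t) (az , le , _) = place-shape wall-c0 false n (+ m) t
    (aztec n (+ m) (+ t) az , roundUp-≤ m t (ℤₚ.drop‿+≤+ (subst (ℤ._≤ + t) (ceil-+ m) le)))
  R-shape n -[1+ m ] (+ t) (az , _ , le) = place-shape wall-c0 false n -[1+ m ] t
    (aztec n -[1+ m ] (+ t) az , <-roundUp m t (ℤₚ.drop‿+≤+ (ℤₚ.neg-cancel-≤ (subst (λ z → ℤ.- z ℤ.≤ -[1+ m ]) (ceil-+ t) le))))
  R-shape n (+ m) -[1+ q ] (_ , le , _) with subst (ℤ._≤ -[1+ q ]) (ceil-+ m) le
  ... | ()
  R-shape n -[1+ m ] -[1+ q ] (_ , _ , le) with subst (ℤ._≤ -[1+ m ]) (trans (cong ℤ.-_ (ceil-neg q)) (ℤₚ.neg-involutive (+ roundUp q))) le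
  ... | ()

  shape-R : ∀ n a b → place (Shape c0 false n) a b → R n a b
  shape-R n (+ m) (+ t) p with place-shape⁻ wall-c0 false n (+ m) t p
  ... | le , cond = aztec⁻ n (+ m) (+ t) le , subst (ℤ._≤ + t) (sym (ceil-+ m)) (ℤ.+≤+ (roundUp-≤⁻ m t cond)) ,
                    subst (λ z → ℤ.- z ℤ.≤ + m) (sym (ceil-+ t)) ℤₚ.neg-≤-pos
  shape-R n -[1+ m ] (+ t) p with place-shape⁻ wall-c0 false n -[1+ m ] t p
  ... | le , cond = aztec⁻ n -[1+ m ] (+ t) le , subst (ℤ._≤ + t) (sym (ceil-neg m)) ℤₚ.neg-≤-pos ,
                    subst (λ z → ℤ.- z ℤ.≤ -[1+ m ]) (sym (ceil-+ t)) (ℤₚ.neg-mono-≤ (ℤ.+≤+ (<-roundUp⁻ m t cond)))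
  shape-R n a -[1+ q ] p = ⊥-elim (place-negative p)

  aztec-swap : ∀ n x t → x + suc t ≤ n → t + suc x ≤ n
  aztec-swap n x t = subst (_≤ n) (lemma x t)
    where
    lemma : ∀ x t → x + suc t ≡ t + suc x
    lemma = solve-∀

  -- With a = t, the upper bound on b ≥ 0 and the lower bound on b < 0 both read mag b < roundUp t,
  -- so wall and row 0 carry the same parity `false`.
  Kna-shape : ∀ n a b → Kna n a b → place (Shape c2 false n) b a
  Kna-shape n (+ t) (+ m) (az , _ , le) = place-shape wall-c2 false n (+ m) t
    (aztec-swap n t m (aztec n (+ t) (+ m) az) ,
     <-roundUp m t (upper m (roundUp t) (subst (λ z → + m ℤ.≤ z ℤ.- 1ℤ) (ceil-+ t) le)))
    where
    upper : ∀ m u → + m ℤ.≤ + u ℤ.- 1ℤ → m < u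
    upper m (suc u) le = s≤s (ℤₚ.drop‿+≤+ le)
  Kna-shape n (+ t) -[1+ m ] (az , le , _) = place-shape wall-c2 false n -[1+ m ] t
    (aztec-swap n t m (aztec n (+ t) -[1+ m ] az) ,
     <-roundUp m t (ℤₚ.drop‿+≤+ (ℤₚ.neg-cancel-≤ (subst (λ z → ℤ.- z ℤ.≤ -[1+ m ]) (ceil-+ t) le))))
  Kna-shape n -[1+ q ] (+ m) (_ , _ , le) = ⊥-elim (absurd (roundUp q) (subst (λ z → + m ℤ.≤ z ℤ.- 1ℤ) (ceil-neg q) le))
    where
    absurd : ∀ u → ¬ (+ m ℤ.≤ ℤ.- + u ℤ.- 1ℤ)
    absurd zero    ()
    absurd (suc u) ()
  Kna-shape n -[1+ q ] -[1+ m ] (_ , le , _)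
    with subst (ℤ._≤ -[1+ m ]) (trans (cong ℤ.-_ (ceil-neg q)) (ℤₚ.neg-involutive (+ roundUp q))) le
  ... | ()

  shape-Kna : ∀ n a b → place (Shape c2 false n) b a → Kna n a b
  shape-Kna n (+ t) (+ m) p with place-shape⁻ wall-c2 false n (+ m) t p
  ... | le , cond = aztec⁻ n (+ t) (+ m) (aztec-swap n m t le) ,
                    subst (λ z → ℤ.- z ℤ.≤ + m) (sym (ceil-+ t)) ℤₚ.neg-≤-pos ,
                    subst (λ z → + m ℤ.≤ z ℤ.- 1ℤ) (sym (ceil-+ t)) (upper (<-roundUp⁻ m t cond))
    where
    upper : ∀ {m u} → m < u → + m ℤ.≤ + u ℤ.- 1ℤ
    upper (s≤s le) = ℤ.+≤+ le
  shape-Kna n (+ t) -[1+ m ] p with place-shape⁻ wall-c2 false n -[1+ m ] t p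
  ... | le , cond = aztec⁻ n (+ t) -[1+ m ] (aztec-swap n m t le) ,
                    subst (λ z → ℤ.- z ℤ.≤ -[1+ m ]) (sym (ceil-+ t)) (ℤₚ.neg-mono-≤ (ℤ.+≤+ (<-roundUp⁻ m t cond))) ,
                    subst (λ z → -[1+ m ] ℤ.≤ z ℤ.- 1ℤ) (sym (ceil-+ t)) (upper (<-roundUp⁻ m t cond))
    where
    upper : ∀ {u} → m < u → -[1+ m ] ℤ.≤ + u ℤ.- 1ℤ
    upper (s≤s _) = ℤ.-≤+
  shape-Kna n -[1+ q ] b p = ⊥-elim (place-negative p)

-- Assembly: the constants for each order and the final formulas.

open Determinants using (det; below; det-length)
open RowMatching
open EvenPolynomials using (ev; od; wev)
open Recursion
open Vandermonde
open Products
open Coordinates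
open Tilings using (num-ext)
open RowByRow
open Shapes
open Quarters
open import Defs
open import Data.Bool using (true; false)
open import Data.Nat using (ℕ; zero; suc; _+_; _*_; _∸_; _^_; _≤_; s≤s; z≤n; ⌊_/2⌋; NonZero)
open import Data.Nat.Properties
open import Data.Nat.Tactic.RingSolver using (solve-∀)
import Data.Integer as ℤ
open ℤ using (ℤ; +_; ∣_∣)
import Data.Integer.Properties as ℤₚ
open import Data.List using (length)
open import Data.Product using (Σ; _×_; _,_)
open import Function using (_∘_)
open import Relation.Binary.PropositionalEquality using (_≡_; _≢_; refl; sym; trans; cong; cong₂; subst; module ≡-Reasoning)
open ≡-Reasoning

-- The primed variants have two rows more or less, so that the class of the top row changes.
module _ (h : ℕ) where
  open Even h

  private
    cycle : ∀ {k C D} n → Part h (ev 1) k C D (count len c0 n) →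
      Part h (ev 1) (suc k) (C * α k * β k) (D * τ k * τ (suc k)) (count len c0 (4 + n))
    cycle n p = e0 {n = 3 + n} (e1 {n = 2 + n} (e2 {n = 1 + n} (e3 {n = n} p)))

  part0 : ∀ k → Part h (ev 1) k (Cₑ k) (Dₑ k) (count len c0 (k * 4))
  part0 zero    = top len c0 h (ev 1)
  part0 (suc k) = cycle (k * 4) (part0 k)

  part0′ : ∀ k → Part h (ev 1) (suc k) (Cₑ (suc k)) (Dₑ (suc k)) (count len c0 (2 + k * 4))
  -- The steps `e3` and `e2` of a whole cycle would act here on k = 0 functions with constant 1, so
  -- starting two rows later leaves the constants unchanged.
  part0′ zero    = e0 {n = 1} (e1 {n = 0} (top len c2 h (od 1)))
  part0′ (suc k) = cycle (2 + k * 4) (part0′ k)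

  part2 : ∀ k → Part h (od 1) k (Cₑ k * α k) (Dₑ k * τ k) (count len c2 (2 + k * 4))
  part2 k = e2 {n = 1 + k * 4} (e3 {n = k * 4} (part0 k))

  part2′ : ∀ k → Part h (od 1) (suc k) (Cₑ (suc k) * α (suc k)) (Dₑ (suc k) * τ (suc k)) (count len c2 (suc k * 4))
  part2′ k = e2 {n = 3 + k * 4} (e3 {n = 2 + k * 4} (part0′ k))

module _ (h : ℕ) where
  open Odd h

  private
    most : ∀ {k C D} n → Part (suc h) wev k C D (count len c1 n) →
      Hole (suc h) (ev 1) (suc k) (C * α′ k * β k) (D * τ k) (count len c2 (3 + n))
    most n p = o2 {n = 2 + n} (o3 {n = 1 + n} (o0 {n = n} p))

  part1 : ∀ k → Part (suc h) wev k (Cₒ k) (Dₒ k) (count len c1 (k * 4))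
  part1 zero    = top len c1 (suc h) wev
  part1 (suc k) = o1 {n = 3 + k * 4} (most (k * 4) (part1 k))

  part1′ : ∀ k → Part (suc h) wev (suc k) (Cₒ (suc k)) (Dₒ (suc k)) (count len c1 (2 + k * 4))
  part1′ zero    = o1 {n = 1} (o2 {n = 0} (top len c3 h (od 2)))
  part1′ (suc k) = o1 {n = 5 + k * 4} (most (2 + k * 4) (part1′ k))

  hole0 : ∀ k → Hole (suc h) (od 1) k (Cₒ k * α′ k) (Dₒ k) (count len c0 (1 + k * 4))
  hole0 k = o0 {n = k * 4} (part1 k)

  hole0′ : ∀ k → Hole (suc h) (od 1) (suc k) (Cₒ (suc k) * α′ (suc k)) (Dₒ (suc k)) (count len c0 (3 + k * 4))
  hole0′ k = o0 {n = 2 + k * 4} (part1′ k)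

  hole2 : ∀ k → Hole (suc h) (ev 1) (suc k) (Cₒ (suc k)) (Dₒ (suc k)) (count len c2 (3 + k * 4))
  hole2 k = most (k * 4) (part1 k)

  hole2′ : ∀ k → Hole (suc h) (ev 1) (suc k) (Cₒ (suc k)) (Dₒ (suc k)) (count len c2 (1 + k * 4))
  hole2′ zero    = o2 {n = 0} (top len c3 h (od 2))
  hole2′ (suc k) = most (2 + k * 4) (part1′ k)

-- A count is nonnegative, so absolute values dispose of the signs from integration and from the
-- order of the points.
formula-at : ∀ {s m f k C D T} → Formula s m f k C D T → ∀ {b ps} → s (alt b m) ≡ ps →
  T (alt b m) * C ≡ D * ∣ det (below f k) ps ∣
formula-at {s} {m} {f} {k} {C} {D} {T} (formula c d ∣c∣ ∣d∣ val) {b} refl = begin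
  T xs * C                         ≡⟨ cong (T xs *_) (sym ∣c∣) ⟩
  T xs * ∣ c ∣                     ≡⟨ sym (ℤₚ.abs-* (+ T xs) c) ⟩
  ∣ + T xs ℤ.* c ∣                 ≡⟨ cong ∣_∣ (val xs (length-alt b m)) ⟩
  ∣ d ℤ.* det (below f k) (s xs) ∣ ≡⟨ ℤₚ.abs-* d _ ⟩
  ∣ d ∣ * ∣ det (below f k) (s xs) ∣ ≡⟨ cong (_* ∣ det (below f k) (s xs) ∣) ∣d∣ ⟩
  D * ∣ det (below f k) (s xs) ∣   ∎
  where xs = alt b m

length-below : ∀ {A : Set} (f : ℕ → A) k → length (below f k) ≡ k
length-below f zero    = refl
length-below f (suc k) = cong suc (length-below f k)

formula-zero : ∀ {s m f k C D T} → .⦃ NonZero C ⦄ → Formula s m f k C D T → ∀ {b n l} → s (alt b m) ≡ ap n l → l ≢ k →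
  T (alt b m) ≡ 0
formula-zero {m = m} {f} {k} {C} {D} {T} F {b} {n} {l} e l≢k = *-cancelʳ-≡ _ 0 C (begin
  T (alt b m) * C                        ≡⟨ formula-at F e ⟩
  D * ∣ det (below f k) (ap n l) ∣       ≡⟨ cong (λ z → D * ∣ z ∣) (det-length (below f k) (ap n l)
                                             (λ q → l≢k (trans (sym (length-ap n l)) (trans q (length-below f k))))) ⟩
  D * 0                                  ≡⟨ *-zeroʳ D ⟩
  0                                      ∎)

num-Ka : ∀ {len w} → Fits len w → NumTilings (Ka w) (count len c0 w (alt true (len c0)))
num-Ka {w = w} fits = num-ext (shape-Ka w) (Ka-shape w) (shape-count counting⁺ fits c0 refl true)

num-R : ∀ {len w} → Fits len w → NumTilings (R w) (count len c0 w (alt false (len c0)))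
num-R {w = w} fits = num-ext (shape-R w) (R-shape w) (shape-count counting⁺ fits c0 refl false)

num-Kna : ∀ {len w} → Fits len w → NumTilings (Kna w) (count len c2 w (alt false (len c2)))
num-Kna {w = w} fits = num-ext (shape-Kna w) (Kna-shape w) (shape-count counting⁻ fits c2 refl false)

fits0 : ∀ n → Fits (Even.len (n * 2)) (n * 4)
fits0 n = subst (Fits _) (lemma n) (fits-even (n * 2))
  where
  lemma : ∀ n → n * 2 + n * 2 ≡ n * 4
  lemma = solve-∀

fits2 : ∀ n → Fits (Even.len (1 + n * 2)) (2 + n * 4)
fits2 n = subst (Fits _) (lemma n) (fits-even (1 + n * 2))
  where
  lemma : ∀ n → 1 + n * 2 + (1 + n * 2) ≡ 2 + n * 4
  lemma = solve-∀

fits1 : ∀ n → Fits (Odd.len (n * 2)) (1 + n * 4)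
fits1 n = subst (Fits _) (lemma n) (fits-odd (n * 2))
  where
  lemma : ∀ n → suc (n * 2 + n * 2) ≡ 1 + n * 4
  lemma = solve-∀

fits3 : ∀ n → Fits (Odd.len (1 + n * 2)) (3 + n * 4)
fits3 n = subst (Fits _) (lemma n) (fits-odd (1 + n * 2))
  where
  lemma : ∀ n → suc (1 + n * 2 + (1 + n * 2)) ≡ 3 + n * 4
  lemma = solve-∀

diagonal-α′ : ∀ n → prod n (λ j → j + j ∸ 1) ≡ α′ n
diagonal-α′ zero    = refl
diagonal-α′ (suc k) = trans (cong₂ _*_ (diagonal-α′ k) (lemma k)) (*-comm (α′ k) _)
  where
  lemma : ∀ k → k + suc k ≡ 1 + 2 * k
  lemma = solve-∀

even-ev : ∀ e n t → t * Cₑ n ≡ Dₑ n * spread e n →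
  t * denominator n ≡ 2 ^ ⌊ n * (3 * n ∸ 1) /2⌋ * numerator e n
even-ev e n t eq rewrite xₑ-closed n = *-cancelˡ-≡ _ _ (Cₑ n) ⦃ Cₑ-nonZero n ⦄ (begin
  Cₑ n * (t * denominator n)            ≡⟨ lemma (Cₑ n) t (denominator n) ⟩
  t * Cₑ n * denominator n              ≡⟨ cong (_* denominator n) eq ⟩
  Dₑ n * spread e n * denominator n     ≡⟨ even-product e n ⟩
  Cₑ n * (2 ^ xₑ n * numerator e n)     ∎)
  where
  lemma : ∀ c t p → c * (t * p) ≡ t * c * p
  lemma = solve-∀

odd-ev : ∀ e n t → t * Cₒ n ≡ Dₒ n * spread e n →
  t * denominator n ≡ 2 ^ ⌊ n * (3 * n ∸ 3) /2⌋ * numerator e n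
odd-ev e n t eq rewrite xₒ-closed n = *-cancelˡ-≡ _ _ (Cₒ n) ⦃ Cₒ-nonZero n ⦄ (begin
  Cₒ n * (t * denominator n)            ≡⟨ lemma (Cₒ n) t (denominator n) ⟩
  t * Cₒ n * denominator n              ≡⟨ cong (_* denominator n) eq ⟩
  Dₒ n * spread e n * denominator n     ≡⟨ odd-product e n ⟩
  Cₒ n * (2 ^ xₒ n * numerator e n)     ∎)
  where
  lemma : ∀ c t p → c * (t * p) ≡ t * c * p
  lemma = solve-∀

denominatorLe numeratorLe diagonal₁ diagonal₃ : ℕ → ℕ
denominatorLe n = prodLe n (λ i j → i + j ∸ 1)
numeratorLe n   = prodLe n (λ i j → 2 * i + 2 * j ∸ 1)
diagonal₁ n     = prod n (λ j → 2 * j + 2 * j ∸ 1)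
diagonal₃ n     = prod n (λ j → 2 * j + 2 * j ∸ 3)

denominatorLe≡ : ∀ n → denominatorLe n ≡ denominator n * α′ n
denominatorLe≡ n = trans (prodLe-diagonal n (λ i j → i + j ∸ 1)) (cong (denominator n *_) (diagonal-α′ n))

-- The odd basis contributes the points 4j - 1 themselves, which are the factors i = j of the
-- numerator; the factors 2j - 1 of the denominator come from `α` = `τ` · `α′`.
even-od : ∀ n t → t * (Cₑ n * α n) ≡ Dₑ n * τ n * (diagonal₁ n * spread 1 n) →
  t * denominatorLe n ≡ 2 ^ ⌊ n * (3 * n ∸ 1) /2⌋ * numeratorLe n
even-od n t eq rewrite xₑ-closed n | denominatorLe≡ n | prodLe-diagonal n (λ i j → 2 * i + 2 * j ∸ 1) =
  *-cancelˡ-≡ _ _ (Cₑ n * τ n) ⦃ m*n≢0 (Cₑ n) (τ n) ⦃ Cₑ-nonZero n ⦄ ⦃ prodℕ-nonZero _ (λ _ → _) n ⦄ ⦄ (begin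
  Cₑ n * τ n * (t * (denominator n * α′ n))             ≡⟨ lemma₁ (Cₑ n) (τ n) t (denominator n) (α′ n) ⟩
  t * (Cₑ n * (τ n * α′ n)) * denominator n             ≡⟨ cong (λ z → t * (Cₑ n * z) * denominator n) (sym (α≡τα′ n)) ⟩
  t * (Cₑ n * α n) * denominator n                      ≡⟨ cong (_* denominator n) eq ⟩
  Dₑ n * τ n * (diagonal₁ n * spread 1 n) * denominator n ≡⟨ lemma₂ (Dₑ n) (τ n) (diagonal₁ n) (spread 1 n) (denominator n) ⟩
  Dₑ n * spread 1 n * denominator n * (τ n * diagonal₁ n) ≡⟨ cong (_* (τ n * diagonal₁ n)) (even-product 1 n) ⟩
  Cₑ n * (2 ^ xₑ n * numerator 1 n) * (τ n * diagonal₁ n) ≡⟨ lemma₃ (Cₑ n) (2 ^ xₑ n) (numerator 1 n) (τ n) (diagonal₁ n) ⟩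
  Cₑ n * τ n * (2 ^ xₑ n * (numerator 1 n * diagonal₁ n)) ∎)
  where
  lemma₁ : ∀ c x t p a → c * x * (t * (p * a)) ≡ t * (c * (x * a)) * p
  lemma₁ = solve-∀
  lemma₂ : ∀ d x w s p → d * x * (w * s) * p ≡ d * s * p * (x * w)
  lemma₂ = solve-∀
  lemma₃ : ∀ c e m x w → c * (e * m) * (x * w) ≡ c * x * (e * (m * w))
  lemma₃ = solve-∀

odd-od : ∀ n t → t * (Cₒ n * α′ n) ≡ Dₒ n * (diagonal₁ n * spread 1 n) →
  t * denominatorLe n ≡ 2 ^ ⌊ n * (3 * n ∸ 3) /2⌋ * numeratorLe n
odd-od n t eq rewrite xₒ-closed n | denominatorLe≡ n | prodLe-diagonal n (λ i j → 2 * i + 2 * j ∸ 1) =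
  *-cancelˡ-≡ _ _ (Cₒ n) ⦃ Cₒ-nonZero n ⦄ (begin
  Cₒ n * (t * (denominator n * α′ n))                   ≡⟨ lemma₁ (Cₒ n) t (denominator n) (α′ n) ⟩
  t * (Cₒ n * α′ n) * denominator n                     ≡⟨ cong (_* denominator n) eq ⟩
  Dₒ n * (diagonal₁ n * spread 1 n) * denominator n     ≡⟨ lemma₂ (Dₒ n) (diagonal₁ n) (spread 1 n) (denominator n) ⟩
  Dₒ n * spread 1 n * denominator n * diagonal₁ n       ≡⟨ cong (_* diagonal₁ n) (odd-product 1 n) ⟩
  Cₒ n * (2 ^ xₒ n * numerator 1 n) * diagonal₁ n       ≡⟨ lemma₃ (Cₒ n) (2 ^ xₒ n) (numerator 1 n) (diagonal₁ n) ⟩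
  Cₒ n * (2 ^ xₒ n * (numerator 1 n * diagonal₁ n))     ∎)
  where
  lemma₁ : ∀ c t p a → c * (t * (p * a)) ≡ t * (c * a) * p
  lemma₁ = solve-∀
  lemma₂ : ∀ d w s p → d * (w * s) * p ≡ d * s * p * w
  lemma₂ = solve-∀
  lemma₃ : ∀ c e m w → c * (e * m) * w ≡ c * (e * (m * w))
  lemma₃ = solve-∀

-- The points are 1, 5, 9, ..., so the numerator appears with 2i + 2j - 3; the extra factor from the
-- points themselves converts it to the one with 2i + 2j - 1 that R(4n) has.
odd-R : ∀ n s → s * (Cₒ n * α′ n) ≡ Dₒ n * (diagonal₃ n * spread 3 n) →
  s * denominator n ≡ 2 ^ xₒ n * numerator 1 n
odd-R n s eq = *-cancelˡ-≡ _ _ (Cₒ n * α′ n) ⦃ m*n≢0 (Cₒ n) (α′ n) ⦃ Cₒ-nonZero n ⦄ ⦃ α′-nonZero n ⦄ ⦄ (begin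
  Cₒ n * α′ n * (s * denominator n)                     ≡⟨ lemma₁ (Cₒ n * α′ n) s (denominator n) ⟩
  s * (Cₒ n * α′ n) * denominator n                     ≡⟨ cong (_* denominator n) eq ⟩
  Dₒ n * (diagonal₃ n * spread 3 n) * denominator n     ≡⟨ lemma₂ (Dₒ n) (diagonal₃ n) (spread 3 n) (denominator n) ⟩
  Dₒ n * spread 3 n * denominator n * diagonal₃ n       ≡⟨ cong (_* diagonal₃ n) (odd-product 3 n) ⟩
  Cₒ n * (2 ^ xₒ n * numerator 3 n) * diagonal₃ n       ≡⟨ lemma₃ (Cₒ n) (2 ^ xₒ n) (numerator 3 n) (diagonal₃ n) ⟩
  Cₒ n * 2 ^ xₒ n * (diagonal₃ n * numerator 3 n)       ≡⟨ cong (Cₒ n * 2 ^ xₒ n *_) (numerator-shift n) ⟩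
  Cₒ n * 2 ^ xₒ n * (α′ n * numerator 1 n)              ≡⟨ lemma₄ (Cₒ n) (2 ^ xₒ n) (α′ n) (numerator 1 n) ⟩
  Cₒ n * α′ n * (2 ^ xₒ n * numerator 1 n)              ∎)
  where
  lemma₁ : ∀ c s p → c * (s * p) ≡ s * c * p
  lemma₁ = solve-∀
  lemma₂ : ∀ d w s p → d * (w * s) * p ≡ d * s * p * w
  lemma₂ = solve-∀
  lemma₃ : ∀ c e m w → c * (e * m) * w ≡ c * e * (w * m)
  lemma₃ = solve-∀
  lemma₄ : ∀ c e a m → c * e * (a * m) ≡ c * a * (e * m)
  lemma₄ = solve-∀

pair : ∀ (X : ℕ → Region) {i j i′ j′} t t′ p {x} → .⦃ NonZero p ⦄ → i ≡ i′ → j ≡ j′ →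
  NumTilings (X i) t → NumTilings (X j) t′ → t * p ≡ x → t′ * p ≡ x →
  Σ ℕ λ t → NumTilings (X i′) t × NumTilings (X j′) t × t * p ≡ x
pair X {j = j} t t′ p refl refl num num′ e e′ =
  t , num , subst (NumTilings (X j)) (*-cancelʳ-≡ t′ t p (trans e′ (sym e))) num′ , e

module _ (n : ℕ) where

  -- Row 0 has n + 1 empty sites against n functions; in the next lemma it has n cells against n + 1
  -- functions.
  R-1-empty : NumTilings (R (1 + n * 4)) 0
  R-1-empty = subst (NumTilings (R (1 + n * 4)))
    (formula-zero ⦃ m*n≢0 (Cₒ n) (α′ n) ⦃ Cₒ-nonZero n ⦄ ⦃ α′-nonZero n ⦄ ⦄ (hole0 (n * 2) n) {false} (trans (zeros-alt 0 false (1 + n * 2)) (ones-true-odd 0 n)) 1+n≢n)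
    (num-R (fits1 n))

  R-2-empty : NumTilings (R (2 + n * 4)) 0
  R-2-empty = subst (NumTilings (R (2 + n * 4)))
    (formula-zero ⦃ Cₑ-nonZero (suc n) ⦄ (part0′ (1 + n * 2) n) {false} (ones-false-odd 0 n) (1+n≢n ∘ sym))
    (num-R (fits2 n))

index-1 : ∀ n → 1 + n * 4 ≡ 4 * n + 1
index-1 = solve-∀
index-2 : ∀ n → 2 + n * 4 ≡ 4 * n + 2
index-2 = solve-∀
index-0 : ∀ n → n * 4 ≡ 4 * n
index-0 = solve-∀

module _ (k : ℕ) where
  private
    n = suc k
    index : ∀ i → i ≤ 4 → 4 ∸ i + k * 4 ≡ 4 * n ∸ i
    index i le = sym (trans (cong (_∸ i) (sym (index-0 n))) (+-∸-comm (k * 4) le))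
    instance
      dn : NonZero (denominator n)
      dn = denominator-nonZero n
      dl : NonZero (denominatorLe n)
      dl = subst NonZero (sym (denominatorLe≡ n)) (m*n≢0 (denominator n) (α′ n) ⦃ denominator-nonZero n ⦄ ⦃ α′-nonZero n ⦄)

  R-part : Σ ℕ λ t → Σ ℕ λ s →
    NumTilings (R (4 * n)) t × NumTilings (R (4 * n ∸ 1)) s × t ≡ 2 ^ n * s ×
    t * denominator n ≡ 2 ^ ⌊ n * (3 * n ∸ 1) /2⌋ * numerator 1 n
  R-part = t , s ,
    subst (λ m → NumTilings (R m) t) (index-0 n) (num-R (fits0 n)) ,
    subst (λ m → NumTilings (R m) s) (index 1 (s≤s z≤n)) (num-R (fits3 k)) ,
    *-cancelʳ-≡ _ _ (denominator n) ratio , t-formula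
    where
    t s : ℕ
    t = count (Even.len (n * 2)) c0 (n * 4) (alt false (n * 2))
    s = count (Odd.len (1 + k * 2)) c0 (3 + k * 4) (alt false (n * 2))
    t-formula : t * denominator n ≡ 2 ^ ⌊ n * (3 * n ∸ 1) /2⌋ * numerator 1 n
    t-formula = even-ev 1 n t (trans (formula-at (part0 (n * 2) n) {false} (ones-false-even 0 n)) (cong (Dₑ n *_) (∣det-ev∣ 1 1 refl n)))
    s-formula : s * denominator n ≡ 2 ^ xₒ n * numerator 1 n
    s-formula = odd-R n s (trans (formula-at (hole0′ (1 + k * 2) k) {false} (trans (zeros-alt 0 false (n * 2)) (ones-true-even 0 n))) (cong (Dₒ n *_) (∣det-od∣ 0 3 refl n)))
    ratio : t * denominator n ≡ 2 ^ n * s * denominator n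
    ratio = begin
      t * denominator n                                ≡⟨ t-formula ⟩
      2 ^ ⌊ n * (3 * n ∸ 1) /2⌋ * numerator 1 n        ≡⟨ cong (λ x → 2 ^ x * numerator 1 n) (xₑ-closed n) ⟩
      2 ^ xₑ n * numerator 1 n                         ≡⟨ cong (_* numerator 1 n) (xₑ≡n+xₒ n) ⟩
      2 ^ n * 2 ^ xₒ n * numerator 1 n                 ≡⟨ *-assoc (2 ^ n) _ _ ⟩
      2 ^ n * (2 ^ xₒ n * numerator 1 n)               ≡⟨ cong (2 ^ n *_) (sym s-formula) ⟩
      2 ^ n * (s * denominator n)                      ≡⟨ sym (*-assoc (2 ^ n) s _) ⟩
      2 ^ n * s * denominator n                        ∎

  -- For both orders row 0 consists of n cells at the positions 1, 5, 9, ..., and the constants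
  -- agree, so the two counts satisfy the same equation.
  Ka-even : Σ ℕ λ t → NumTilings (Ka (4 * n ∸ 2)) t × NumTilings (Ka (4 * n)) t ×
    t * denominator n ≡ 2 ^ ⌊ n * (3 * n ∸ 1) /2⌋ * numerator 3 n
  Ka-even = pair Ka t t′ (denominator n) (index 2 (s≤s (s≤s z≤n))) (index-0 n) (num-Ka (fits2 k)) (num-Ka (fits0 n))
    (even-ev 3 n t (trans (formula-at (part0′ (1 + k * 2) k) {true} (ones-true-odd 0 k)) (cong (Dₑ n *_) (∣det-ev∣ 0 3 refl n))))
    (even-ev 3 n t′ (trans (formula-at (part0 (n * 2) n) {true} (ones-true-even 0 n)) (cong (Dₑ n *_) (∣det-ev∣ 0 3 refl n))))
    where
    t t′ : ℕ
    t  = count (Even.len (1 + k * 2)) c0 (2 + k * 4) (alt true (1 + k * 2))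
    t′ = count (Even.len (n * 2)) c0 (n * 4) (alt true (n * 2))

  Ka-odd : Σ ℕ λ t → NumTilings (Ka (4 * n ∸ 1)) t × NumTilings (Ka (4 * n + 1)) t ×
    t * denominatorLe n ≡ 2 ^ ⌊ n * (3 * n ∸ 3) /2⌋ * numeratorLe n
  Ka-odd = pair Ka t t′ (denominatorLe n) (index 1 (s≤s z≤n)) (index-1 n) (num-Ka (fits3 k)) (num-Ka (fits1 n))
    (odd-od n t (trans (formula-at (hole0′ (1 + k * 2) k) {true} (trans (zeros-alt 0 true (n * 2)) (ones-false-even 0 n))) (cong (Dₒ n *_) (∣det-od∣ 1 1 refl n))))
    (odd-od n t′ (trans (formula-at (hole0 (n * 2) n) {true} (trans (zeros-alt 0 true (1 + n * 2)) (ones-false-odd 0 n))) (cong (Dₒ n *_) (∣det-od∣ 1 1 refl n))))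
    where
    t t′ : ℕ
    t  = count (Odd.len (1 + k * 2)) c0 (3 + k * 4) (alt true (n * 2))
    t′ = count (Odd.len (n * 2)) c0 (1 + n * 4) (alt true (1 + n * 2))

  Kna-even : Σ ℕ λ t → NumTilings (Kna (4 * n)) t × NumTilings (Kna (4 * n + 2)) t ×
    t * denominatorLe n ≡ 2 ^ ⌊ n * (3 * n ∸ 1) /2⌋ * numeratorLe n
  Kna-even = pair Kna t t′ (denominatorLe n) (index-0 n) (index-2 n) (num-Kna (fits0 n)) (num-Kna (fits2 n))
    (even-od n t (trans (formula-at (part2′ (n * 2) k) {false} (ones-false-even 0 n)) (cong (Dₑ n * τ n *_) (∣det-od∣ 1 1 refl n))))
    (even-od n t′ (trans (formula-at (part2 (1 + n * 2) n) {false} (ones-false-odd 0 n)) (cong (Dₑ n * τ n *_) (∣det-od∣ 1 1 refl n))))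
    where
    t t′ : ℕ
    t  = count (Even.len (n * 2)) c2 (n * 4) (alt false (n * 2))
    t′ = count (Even.len (1 + n * 2)) c2 (2 + n * 4) (alt false (1 + n * 2))

  Kna-odd : Σ ℕ λ t → NumTilings (Kna (4 * n ∸ 3)) t × NumTilings (Kna (4 * n ∸ 1)) t ×
    t * denominator n ≡ 2 ^ ⌊ n * (3 * n ∸ 3) /2⌋ * numerator 3 n
  Kna-odd = pair Kna t t′ (denominator n) (index 3 (s≤s (s≤s (s≤s z≤n)))) (index 1 (s≤s z≤n)) (num-Kna (fits1 k)) (num-Kna (fits3 k))
    (odd-ev 3 n t (trans (formula-at (hole2′ (k * 2) k) {false} (trans (zeros-alt 0 false (1 + k * 2)) (ones-true-odd 0 k))) (cong (Dₒ n *_) (∣det-ev∣ 0 3 refl n))))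
    (odd-ev 3 n t′ (trans (formula-at (hole2 (1 + k * 2) k) {false} (trans (zeros-alt 0 false (n * 2)) (ones-true-even 0 n))) (cong (Dₒ n *_) (∣det-ev∣ 0 3 refl n))))
    where
    t t′ : ℕ
    t  = count (Odd.len (k * 2)) c2 (1 + k * 4) (alt false (1 + k * 2))
    t′ = count (Odd.len (1 + k * 2)) c2 (3 + k * 4) (alt false (n * 2))

theorem1 : ((n : ℕ) → NumTilings (R (4 * n + 1)) 0 × NumTilings (R (4 * n + 2)) 0) ×
    ((n : ℕ) → 1 ≤ n →
    (Σ ℕ λ t → Σ ℕ λ s →
    NumTilings (R (4 * n)) t × NumTilings (R (4 * n ∸ 1)) s × t ≡ 2 ^ n * s ×
    t * prodLt n (λ i j → i + j ∸ 1)
    ≡ 2 ^ ⌊ n * (3 * n ∸ 1) /2⌋ * prodLt n (λ i j → 2 * i + 2 * j ∸ 1)) ×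
    (Σ ℕ λ t →
    NumTilings (Ka (4 * n ∸ 2)) t × NumTilings (Ka (4 * n)) t ×
    t * prodLt n (λ i j → i + j ∸ 1)
    ≡ 2 ^ ⌊ n * (3 * n ∸ 1) /2⌋ * prodLt n (λ i j → 2 * i + 2 * j ∸ 3)) ×
    (Σ ℕ λ t →
    NumTilings (Ka (4 * n ∸ 1)) t × NumTilings (Ka (4 * n + 1)) t ×
    t * prodLe n (λ i j → i + j ∸ 1)
    ≡ 2 ^ ⌊ n * (3 * n ∸ 3) /2⌋ * prodLe n (λ i j → 2 * i + 2 * j ∸ 1)) ×
    (Σ ℕ λ t →
    NumTilings (Kna (4 * n)) t × NumTilings (Kna (4 * n + 2)) t ×
    t * prodLe n (λ i j → i + j ∸ 1)
    ≡ 2 ^ ⌊ n * (3 * n ∸ 1) /2⌋ * prodLe n (λ i j → 2 * i + 2 * j ∸ 1)) ×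
    (Σ ℕ λ t →
    NumTilings (Kna (4 * n ∸ 3)) t × NumTilings (Kna (4 * n ∸ 1)) t ×
    t * prodLt n (λ i j → i + j ∸ 1)
    ≡ 2 ^ ⌊ n * (3 * n ∸ 3) /2⌋ * prodLt n (λ i j → 2 * i + 2 * j ∸ 3)))
theorem1 =
  (λ n → subst (λ m → NumTilings (R m) 0) (index-1 n) (R-1-empty n) , subst (λ m → NumTilings (R m) 0) (index-2 n) (R-2-empty n)) ,
  λ { (suc k) _ → R-part k , Ka-even k , Ka-odd k , Kna-even k , Kna-odd k }
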